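{- Let $\mathcal C(\mathbb Z[X])$ be the set of polynomials $f\in\mathbb Z[X]$ with $f=0$ or $f>0$, where $\mathbb Z[X]$ is ordered by declaring a nonzero polynomial positive iff its leading coefficient is positive, viewed as a structure for $\{+,\cdot,0,1,<\}$. Then $\mathcal C(\mathbb Z[X])$ satisfies $\mathbf{GS}^s$: for every prime $p$ there exists $n$ such that $n$ is $p$-good and no $m$ with $n<m$ is $p$-good.
   Context: In a structure for $\{+,\cdot,0,1,<\}$: $x\mid y$ means $\exists z\,(xz=y)$; $m,n$ are relatively prime if every common divisor of $m$ and $n$ equals $1$; $x$ is prime means $1<x$ and for all $a,b,c$, if $xc=ab$ then $x\mid a$ or $x\mid b$. For a prime $p$, an element $n$ is $p$-good if every $t$ with $1<t<n$, $t$ relatively prime to $n$, and $v$ relatively prime to $t$ for every prime $v\le p$, is prime. -}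

module Defs where

open import Data.Bool using (Bool; true; false; not; T; if_then_else_)
open import Data.Unit using (tt)
open import Data.Nat using (suc)
open import Data.List using (List; []; _∷_; map)
open import Data.Integer as ℤ using (ℤ; 0ℤ; 1ℤ)
open import Data.Product using (Σ; ∃; _×_; _,_; proj₁)
open import Data.Sum using (_⊎_)
open import Relation.Nullary using (¬_; yes; no)
open import Relation.Nullary.Decidable using (⌊_⌋)
open import Relation.Binary.PropositionalEquality using (_≡_)

-- Z[X]: polynomials as coefficient lists (constant term first) in
-- canonical form (no trailing zero coefficient), so that equality of
-- polynomials is propositional equality _≡_.

isZero : ℤ → Bool
isZero (ℤ.+ 0) = true
isZero _       = false

isNorm : List ℤ → Bool
isNorm []           = true
isNorm (a ∷ [])     = not (isZero a)
isNorm (a ∷ b ∷ l)  = isNorm (b ∷ l)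

cons : ℤ → List ℤ → List ℤ
cons a []      = if isZero a then [] else a ∷ []
cons a (b ∷ l) = a ∷ b ∷ l

norm : List ℤ → List ℤ
norm []      = []
norm (a ∷ l) = cons a (norm l)

cons-norm : ∀ a l → T (isNorm l) → T (isNorm (cons a l))
cons-norm (ℤ.+ 0)         [] _ = tt
cons-norm (ℤ.+ (suc n))   [] _ = tt
cons-norm (ℤ.-[1+ n ])    [] _ = tt
cons-norm a (b ∷ l) h = h

norm-norm : ∀ l → T (isNorm (norm l))
norm-norm []      = tt
norm-norm (a ∷ l) = cons-norm a (norm l) (norm-norm l)

Poly : Set
Poly = Σ (List ℤ) (λ l → T (isNorm l))

mkP : List ℤ → Poly
mkP l = norm l , norm-norm l

addR : List ℤ → List ℤ → List ℤ
addR []      q       = q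
addR (a ∷ p) []      = a ∷ p
addR (a ∷ p) (b ∷ q) = (a ℤ.+ b) ∷ addR p q

mulR : List ℤ → List ℤ → List ℤ
mulR []      q = []
mulR (a ∷ p) q = addR (map (a ℤ.*_) q) (0ℤ ∷ mulR p q)

negR : List ℤ → List ℤ
negR = map (λ a → ℤ.- a)

infixl 6 _+P_ _-P_
infixl 7 _*P_
infix 4 _<P_ _≤P_ _∣C_

_+P_ : Poly → Poly → Poly
f +P g = mkP (addR (proj₁ f) (proj₁ g))

_-P_ : Poly → Poly → Poly
f -P g = mkP (addR (proj₁ f) (negR (proj₁ g)))

_*P_ : Poly → Poly → Poly
f *P g = mkP (mulR (proj₁ f) (proj₁ g))

0P 1P : Poly
0P = mkP []
1P = mkP (1ℤ ∷ [])

lastR : List ℤ → ℤ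
lastR []          = 0ℤ
lastR (a ∷ [])    = a
lastR (a ∷ b ∷ l) = lastR (b ∷ l)

lead : Poly → ℤ
lead f = lastR (proj₁ f)

Pos : Poly → Set
Pos f = 0ℤ ℤ.< lead f

_<P_ : Poly → Poly → Set
f <P g = Pos (g -P f)

_≤P_ : Poly → Poly → Set
f ≤P g = f <P g ⊎ f ≡ g

-- C(Z[X]) = { f | f = 0 or f > 0 }, a substructure for {+,·,0,1,<};
-- quantifiers of the structure range over elements satisfying InC.

InC : Poly → Set
InC f = f ≡ 0P ⊎ 0P <P f

_∣C_ : Poly → Poly → Set
x ∣C y = Σ Poly (λ z → InC z × x *P z ≡ y)

RelPrimeC : Poly → Poly → Set
RelPrimeC m n = ∀ d → InC d → d ∣C m → d ∣C n → d ≡ 1P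

PrimeC : Poly → Set
PrimeC x = 1P <P x ×
  (∀ a b c → InC a → InC b → InC c → x *P c ≡ a *P b → x ∣C a ⊎ x ∣C b)

GoodC : Poly → Poly → Set
GoodC p n = ∀ t → InC t → 1P <P t → t <P n → RelPrimeC t n →
  (∀ v → InC v → PrimeC v → v ≤P p → RelPrimeC v t) → PrimeC t

{-# OPTIONS --safe #-}
module Submission where

-- For n in 𝒞(ℤ[X]), n is p-good iff q² ≥ n for every prime q > p not dividing n:
-- a failing q makes t = q² a counterexample, and conversely a non-prime t = gh has
-- prime factors v | g and w | h above p, not dividing n, the smaller of which has
-- square at most t < n. This rests on deciding whether an element above 1 is prime
-- or a proper product: factors have bounded coefficients, and an irreducible
-- element is prime by Gauss's lemma and Euclid's algorithm over ℚ.
--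
-- For constant p = k, no nonconstant n is good, and a constant n is not good once
-- some prime q > k not dividing n satisfies q² < n. Such q exists for all large n,
-- as otherwise all small primes divide n k!, whose logarithmic power is then a
-- common multiple of 1, …, x that is smaller than 2^(x/2). So the largest good n
-- is found by search.
--
-- For nonconstant p, the primes following p are translates p + j; infinitely many
-- exist, as p + j is irreducible when its constant term is a prime exceeding the
-- sum of the other coefficients. If u₁ < u₂ are the first two, then
-- n₀ = u₁(2u₂ − u₁) < u₂² is good. A larger good m would be divisible by u₁,
-- hence m > u₂² and m is divisible by u₂, hence m ≥ 2u₁u₂, which exceeds the
-- square of every translate of p, although some prime translate does not divide m.

open import Defs
open import Algebra.Properties.CommutativeSemigroup using (interchange)
import Algebra.Solver.Ring
open import Algebra.Bundles using (CommutativeRing)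
open import Algebra.Solver.Ring.AlmostCommutativeRing using (fromCommutativeRing; _-Raw-AlmostCommutative⟶_)
open import Data.Bool using (T)
open import Data.Bool.Properties using (T-irrelevant)
open import Data.Empty using (⊥; ⊥-elim)
open import Data.Integer as ℤ using (ℤ; 0ℤ; 1ℤ; +_; -[1+_]; ∣_∣; +<+)
open import Data.Integer.Divisibility.Signed using (∣ᵤ⇒∣; divides)
import Data.Integer.Properties as ℤ
open import Data.Integer.Tactic.RingSolver using (solve-∀)
open import Data.List using (List; []; _∷_; map; length; cartesianProductWith; _++_; upTo)
open import Data.List.Membership.Propositional using (_∈_; lose; find)
import Data.List.Membership.Propositional.Properties as ∈
import Data.List.Properties
open import Data.List.Relation.Unary.All using (All; []; _∷_)
open import Data.List.Relation.Unary.Any using (Any; here; there; any?)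
import Data.Maybe
open import Data.Nat as ℕ using (ℕ; zero; suc; z≤n; s≤s; _!)
import Data.Nat.Divisibility as ℕ
open import Data.Nat.ListAction using (product)
open import Data.Nat.Primality using (Prime; Composite; prime?; euclidsLemma; prime⇒nonTrivial; prime⇒irreducible; ¬prime⇒composite)
open import Data.Nat.Primality.Factorisation using (factorise)
import Data.Nat.Properties as ℕ
import Data.Nat.Tactic.RingSolver as ℕ-Ring
open import Data.Product using (Σ; ∃; _×_; _,_; proj₁; proj₂)
open import Data.Sum using (_⊎_; inj₁; inj₂; map₁; map₂)
open import Data.Unit using (tt)
import Data.Vec
open import Data.Vec.N-ary using (N-ary; Eq; curryⁿ; curryⁿ-cong; _$ⁿ_)
open import Relation.Binary.Definitions using (Tri; tri<; tri≈; tri>)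
open import Relation.Binary.PropositionalEquality hiding ([_])
open import Relation.Nullary using (¬_; yes; no; Dec; ¬?)
open import Relation.Nullary.Decidable using (_×-dec_; dec⇒maybe; decidable-stable; toWitness)

-- ℤ[X] as a commutative ring

-- The order is not Archimedean: a nonconstant positive polynomial exceeds every constant. Hence an
-- element above p is either p plus a positive constant or larger than all translates of p. For
-- nonconstant p this replaces any estimate on the distribution of primes: n₀ misses u₂² only by the
-- constant (u₂ - u₁)², whereas consecutive multiples of u₁ differ by the nonconstant u₁. So three
-- primes, u₁, u₂ and one more translate, rule out every larger element.
--
-- Goodness asks for a proof that t is prime, and without excluded middle it is not enough that t
-- has no factors in some weak sense; hence the decision procedure. Division is done over ℤ with
-- constant multipliers, which are later removed one integer prime at a time.
--
-- Two analytic arguments are replaced by integer ones. The lower bound for common multiples comes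
-- from the integral of (x(1 - x))^m over [0, 1], computed by recursion on factorials. The
-- irreducibility criterion, usually read off from complex roots lying outside the unit disc,
-- becomes a descent on the sum of the absolute values of the coefficients.

coef : List ℤ → ℕ → ℤ
coef []      _       = 0ℤ
coef (a ∷ l) zero    = a
coef (a ∷ l) (suc i) = coef l i

infix 4 _≈_
-- Raw lists may end in zeros, so the ring laws for `addR` and `mulR` are proved coefficientwise;
-- `normal-ext` turns them into equations in `Poly`.
_≈_ : List ℤ → List ℤ → Set
p ≈ q = ∀ i → coef p i ≡ coef q i

coef-cons : ∀ a l i → coef (cons a l) i ≡ coef (a ∷ l) i
coef-cons (+ zero)  []      zero    = refl
coef-cons (+ zero)  []      (suc i) = refl
coef-cons (+ suc n) []      i       = refl
coef-cons -[1+ n ]  []      i       = refl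
coef-cons a         (b ∷ l) i       = refl

coef-norm : ∀ l → norm l ≈ l
coef-norm []      i       = refl
coef-norm (a ∷ l) zero    = coef-cons a (norm l) zero
coef-norm (a ∷ l) (suc i) = trans (coef-cons a (norm l) (suc i)) (coef-norm l i)

isNorm-tail : ∀ a l → T (isNorm (a ∷ l)) → T (isNorm l)
isNorm-tail a []      _ = tt
isNorm-tail a (b ∷ l) h = h

normal-≈[] : ∀ a l → T (isNorm (a ∷ l)) → ¬ (a ∷ l ≈ [])
normal-≈[] a []      h e with e 0
normal-≈[] _ []      () e | refl
normal-≈[] a (b ∷ l) h e = normal-≈[] b l h (λ i → e (suc i))

normal-ext : ∀ p q → T (isNorm p) → T (isNorm q) → p ≈ q → p ≡ q
normal-ext []      []      _ _ _ = refl
normal-ext []      (b ∷ q) _ h e = ⊥-elim (normal-≈[] b q h (λ i → sym (e i)))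
normal-ext (a ∷ p) []      h _ e = ⊥-elim (normal-≈[] a p h e)
normal-ext (a ∷ p) (b ∷ q) h h′ e =
  cong₂ _∷_ (e 0) (normal-ext p q (isNorm-tail a p h) (isNorm-tail b q h′) (λ i → e (suc i)))

infix 9 _[_]
_[_] : Poly → ℕ → ℤ
f [ i ] = coef (proj₁ f) i

Σ-≡ : {f g : Poly} → proj₁ f ≡ proj₁ g → f ≡ g
Σ-≡ {l , h} {.l , h′} refl = cong (l ,_) (T-irrelevant h h′)

ext : {f g : Poly} → (∀ i → f [ i ] ≡ g [ i ]) → f ≡ g
ext {f} {g} e = Σ-≡ (normal-ext (proj₁ f) (proj₁ g) (proj₂ f) (proj₂ g) e)

mkP-[] : ∀ l i → mkP l [ i ] ≡ coef l i
mkP-[] = coef-norm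

mkP-proj₁ : ∀ f → mkP (proj₁ f) ≡ f
mkP-proj₁ f = ext (coef-norm (proj₁ f))

coef-addR : ∀ p q i → coef (addR p q) i ≡ coef p i ℤ.+ coef q i
coef-addR []      q       i       = sym (ℤ.+-identityˡ _)
coef-addR (a ∷ p) []      i       = sym (ℤ.+-identityʳ _)
coef-addR (a ∷ p) (b ∷ q) zero    = refl
coef-addR (a ∷ p) (b ∷ q) (suc i) = coef-addR p q i

coef-scale : ∀ c p i → coef (map (c ℤ.*_) p) i ≡ c ℤ.* coef p i
coef-scale c []      i       = sym (ℤ.*-zeroʳ c)
coef-scale c (a ∷ p) zero    = refl
coef-scale c (a ∷ p) (suc i) = coef-scale c p i

coef-negR : ∀ p i → coef (negR p) i ≡ ℤ.- coef p i
coef-negR []      i       = refl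
coef-negR (a ∷ p) zero    = refl
coef-negR (a ∷ p) (suc i) = coef-negR p i

mulR-zero : ∀ a p q → coef (mulR (a ∷ p) q) 0 ≡ a ℤ.* coef q 0
mulR-zero a p q = trans (coef-addR (map (a ℤ.*_) q) _ 0)
  (trans (ℤ.+-identityʳ _) (coef-scale a q 0))

mulR-suc : ∀ a p q i →
  coef (mulR (a ∷ p) q) (suc i) ≡ a ℤ.* coef q (suc i) ℤ.+ coef (mulR p q) i
mulR-suc a p q i = trans (coef-addR (map (a ℤ.*_) q) _ (suc i))
  (cong (ℤ._+ _) (coef-scale a q (suc i)))

mulR-[]ʳ : ∀ p → mulR p [] ≈ []
mulR-[]ʳ []      i       = refl
mulR-[]ʳ (a ∷ p) zero    = refl
mulR-[]ʳ (a ∷ p) (suc i) = mulR-[]ʳ p i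

mulR-congʳ : ∀ p {q q′} → q ≈ q′ → mulR p q ≈ mulR p q′
mulR-congʳ []      e i = refl
mulR-congʳ (a ∷ p) {q} {q′} e zero = trans (mulR-zero a p q)
  (trans (cong (a ℤ.*_) (e 0)) (sym (mulR-zero a p q′)))
mulR-congʳ (a ∷ p) {q} {q′} e (suc i) = trans (mulR-suc a p q i)
  (trans (cong₂ ℤ._+_ (cong (a ℤ.*_) (e (suc i))) (mulR-congʳ p e i))
    (sym (mulR-suc a p q′ i)))

mulR-zeroʳ : ∀ p b q → coef (mulR p (b ∷ q)) 0 ≡ b ℤ.* coef p 0
mulR-zeroʳ []      b q = sym (ℤ.*-zeroʳ b)
mulR-zeroʳ (a ∷ p) b q = trans (mulR-zero a p (b ∷ q)) (ℤ.*-comm a b)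

-- Recursion along the second factor, while `mulR` recurses on the first; the two together give
-- `mulR-comm`.
mulR-sucʳ : ∀ p b q i →
  coef (mulR p (b ∷ q)) (suc i) ≡ b ℤ.* coef p (suc i) ℤ.+ coef (mulR p q) i
mulR-sucʳ []      b q i = sym (trans (ℤ.+-identityʳ _) (ℤ.*-zeroʳ b))
mulR-sucʳ (a ∷ p) b q zero
  rewrite mulR-suc a p (b ∷ q) 0 | mulR-zeroʳ p b q | mulR-zero a p q
  = ℤ.+-comm (a ℤ.* coef q 0) (b ℤ.* coef p 0)
mulR-sucʳ (a ∷ p) b q (suc i)
  rewrite mulR-suc a p (b ∷ q) (suc i) | mulR-sucʳ p b q i | mulR-suc a p q i
  = swap (a ℤ.* coef q (suc i)) (b ℤ.* coef p (suc i)) (coef (mulR p q) i)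
  where
  swap : ∀ x y z → x ℤ.+ (y ℤ.+ z) ≡ y ℤ.+ (x ℤ.+ z)
  swap = solve-∀

mulR-comm : ∀ p q → mulR p q ≈ mulR q p
mulR-comm []      q i = sym (mulR-[]ʳ q i)
mulR-comm (a ∷ p) q zero = trans (mulR-zero a p q) (sym (mulR-zeroʳ q a p))
mulR-comm (a ∷ p) q (suc i)
  rewrite mulR-suc a p q i | mulR-comm p q i = sym (mulR-sucʳ q a p i)

mulR-congˡ : ∀ {p p′} q → p ≈ p′ → mulR p q ≈ mulR p′ q
mulR-congˡ {p} {p′} q e i =
  trans (mulR-comm p q i) (trans (mulR-congʳ q e i) (mulR-comm q p′ i))

mulR-distribʳ : ∀ r p q i →
  coef (mulR (addR p q) r) i ≡ coef (mulR p r) i ℤ.+ coef (mulR q r) i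
mulR-distribʳ r []      q       i = sym (ℤ.+-identityˡ _)
mulR-distribʳ r (a ∷ p) []      i = sym (ℤ.+-identityʳ _)
mulR-distribʳ r (a ∷ p) (b ∷ q) zero
  rewrite mulR-zero (a ℤ.+ b) (addR p q) r | mulR-zero a p r | mulR-zero b q r
  = ℤ.*-distribʳ-+ (coef r 0) a b
mulR-distribʳ r (a ∷ p) (b ∷ q) (suc i)
  rewrite mulR-suc (a ℤ.+ b) (addR p q) r i | mulR-suc a p r i | mulR-suc b q r i
        | mulR-distribʳ r p q i
  = lem a b (coef r (suc i)) (coef (mulR p r) i) (coef (mulR q r) i)
  where
  lem : ∀ a b c x y → (a ℤ.+ b) ℤ.* c ℤ.+ (x ℤ.+ y) ≡ (a ℤ.* c ℤ.+ x) ℤ.+ (b ℤ.* c ℤ.+ y)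
  lem = solve-∀

mulR-scale : ∀ c p q i → coef (mulR (map (c ℤ.*_) p) q) i ≡ c ℤ.* coef (mulR p q) i
mulR-scale c []      q i = sym (ℤ.*-zeroʳ c)
mulR-scale c (a ∷ p) q zero
  rewrite mulR-zero (c ℤ.* a) (map (c ℤ.*_) p) q | mulR-zero a p q = ℤ.*-assoc c a _
mulR-scale c (a ∷ p) q (suc i)
  rewrite mulR-suc (c ℤ.* a) (map (c ℤ.*_) p) q i | mulR-suc a p q i | mulR-scale c p q i
  = lem c a (coef q (suc i)) (coef (mulR p q) i)
  where
  lem : ∀ c a x y → c ℤ.* a ℤ.* x ℤ.+ c ℤ.* y ≡ c ℤ.* (a ℤ.* x ℤ.+ y)
  lem = solve-∀

mulR-assoc : ∀ p q r → mulR (mulR p q) r ≈ mulR p (mulR q r)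
mulR-assoc []      q r i = refl
mulR-assoc (a ∷ p) q r i
  rewrite mulR-distribʳ r (map (a ℤ.*_) q) (0ℤ ∷ mulR p q) i | mulR-scale a q r i = lem i
  where
  lem : ∀ i → a ℤ.* coef (mulR q r) i ℤ.+ coef (mulR (0ℤ ∷ mulR p q) r) i ≡
              coef (mulR (a ∷ p) (mulR q r)) i
  lem zero rewrite mulR-zero a p (mulR q r) | mulR-zero 0ℤ (mulR p q) r = ℤ.+-identityʳ _
  lem (suc i) rewrite mulR-suc a p (mulR q r) i | mulR-suc 0ℤ (mulR p q) r i | mulR-assoc p q r i
         | ℤ.+-identityˡ (coef (mulR p (mulR q r)) i) = refl

neg : Poly → Poly
neg f = mkP (negR (proj₁ f))

[+] : ∀ f g i → (f +P g) [ i ] ≡ f [ i ] ℤ.+ g [ i ]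
[+] f g i = trans (mkP-[] (addR (proj₁ f) (proj₁ g)) i) (coef-addR (proj₁ f) (proj₁ g) i)

[neg] : ∀ f i → neg f [ i ] ≡ ℤ.- f [ i ]
[neg] f i = trans (mkP-[] (negR (proj₁ f)) i) (coef-negR (proj₁ f) i)

[*] : ∀ f g i → (f *P g) [ i ] ≡ coef (mulR (proj₁ f) (proj₁ g)) i
[*] f g = mkP-[] (mulR (proj₁ f) (proj₁ g))

-P-neg : ∀ f g → f -P g ≡ f +P neg g
-P-neg f g = ext lem
  where
  lem : ∀ i → (f -P g) [ i ] ≡ (f +P neg g) [ i ]
  lem i rewrite [+] f (neg g) i | mkP-[] (negR (proj₁ g)) i
              | mkP-[] (addR (proj₁ f) (negR (proj₁ g))) i
    = coef-addR (proj₁ f) (negR (proj₁ g)) i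

+P-assoc : ∀ f g h → (f +P g) +P h ≡ f +P (g +P h)
+P-assoc f g h = ext lem
  where
  lem : ∀ i → ((f +P g) +P h) [ i ] ≡ (f +P (g +P h)) [ i ]
  lem i rewrite [+] (f +P g) h i | [+] f g i | [+] f (g +P h) i | [+] g h i
    = ℤ.+-assoc (f [ i ]) (g [ i ]) (h [ i ])

+P-comm : ∀ f g → f +P g ≡ g +P f
+P-comm f g = ext λ i → trans ([+] f g i) (trans (ℤ.+-comm (f [ i ]) (g [ i ])) (sym ([+] g f i)))

+P-identityˡ : ∀ f → 0P +P f ≡ f
+P-identityˡ f = mkP-proj₁ f

+P-inverseˡ : ∀ f → neg f +P f ≡ 0P
+P-inverseˡ f = ext lem
  where
  lem : ∀ i → (neg f +P f) [ i ] ≡ 0ℤ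
  lem i rewrite [+] (neg f) f i | [neg] f i = ℤ.+-inverseˡ (f [ i ])

*P-comm : ∀ f g → f *P g ≡ g *P f
*P-comm f g = ext λ i → trans ([*] f g i) (trans (mulR-comm (proj₁ f) _ i) (sym ([*] g f i)))

*P-assoc : ∀ f g h → (f *P g) *P h ≡ f *P (g *P h)
*P-assoc f g h = ext λ i → trans ([*] (f *P g) h i)
  (trans (mulR-congˡ {norm (mulR (proj₁ f) (proj₁ g))} {mulR (proj₁ f) (proj₁ g)}
            (proj₁ h) (mkP-[] (mulR (proj₁ f) (proj₁ g))) i)
  (trans (mulR-assoc (proj₁ f) (proj₁ g) (proj₁ h) i)
  (trans (mulR-congʳ (proj₁ f) (λ j → sym (mkP-[] (mulR (proj₁ g) (proj₁ h)) j)) i)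
    (sym ([*] f (g *P h) i)))))

*P-distribʳ : ∀ h f g → (f +P g) *P h ≡ (f *P h) +P (g *P h)
*P-distribʳ h f g = ext lem
  where
  lem : ∀ i → ((f +P g) *P h) [ i ] ≡ ((f *P h) +P (g *P h)) [ i ]
  lem i rewrite [*] (f +P g) h i | [+] (f *P h) (g *P h) i | [*] f h i | [*] g h i
              | mulR-congˡ {norm (addR (proj₁ f) (proj₁ g))} {addR (proj₁ f) (proj₁ g)}
                  (proj₁ h) (mkP-[] (addR (proj₁ f) (proj₁ g))) i
    = mulR-distribʳ (proj₁ h) (proj₁ f) (proj₁ g) i

*P-identityˡ : ∀ f → 1P *P f ≡ f
*P-identityˡ f = ext λ where
    zero    → trans ([*] 1P f 0) (trans (mulR-zero 1ℤ [] l) (ℤ.*-identityˡ _))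
    (suc i) → trans ([*] 1P f (suc i))
      (trans (mulR-suc 1ℤ [] l i) (trans (ℤ.+-identityʳ _) (ℤ.*-identityˡ _)))
  where l = proj₁ f

polyRing : CommutativeRing _ _
polyRing = record
  { Carrier = Poly ; _≈_ = _≡_ ; _+_ = _+P_ ; _*_ = _*P_ ; -_ = neg ; 0# = 0P ; 1# = 1P
  ; isCommutativeRing = record
    { isRing = record
      { +-isAbelianGroup = record
        { isGroup = record
          { isMonoid = record
            { isSemigroup = record
              { isMagma = record { isEquivalence = isEquivalence ; ∙-cong = cong₂ _+P_ }
              ; assoc = +P-assoc }
            ; identity = +P-identityˡ , λ f → trans (+P-comm f 0P) (+P-identityˡ f) }
          ; inverse = +P-inverseˡ , λ f → trans (+P-comm f (neg f)) (+P-inverseˡ f)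
          ; ⁻¹-cong = cong neg }
        ; comm = +P-comm }
      ; *-cong = cong₂ _*P_
      ; *-assoc = *P-assoc
      ; *-identity = *P-identityˡ , λ f → trans (*P-comm f 1P) (*P-identityˡ f)
      ; distrib = (λ h f g → trans (*P-comm h (f +P g))
                    (trans (*P-distribʳ h f g) (cong₂ _+P_ (*P-comm f h) (*P-comm g h))))
                , *P-distribʳ }
    ; *-comm = *P-comm } }

-- Constants, the indeterminate, and induction on coefficients

C : ℤ → Poly
C a = mkP (a ∷ [])

X : Poly
X = mkP (0ℤ ∷ 1ℤ ∷ [])

C-suc : ∀ a i → C a [ suc i ] ≡ 0ℤ
C-suc a i = mkP-[] (a ∷ []) (suc i)

C-zero : ∀ a → C a [ 0 ] ≡ a
C-zero a = mkP-[] (a ∷ []) 0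

C-+ : ∀ a b → C (a ℤ.+ b) ≡ C a +P C b
C-+ a b = ext lem
  where
  lem : ∀ i → C (a ℤ.+ b) [ i ] ≡ (C a +P C b) [ i ]
  lem zero    rewrite [+] (C a) (C b) 0 | C-zero a | C-zero b = C-zero (a ℤ.+ b)
  lem (suc i) rewrite [+] (C a) (C b) (suc i) | C-suc a i | C-suc b i = C-suc (a ℤ.+ b) i

[C*] : ∀ c f i → (C c *P f) [ i ] ≡ c ℤ.* f [ i ]
[C*] c f i = trans ([*] (C c) f i) (trans (mulR-congˡ {norm (c ∷ [])} {c ∷ []} (proj₁ f) (mkP-[] (c ∷ [])) i) (lem i))
  where
  lem : ∀ i → coef (mulR (c ∷ []) (proj₁ f)) i ≡ c ℤ.* f [ i ]
  lem zero    = mulR-zero c [] (proj₁ f)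
  lem (suc i) = trans (mulR-suc c [] (proj₁ f) i) (ℤ.+-identityʳ _)

C-* : ∀ a b → C (a ℤ.* b) ≡ C a *P C b
C-* a b = ext lem
  where
  lem : ∀ i → C (a ℤ.* b) [ i ] ≡ (C a *P C b) [ i ]
  lem zero    rewrite [C*] a (C b) 0 | C-zero b = C-zero (a ℤ.* b)
  lem (suc i) rewrite [C*] a (C b) (suc i) | C-suc b i | ℤ.*-zeroʳ a = C-suc (a ℤ.* b) i

C-neg : ∀ a → C (ℤ.- a) ≡ neg (C a)
C-neg a = ext lem
  where
  lem : ∀ i → C (ℤ.- a) [ i ] ≡ neg (C a) [ i ]
  lem zero    rewrite [neg] (C a) 0 | C-zero a = C-zero (ℤ.- a)
  lem (suc i) rewrite [neg] (C a) (suc i) | C-suc a i = C-suc (ℤ.- a) i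

C-injective : ∀ {a b} → C a ≡ C b → a ≡ b
C-injective {a} {b} e = trans (sym (C-zero a)) (trans (cong (_[ 0 ]) e) (C-zero b))

[X*]-zero : ∀ f → (X *P f) [ 0 ] ≡ 0ℤ
[X*]-zero f = trans ([*] X f 0) (mulR-zero 0ℤ (1ℤ ∷ []) (proj₁ f))

[X*]-suc : ∀ f i → (X *P f) [ suc i ] ≡ f [ i ]
[X*]-suc f i = trans ([*] X f (suc i)) (trans (mulR-suc 0ℤ (1ℤ ∷ []) (proj₁ f) i)
  (trans (ℤ.+-identityˡ _) (trans (sym ([*] 1P f i)) (cong (_[ i ]) (*P-identityˡ f)))))

[C+X*]-zero : ∀ a f → (C a +P X *P f) [ 0 ] ≡ a
[C+X*]-zero a f rewrite [+] (C a) (X *P f) 0 | C-zero a | [X*]-zero f = ℤ.+-identityʳ a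

[C+X*]-suc : ∀ a f i → (C a +P X *P f) [ suc i ] ≡ f [ i ]
[C+X*]-suc a f i rewrite [+] (C a) (X *P f) (suc i) | C-suc a i | [X*]-suc f i = ℤ.+-identityˡ (f [ i ])

mkP-∷ : ∀ a l → mkP (a ∷ l) ≡ C a +P X *P mkP l
mkP-∷ a l = ext λ where
  zero    → trans (mkP-[] (a ∷ l) 0) (sym ([C+X*]-zero a (mkP l)))
  (suc i) → trans (mkP-[] (a ∷ l) (suc i))
              (sym (trans ([C+X*]-suc a (mkP l) i) (mkP-[] l i)))

tl : Poly → Poly
tl ([]    , _) = 0P
tl (a ∷ l , h) = l , isNorm-tail a l h

[tl] : ∀ f i → tl f [ i ] ≡ f [ suc i ]
[tl] ([]    , _) i = refl
[tl] (a ∷ l , h) i = refl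

split : ∀ f → f ≡ C (f [ 0 ]) +P X *P tl f
split f = ext λ where
  zero    → sym ([C+X*]-zero (f [ 0 ]) (tl f))
  (suc i) → sym (trans ([C+X*]-suc (f [ 0 ]) (tl f) i) ([tl] f i))

-- Lets inductions work with ring expressions instead of normalised lists. The step may return to 0,
-- since a and f can both vanish.
Poly-ind : ∀ {ℓ} (P : Poly → Set ℓ) → P 0P → (∀ a f → P f → P (C a +P X *P f)) → ∀ f → P f
Poly-ind P z s f = subst P (mkP-proj₁ f) (go (proj₁ f))
  where
  go : ∀ l → P (mkP l)
  go []      = z
  go (a ∷ l) = subst P (sym (mkP-∷ a l)) (s a (mkP l) (go l))

X*-cancel : ∀ {f g} → X *P f ≡ X *P g → f ≡ g
X*-cancel {f} {g} e = ext λ i →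
  trans (sym ([X*]-suc f i)) (trans (cong (_[ suc i ]) e) ([X*]-suc g i))

C*-cancel : ∀ {c f g} → c ≢ 0ℤ → C c *P f ≡ C c *P g → f ≡ g
C*-cancel {c} {f} {g} c≢0 e = ext λ i → ℤ.*-cancelˡ-≡ c (f [ i ]) (g [ i ]) ⦃ ℤ.≢-nonZero c≢0 ⦄
  (trans (sym ([C*] c f i)) (trans (cong (_[ i ]) e) ([C*] c g i)))

_≟P_ : (f g : Poly) → Dec (f ≡ g)
(p , h) ≟P (q , k) with Data.List.Properties.≡-dec ℤ._≟_ p q
... | yes e = yes (Σ-≡ e)
... | no ¬e = no λ e → ¬e (cong proj₁ e)

constants : ℤ.+-*-rawRing -Raw-AlmostCommutative⟶ fromCommutativeRing polyRing
constants = record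
  { ⟦_⟧ = C ; +-homo = C-+ ; *-homo = C-* ; -‿homo = C-neg ; 0-homo = refl ; 1-homo = refl }

module Solver = Algebra.Solver.Ring ℤ.+-*-rawRing (fromCommutativeRing polyRing) constants
  (λ a b → Data.Maybe.map (cong C) (dec⇒maybe (a ℤ.≟ b)))
open Solver using (Polynomial; con; _:+_; _:*_; _:-_; :-_; _:=_)

close : ∀ n → N-ary n (Polynomial n) (Polynomial n × Polynomial n) → Polynomial n × Polynomial n
close n f = f $ⁿ Data.Vec.map Solver.var (Data.Vec.allFin n)

-- The library's solve compares the interpretations of the two normal forms;
-- comparing the normal forms themselves keeps the type checker from unfolding
-- the polynomial operations.
solve : ∀ n (f : N-ary n (Polynomial n) (Polynomial n × Polynomial n)) →
        let e = close n f in
        Solver.normalise (proj₁ e) ≡ Solver.normalise (proj₂ e) →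
        Eq n _≡_ (curryⁿ Solver.⟦ proj₁ e ⟧) (curryⁿ Solver.⟦ proj₂ e ⟧)
solve n f eq = curryⁿ-cong _≡_ Solver.⟦ e₁ ⟧ Solver.⟦ e₂ ⟧
  (λ ρ → Solver.prove ρ e₁ e₂ (cong (λ p → Solver.⟦ p ⟧N ρ) eq))
  where
  e₁ = proj₁ (close n f)
  e₂ = proj₂ (close n f)

-- Degree and order

-- An upper bound rather than the degree itself: it covers 0 and survives sums in which leading
-- terms cancel.
DegBelow : Poly → ℕ → Set
DegBelow f n = ∀ i → n ℕ.≤ i → f [ i ] ≡ 0ℤ

degBelow-length : ∀ f → DegBelow f (length (proj₁ f))
degBelow-length f = go (proj₁ f)
  where
  go : ∀ l i → length l ℕ.≤ i → coef l i ≡ 0ℤ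
  go []      i       _       = refl
  go (a ∷ l) (suc i) (s≤s h) = go l i h

coef-length : ∀ a l → coef (a ∷ l) (length l) ≡ lastR (a ∷ l)
coef-length a []      = refl
coef-length a (b ∷ l) = coef-length b l

lastR≢0 : ∀ a l → T (isNorm (a ∷ l)) → lastR (a ∷ l) ≢ 0ℤ
lastR≢0 a []      h e with a
lastR≢0 a []      () refl | _
lastR≢0 a (b ∷ l) h = lastR≢0 b l h

top : ∀ f → f ≡ 0P ⊎ ∃ λ n → DegBelow f (suc n) × f [ n ] ≢ 0ℤ × f [ n ] ≡ lead f
top ([]    , tt) = inj₁ refl
top f@(a ∷ l , h) = inj₂ (length l , degBelow-length f
  , (λ e → lastR≢0 a l h (trans (sym (coef-length a l)) e)) , coef-length a l)

Pos⇒top : ∀ {f} → Pos f → ∃ λ n → DegBelow f (suc n) × 0ℤ ℤ.< f [ n ]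
Pos⇒top {f} p with top f
... | inj₁ refl = ⊥-elim (ℤ.<-irrefl refl p)
... | inj₂ (n , D , _ , e) = n , D , subst (0ℤ ℤ.<_) (sym e) p

top-unique : ∀ {f m n} → DegBelow f (suc m) → f [ m ] ≢ 0ℤ → DegBelow f (suc n) → f [ n ] ≢ 0ℤ → m ≡ n
top-unique {f} {m} {n} Dm m≢ Dn n≢ with ℕ.<-cmp m n
... | tri< lt _ _ = ⊥-elim (n≢ (Dm n lt))
... | tri≈ _ eq _ = eq
... | tri> _ _ gt = ⊥-elim (m≢ (Dn m gt))

top⇒Pos : ∀ {f} n → DegBelow f (suc n) → 0ℤ ℤ.< f [ n ] → Pos f
top⇒Pos {f} n D p with top f
... | inj₁ refl = ⊥-elim (ℤ.<-irrefl refl p)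
... | inj₂ (m , D′ , ≢0 , e) with top-unique {f} D (λ e → ℤ.<-irrefl (sym e) p) D′ ≢0
...   | refl = subst (0ℤ ℤ.<_) e p

degBelow-≤ : ∀ {f m n} → m ℕ.≤ n → DegBelow f m → DegBelow f n
degBelow-≤ m≤n D i n≤i = D i (ℕ.≤-trans m≤n n≤i)

degBelow-+ : ∀ {f g n} → DegBelow f n → DegBelow g n → DegBelow (f +P g) n
degBelow-+ {f} {g} Df Dg i n≤i rewrite [+] f g i | Df i n≤i | Dg i n≤i = refl

degBelow-neg : ∀ {f n} → DegBelow f n → DegBelow (neg f) n
degBelow-neg {f} Df i n≤i rewrite [neg] f i | Df i n≤i = refl

degBelow-X* : ∀ {f n} → DegBelow f n → DegBelow (X *P f) (suc n)
degBelow-X* {f} Df (suc i) (s≤s n≤i) = trans ([X*]-suc f i) (Df i n≤i)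

degBelow-C : ∀ c → DegBelow (C c) 1
degBelow-C c (suc i) _ = C-suc c i

degBelow-tl : ∀ {f n} → DegBelow f (suc n) → DegBelow (tl f) n
degBelow-tl {f} D i n≤i = trans ([tl] f i) (D (suc i) (s≤s n≤i))

degBelow-0 : ∀ {f} → DegBelow f 0 → f ≡ 0P
degBelow-0 D = ext λ i → D i z≤n

degBelow-1 : ∀ {f} → DegBelow f 1 → f ≡ C (f [ 0 ])
degBelow-1 {f} D = ext λ where
  zero    → sym (C-zero (f [ 0 ]))
  (suc i) → trans (D (suc i) (s≤s z≤n)) (sym (C-suc (f [ 0 ]) i))

[*]-zero : ∀ f g → (f *P g) [ 0 ] ≡ f [ 0 ] ℤ.* g [ 0 ]
[*]-zero ([]    , _)   g = sym (ℤ.*-zeroˡ (g [ 0 ]))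
[*]-zero f@(a ∷ l , _) g = trans ([*] f g 0) (mulR-zero a l (proj₁ g))

[*]-suc : ∀ f g i → (f *P g) [ suc i ] ≡ f [ 0 ] ℤ.* g [ suc i ] ℤ.+ (tl f *P g) [ i ]
[*]-suc ([]    , _)   g i rewrite ℤ.*-zeroˡ (g [ suc i ]) = refl
[*]-suc f@(a ∷ l , _) g i rewrite [*] f g (suc i) | [*] (tl f) g i = mulR-suc a l (proj₁ g) i

degBelow-* : ∀ n {m} f {g} → DegBelow f (suc n) → DegBelow g (suc m) → DegBelow (f *P g) (suc (n ℕ.+ m))
degBelow-* n f {g} Df Dg (suc i) (s≤s n+m≤i)
  rewrite [*]-suc f g i | Dg (suc i) (s≤s (ℕ.≤-trans (ℕ.m≤n+m _ n) n+m≤i)) | ℤ.*-zeroʳ (f [ 0 ])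
        | ℤ.+-identityˡ ((tl f *P g) [ i ])
  = go n Df n+m≤i
  where
  go : ∀ n → DegBelow f (suc n) → n ℕ.+ _ ℕ.≤ i → (tl f *P g) [ i ] ≡ 0ℤ
  go zero    Df _ rewrite degBelow-0 {tl f} (degBelow-tl {f} Df) = refl
  go (suc n) Df h = degBelow-* n (tl f) {g} (degBelow-tl {f} Df) Dg i h

top-* : ∀ n m f {g} → DegBelow f (suc n) → DegBelow g (suc m) → (f *P g) [ n ℕ.+ m ] ≡ f [ n ] ℤ.* g [ m ]
top-* zero zero    f {g} Df Dg = [*]-zero f g
top-* zero (suc m) f {g} Df Dg
  rewrite [*]-suc f g m | degBelow-0 {tl f} (degBelow-tl {f} Df) = ℤ.+-identityʳ _
top-* (suc n) m f {g} Df Dg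
  rewrite [*]-suc f g (n ℕ.+ m) | Dg (suc (n ℕ.+ m)) (s≤s (ℕ.m≤n+m m n)) | ℤ.*-zeroʳ (f [ 0 ])
        | ℤ.+-identityˡ ((tl f *P g) [ n ℕ.+ m ])
  = trans (top-* n m (tl f) {g} (degBelow-tl {f} Df) Dg) (cong (ℤ._* g [ m ]) ([tl] f n))

0<* : ∀ {a b} → 0ℤ ℤ.< a → 0ℤ ℤ.< b → 0ℤ ℤ.< a ℤ.* b
0<* {+ suc a} {+ suc b} _ _ = +<+ (s≤s z≤n)
0<* {+ suc a} {+ zero}  _ (+<+ ())
0<* {+ zero}            (+<+ ())

≢0⇒0<⊎0<- : ∀ {a} → a ≢ 0ℤ → 0ℤ ℤ.< a ⊎ 0ℤ ℤ.< ℤ.- a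
≢0⇒0<⊎0<- {+ zero}  h = ⊥-elim (h refl)
≢0⇒0<⊎0<- {+ suc n} h = inj₁ (+<+ (s≤s z≤n))
≢0⇒0<⊎0<- { -[1+ n ]} h = inj₂ (+<+ (s≤s z≤n))

trichotomy : ∀ f → f ≡ 0P ⊎ Pos f ⊎ Pos (neg f)
trichotomy f with top f
... | inj₁ e = inj₁ e
... | inj₂ (n , D , ≢0 , _) with ≢0⇒0<⊎0<- ≢0
...   | inj₁ p = inj₂ (inj₁ (top⇒Pos {f} n D p))
...   | inj₂ p = inj₂ (inj₂ (top⇒Pos {neg f} n (degBelow-neg {f} D) (subst (0ℤ ℤ.<_) (sym ([neg] f n)) p)))

Pos-* : ∀ {f g} → Pos f → Pos g → Pos (f *P g)
Pos-* {f} {g} p q with Pos⇒top {f} p | Pos⇒top {g} q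
... | n , Df , fn | m , Dg , gm = top⇒Pos {f *P g} (n ℕ.+ m) (degBelow-* n f {g} Df Dg)
  (subst (0ℤ ℤ.<_) (sym (top-* n m f {g} Df Dg)) (0<* fn gm))

top-+ : ∀ {f g} n m → DegBelow f (suc n) → 0ℤ ℤ.< f [ n ] → DegBelow g (suc m) → 0ℤ ℤ.< g [ m ] →
        n ℕ.≤ m → DegBelow (f +P g) (suc m) × 0ℤ ℤ.< (f +P g) [ m ]
top-+ {f} {g} n m Df fn Dg gm n≤m =
  degBelow-+ {f} {g} (degBelow-≤ {f} (s≤s n≤m) Df) Dg
  , subst (0ℤ ℤ.<_) (sym ([+] f g m)) (ℤ.+-mono-≤-< nonneg gm)
  where
  nonneg : 0ℤ ℤ.≤ f [ m ]
  nonneg with ℕ.m≤n⇒m<n∨m≡n n≤m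
  ... | inj₁ lt   = ℤ.≤-reflexive (sym (Df m lt))
  ... | inj₂ refl = ℤ.<⇒≤ fn

Pos-+ : ∀ {f g} → Pos f → Pos g → Pos (f +P g)
Pos-+ {f} {g} p q with Pos⇒top {f} p | Pos⇒top {g} q
... | n , Df , fn | m , Dg , gm with ℕ.≤-total n m
...   | inj₁ n≤m = let D , h = top-+ {f} {g} n m Df fn Dg gm n≤m in top⇒Pos {f +P g} m D h
...   | inj₂ m≤n = let D , h = top-+ {g} {f} m n Dg gm Df fn m≤n in
                   subst Pos (+P-comm g f) (top⇒Pos {g +P f} n D h)

¬Pos-0 : ¬ Pos 0P
¬Pos-0 (+<+ ())

Pos-neg : ∀ {f} → Pos f → ¬ Pos (neg f)
Pos-neg {f} p q = ¬Pos-0 (subst Pos (+P-inverseˡ f) (Pos-+ {neg f} {f} q p))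

Pos-C : ∀ {c} → 0ℤ ℤ.< c → Pos (C c)
Pos-C {c} h = top⇒Pos {C c} 0 (degBelow-C c) (subst (0ℤ ℤ.<_) (sym (C-zero c)) h)

Pos-1 : Pos 1P
Pos-1 = +<+ (s≤s z≤n)

-- The order through positive differences

<P-intro : ∀ {f g d} → Pos d → g ≡ f +P d → f <P g
<P-intro {f} {g} {d} p refl = subst Pos (sym (trans (-P-neg (f +P d) f)
  (solve 2 (λ f d → (f :+ d) :+ (:- f) := d) refl f d))) p

<P-elim : ∀ {f g} → f <P g → ∃ λ d → Pos d × g ≡ f +P d
<P-elim {f} {g} p = g -P f , p ,
  sym (trans (cong (f +P_) (-P-neg g f)) (solve 2 (λ f g → f :+ (g :- f) := g) refl f g))

<P-trans : ∀ {f g h} → f <P g → g <P h → f <P h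
<P-trans {f} {g} {h} p q with <P-elim {f} {g} p | <P-elim {g} {h} q
... | d , d>0 , refl | e , e>0 , refl =
  <P-intro {f} {_} {d +P e} (Pos-+ {d} {e} d>0 e>0) (+P-assoc f d e)

<P-irrefl : ∀ {f} → ¬ (f <P f)
<P-irrefl {f} p with <P-elim {f} {f} p
... | d , d>0 , e = ¬Pos-0 (subst Pos d≡0 d>0)
  where
  d≡0 : d ≡ 0P
  d≡0 = trans (solve 2 (λ f d → d := (f :+ d) :- f) refl f d)
        (trans (cong (_+P neg f) (sym e)) (solve 1 (λ f → f :- f := con 0ℤ) refl f))

<P-asym : ∀ {f g} → f <P g → ¬ (g <P f)
<P-asym {f} {g} p q = <P-irrefl {f} (<P-trans {f} {g} {f} p q)

<P-cmp : ∀ f g → f ≡ g ⊎ f <P g ⊎ g <P f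
<P-cmp f g with trichotomy (g +P neg f)
... | inj₁ e = inj₁ (sym (trans (solve 2 (λ f g → g := f :+ (g :- f)) refl f g)
                 (trans (cong (f +P_) e) (solve 1 (λ f → f :+ con 0ℤ := f) refl f))))
... | inj₂ (inj₁ p) = inj₂ (inj₁ (<P-intro {f} {g} {g +P neg f} p (solve 2 (λ f g → g := f :+ (g :- f)) refl f g)))
... | inj₂ (inj₂ p) = inj₂ (inj₂ (<P-intro {g} {f} {neg (g +P neg f)} p
                        (solve 2 (λ f g → f := g :+ (:- (g :- f))) refl f g)))

Pos⇒0< : ∀ {f} → Pos f → 0P <P f
Pos⇒0< {f} p = <P-intro {0P} {f} {f} p (sym (+P-identityˡ f))

0<⇒Pos : ∀ {f} → 0P <P f → Pos f
0<⇒Pos {f} p with <P-elim {0P} {f} p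
... | d , d>0 , refl = subst Pos (sym (+P-identityˡ d)) d>0

Pos⇒InC : ∀ {f} → Pos f → InC f
Pos⇒InC {f} p = inj₂ (Pos⇒0< {f} p)

1<⇒Pos : ∀ {f} → 1P <P f → Pos f
1<⇒Pos {f} p = 0<⇒Pos {f} (<P-trans {0P} {1P} {f} (Pos⇒0< {1P} Pos-1) p)

-- Equivalently, f exceeds every constant.
Big : Poly → Set
Big f = ∃ λ n → DegBelow f (2 ℕ.+ n) × 0ℤ ℤ.< f [ suc n ]

Big⇒Pos : ∀ {f} → Big f → Pos f
Big⇒Pos {f} (n , D , h) = top⇒Pos {f} (suc n) D h

Big-+C : ∀ {f} c → Big f → Big (f +P C c)
Big-+C {f} c (n , D , h) = n
  , degBelow-+ {f} {C c} D (degBelow-≤ {C c} (s≤s z≤n) (degBelow-C c))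
  , subst (0ℤ ℤ.<_) (sym (trans ([+] f (C c) (suc n))
      (trans (cong (λ z → f [ suc n ] ℤ.+ z) (C-suc c n)) (ℤ.+-identityʳ _)))) h

Big-* : ∀ {f g} → Pos f → Big g → Big (f *P g)
Big-* {f} {g} p (m , Dg , gm) with Pos⇒top {f} p
... | n , Df , fn = n ℕ.+ m
  , subst (λ k → DegBelow (f *P g) (suc k)) (ℕ.+-suc n m) (degBelow-* n f {g} Df Dg)
  , subst (0ℤ ℤ.<_) (sym (trans (cong ((f *P g) [_]) (sym (ℕ.+-suc n m))) (top-* n (suc m) f {g} Df Dg)))
      (0<* fn gm)

-- The later case distinctions between finite and infinite elements rest on this one: a positive
-- polynomial of degree 0 is a positive integer.
Pos-cases : ∀ {f} → Pos f → (∃ λ k → f ≡ C (+ suc k)) ⊎ Big f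
Pos-cases {f} p with Pos⇒top {f} p
... | suc n , D , h = inj₂ (n , D , h)
... | zero  , D , h with f [ 0 ] in eq
...   | + suc k  = inj₁ (k , trans (degBelow-1 {f} D) (cong C eq))
Pos-cases {f} p | zero , D , +<+ () | + zero
Pos-cases {f} p | zero , D , () | -[1+ k ]

C<Big : ∀ {f} c → Big f → C c <P f
C<Big {f} c b = <P-intro {C c} {f} {f +P C (ℤ.- c)} (Big⇒Pos {f +P C (ℤ.- c)} (Big-+C {f} (ℤ.- c) b))
  (trans (solve 2 (λ f c → f := c :+ (f :- c)) refl f (C c)) (cong (λ z → C c +P (f +P z)) (sym (C-neg c))))

C<C : ∀ {a b} → a ℤ.< b → C a <P C b
C<C {a} {b} a<b = <P-intro {C a} {C b} {C (b ℤ.- a)} (Pos-C {b ℤ.- a} (subst (ℤ._< b ℤ.- a) (ℤ.+-inverseʳ a) (ℤ.+-monoˡ-< (ℤ.- a) a<b)))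
  (trans (cong C (lem a b)) (C-+ a (b ℤ.- a)))
  where
  lem : ∀ a b → b ≡ a ℤ.+ (b ℤ.- a)
  lem = solve-∀

C<C⁻¹ : ∀ {a b} → C a <P C b → a ℤ.< b
C<C⁻¹ {a} {b} p with ℤ.<-cmp a b
... | tri< lt _ _   = lt
... | tri≈ _ refl _ = ⊥-elim (<P-irrefl {C a} p)
... | tri> _ _ gt   = ⊥-elim (<P-asym {C a} {C b} p (C<C gt))

Pos⇒1≤ : ∀ {f} → Pos f → f ≡ 1P ⊎ 1P <P f
Pos⇒1≤ {f} p with Pos-cases {f} p
... | inj₁ (zero  , refl) = inj₁ refl
... | inj₁ (suc k , refl) = inj₂ (C<C {+ 1} {+ suc (suc k)} (+<+ (s≤s (s≤s z≤n))))
... | inj₂ b = inj₂ (C<Big {f} 1ℤ b)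

*P-cancel-0 : ∀ {f g} → f *P g ≡ 0P → f ≢ 0P → g ≡ 0P
*P-cancel-0 {f} {g} e f≢0 with top f | top g
... | inj₁ f≡0 | _ = ⊥-elim (f≢0 f≡0)
... | inj₂ _ | inj₁ g≡0 = g≡0
... | inj₂ (n , Df , fn , _) | inj₂ (m , Dg , gm , _)
  with ℤ.i*j≡0⇒i≡0∨j≡0 (f [ n ]) (trans (sym (top-* n m f {g} Df Dg)) (cong (_[ n ℕ.+ m ]) e))
...   | inj₁ h = ⊥-elim (fn h)
...   | inj₂ h = ⊥-elim (gm h)

Pos⇒≢0 : ∀ {f} → Pos f → f ≢ 0P
Pos⇒≢0 p refl = ¬Pos-0 p

*P-cancelˡ : ∀ {f g h} → f ≢ 0P → f *P g ≡ f *P h → g ≡ h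
*P-cancelˡ {f} {g} {h} f≢0 e = trans (solve 2 (λ g h → g := (g :- h) :+ h) refl g h)
  (trans (cong (_+P h) d≡0) (+P-identityˡ h))
  where
  d≡0 : g +P neg h ≡ 0P
  d≡0 = *P-cancel-0 {f} {g +P neg h} (trans (solve 3 (λ f g h → f :* (g :- h) := f :* g :- f :* h) refl f g h)
    (trans (cong (λ z → z +P neg (f *P h)) e) (solve 1 (λ z → z :- z := con 0ℤ) refl (f *P h)))) f≢0

Pos-factor : ∀ {f g} → Pos f → Pos (f *P g) → Pos g
Pos-factor {f} {g} p q with trichotomy g
... | inj₁ refl = ⊥-elim (¬Pos-0 (subst Pos (*P-comm f 0P) q))
... | inj₂ (inj₁ r) = r
... | inj₂ (inj₂ r) = ⊥-elim (Pos-neg {f *P g} q (subst Pos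
        (solve 2 (λ f g → f :* (:- g) := :- (f :* g)) refl f g) (Pos-* {f} {neg g} p r)))

-- Bounded search for factors

evR : ℤ → List ℤ → ℤ
evR x []      = 0ℤ
evR x (a ∷ l) = a ℤ.+ x ℤ.* evR x l

eval : ℤ → Poly → ℤ
eval x f = evR x (proj₁ f)

evR-norm : ∀ x l → evR x (norm l) ≡ evR x l
evR-norm x []      = refl
evR-norm x (a ∷ l) = trans (evR-cons a (norm l)) (cong (λ z → a ℤ.+ x ℤ.* z) (evR-norm x l))
  where
  evR-cons : ∀ a l → evR x (cons a l) ≡ evR x (a ∷ l)
  evR-cons (+ zero)  []      = sym (trans (ℤ.+-identityˡ _) (ℤ.*-zeroʳ x))
  evR-cons (+ suc n) []      = refl
  evR-cons -[1+ n ]  []      = refl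
  evR-cons a         (b ∷ l) = refl

evR-addR : ∀ x p q → evR x (addR p q) ≡ evR x p ℤ.+ evR x q
evR-addR x []      q       = sym (ℤ.+-identityˡ _)
evR-addR x (a ∷ p) []      = sym (ℤ.+-identityʳ _)
evR-addR x (a ∷ p) (b ∷ q) rewrite evR-addR x p q = lem a b x (evR x p) (evR x q)
  where
  lem : ∀ a b x u v → a ℤ.+ b ℤ.+ x ℤ.* (u ℤ.+ v) ≡ (a ℤ.+ x ℤ.* u) ℤ.+ (b ℤ.+ x ℤ.* v)
  lem = solve-∀

evR-scale : ∀ x c p → evR x (map (c ℤ.*_) p) ≡ c ℤ.* evR x p
evR-scale x c []      = sym (ℤ.*-zeroʳ c)
evR-scale x c (a ∷ p) rewrite evR-scale x c p = lem a c x (evR x p)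
  where
  lem : ∀ a c x u → c ℤ.* a ℤ.+ x ℤ.* (c ℤ.* u) ≡ c ℤ.* (a ℤ.+ x ℤ.* u)
  lem = solve-∀

evR-mulR : ∀ x p q → evR x (mulR p q) ≡ evR x p ℤ.* evR x q
evR-mulR x []      q = sym (ℤ.*-zeroˡ (evR x q))
evR-mulR x (a ∷ p) q
  rewrite evR-addR x (map (a ℤ.*_) q) (0ℤ ∷ mulR p q) | evR-scale x a q | evR-mulR x p q
  = lem a x (evR x p) (evR x q)
  where
  lem : ∀ a x u v → a ℤ.* v ℤ.+ (+ 0 ℤ.+ x ℤ.* (u ℤ.* v)) ≡ (a ℤ.+ x ℤ.* u) ℤ.* v
  lem = solve-∀

eval-* : ∀ x f g → eval x (f *P g) ≡ eval x f ℤ.* eval x g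
eval-* x f g = trans (evR-norm x (mulR (proj₁ f) (proj₁ g))) (evR-mulR x (proj₁ f) (proj₁ g))

rootBound : List ℤ → ℕ
rootBound []      = 0
rootBound (a ∷ l) = suc ∣ a ∣ ℕ.+ rootBound l

-- If a + k w = 0 with w ≠ 0, then |a| = k |w| ≥ k. By induction, `nonroot` excludes every root from
-- `rootBound` on.
nonroot-∷ : ∀ a l k → ∣ a ∣ ℕ.< k → evR (+ k) l ≢ 0ℤ → evR (+ k) (a ∷ l) ≢ 0ℤ
nonroot-∷ a l k ∣a∣<k w≢0 e = ℕ.<⇒≱ ∣a∣<k (subst (k ℕ.≤_) ∣a∣≡ k≤)
  where
  w = evR (+ k) l
  k≤ : k ℕ.≤ ∣ + k ℤ.* w ∣
  k≤ = subst (k ℕ.≤_) (sym (ℤ.abs-* (+ k) w))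
    (ℕ.m≤m*n k ∣ w ∣ ⦃ ℕ.≢-nonZero (λ z → w≢0 (ℤ.∣i∣≡0⇒i≡0 z)) ⦄)
  lem : ∀ a b → b ≡ (a ℤ.+ b) ℤ.- a
  lem = solve-∀
  ∣a∣≡ : ∣ + k ℤ.* w ∣ ≡ ∣ a ∣
  ∣a∣≡ = trans (cong ∣_∣ (trans (lem a (+ k ℤ.* w)) (trans (cong (ℤ._- a) e) (ℤ.+-identityˡ (ℤ.- a))))) (ℤ.∣-i∣≡∣i∣ a)

nonroot : ∀ l → T (isNorm l) → l ≢ [] → ∀ k → rootBound l ℕ.≤ k → evR (+ k) l ≢ 0ℤ
nonroot []          h l≢[] k b e = l≢[] refl
nonroot (a ∷ [])    h _ k b e with trans (sym (trans (cong (λ z → a ℤ.+ z) (ℤ.*-zeroʳ (+ k))) (ℤ.+-identityʳ a))) e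
nonroot (_ ∷ []) () _ k b e | refl
nonroot (a ∷ l@(_ ∷ _)) h _ k b e =
  nonroot-∷ a l k (ℕ.≤-trans (s≤s (ℕ.m≤m+n ∣ a ∣ _)) b)
    (nonroot l h (λ ()) k (ℕ.≤-trans (ℕ.m≤n+m (rootBound l) (suc ∣ a ∣)) b)) e

-- The quotient of l by X − x.
horner : ℤ → List ℤ → List ℤ
horner x []          = []
horner x (a ∷ [])    = []
horner x (a ∷ l@(_ ∷ _)) = evR x l ∷ horner x l

horner-length : ∀ x a l → length (horner x (a ∷ l)) ≡ length l
horner-length x a []      = refl
horner-length x a (b ∷ l) = cong suc (horner-length x b l)

horner-eval : ∀ x y l → evR y l ≡ evR x l ℤ.+ (y ℤ.- x) ℤ.* evR y (horner x l)
horner-eval x y []       = sym (trans (ℤ.+-identityˡ _) (ℤ.*-zeroʳ (y ℤ.- x)))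
horner-eval x y (a ∷ []) = lem a x y
  where
  lem : ∀ a x y → a ℤ.+ y ℤ.* 0ℤ ≡ (a ℤ.+ x ℤ.* 0ℤ) ℤ.+ (y ℤ.- x) ℤ.* 0ℤ
  lem = solve-∀
horner-eval x y (a ∷ l@(_ ∷ _)) =
  trans (cong (λ z → a ℤ.+ y ℤ.* z) (horner-eval x y l)) (lem a x y (evR x l) (evR y (horner x l)))
  where
  lem : ∀ a x y u v → a ℤ.+ y ℤ.* (u ℤ.+ (y ℤ.- x) ℤ.* v) ≡ a ℤ.+ x ℤ.* u ℤ.+ (y ℤ.- x) ℤ.* (u ℤ.+ y ℤ.* v)
  lem = solve-∀

AllBelow : ℕ → List ℤ → Set
AllBelow B = All (λ a → ∣ a ∣ ℕ.≤ B)

allBelow-mono : ∀ {B B′ l} → B ℕ.≤ B′ → AllBelow B l → AllBelow B′ l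
allBelow-mono h []       = []
allBelow-mono h (x ∷ xs) = ℕ.≤-trans x h ∷ allBelow-mono h xs


-- The head w of the quotient is the value of the tail at k, so a is the value of the whole list at
-- k minus k w.
horner-head : ∀ k {B} a l → AllBelow B (horner (+ k) (a ∷ l)) → ∣ a ∣ ℕ.≤ ∣ evR (+ k) (a ∷ l) ∣ ℕ.+ k ℕ.* B
horner-head k {B} a [] _ = subst (λ z → ∣ a ∣ ℕ.≤ ∣ z ∣ ℕ.+ k ℕ.* B)
  (sym (trans (cong (λ z → a ℤ.+ z) (ℤ.*-zeroʳ (+ k))) (ℤ.+-identityʳ a))) (ℕ.m≤m+n ∣ a ∣ _)
horner-head k {B} a l@(_ ∷ _) (w≤B ∷ _) = begin
  ∣ a ∣                                    ≡⟨ cong ∣_∣ (lem a (+ k ℤ.* w)) ⟩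
  ∣ (a ℤ.+ + k ℤ.* w) ℤ.- + k ℤ.* w ∣      ≤⟨ ℤ.∣i-j∣≤∣i∣+∣j∣ (a ℤ.+ + k ℤ.* w) (+ k ℤ.* w) ⟩
  ∣ a ℤ.+ + k ℤ.* w ∣ ℕ.+ ∣ + k ℤ.* w ∣    ≡⟨ cong (∣ a ℤ.+ + k ℤ.* w ∣ ℕ.+_) (ℤ.abs-* (+ k) w) ⟩
  ∣ a ℤ.+ + k ℤ.* w ∣ ℕ.+ k ℕ.* ∣ w ∣      ≤⟨ ℕ.+-monoʳ-≤ ∣ a ℤ.+ + k ℤ.* w ∣ (ℕ.*-monoʳ-≤ k w≤B) ⟩
  ∣ a ℤ.+ + k ℤ.* w ∣ ℕ.+ k ℕ.* B          ∎
  where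
  open ℕ.≤-Reasoning
  w = evR (+ k) l
  lem : ∀ a b → a ≡ (a ℤ.+ b) ℤ.- b
  lem = solve-∀

-- Each entry of the quotient is the value at k of a tail of the list, so `horner-head` applies to
-- every tail.
horner-tail : ∀ k {B} a l → AllBelow B (horner (+ k) (a ∷ l)) → AllBelow (suc k ℕ.* B) l
horner-tail k a [] _ = []
horner-tail k {B} a (b ∷ l) (w≤B ∷ rest) =
  ℕ.≤-trans (horner-head k b l rest) (ℕ.+-monoˡ-≤ (k ℕ.* B) w≤B) ∷ horner-tail k b l rest

-- A bound for the coefficients of a polynomial g of length at most n with
-- |g(b+i)| ≤ V i: write g = g(b) + (X − b) h, where |h(b+1+i)| ≤ V (1+i) + V 0.
coefBound : ℕ → ℕ → (ℕ → ℕ) → ℕ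
coefBound zero    b V = 0
coefBound (suc n) b V = V 0 ℕ.+ suc b ℕ.* coefBound n (suc b) (λ i → V (suc i) ℕ.+ V 0)

coefBound-correct : ∀ n b V l → length l ℕ.≤ n → (∀ i → ∣ evR (+ (b ℕ.+ i)) l ∣ ℕ.≤ V i) →
  AllBelow (coefBound n b V) l
coefBound-correct n       b V []      _       _ = []
coefBound-correct (suc n) b V (a ∷ l) (s≤s h) v =
  ℕ.≤-trans (horner-head b a l IH) (ℕ.+-mono-≤ v0 (ℕ.*-monoˡ-≤ B (ℕ.n≤1+n b))) ∷
  allBelow-mono (ℕ.m≤n+m (suc b ℕ.* B) (V 0)) (horner-tail b a l IH)
  where
  V′ : ℕ → ℕ
  V′ i = V (suc i) ℕ.+ V 0
  B = coefBound n (suc b) V′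
  q = horner (+ b) (a ∷ l)
  v0 : ∣ evR (+ b) (a ∷ l) ∣ ℕ.≤ V 0
  v0 = subst (λ z → ∣ evR (+ z) (a ∷ l) ∣ ℕ.≤ V 0) (ℕ.+-identityʳ b) (v 0)
  q-small : ∀ i → ∣ evR (+ (suc b ℕ.+ i)) q ∣ ℕ.≤ V′ i
  q-small i = begin
    ∣ evR y q ∣                                 ≤⟨ ℕ.m≤m+n _ _ ⟩
    suc i ℕ.* ∣ evR y q ∣                       ≡⟨ sym (ℤ.abs-* (+ suc i) (evR y q)) ⟩
    ∣ + suc i ℤ.* evR y q ∣                     ≡⟨ cong ∣_∣ difference ⟩
    ∣ evR y (a ∷ l) ℤ.- evR (+ b) (a ∷ l) ∣     ≤⟨ ℤ.∣i-j∣≤∣i∣+∣j∣ (evR y (a ∷ l)) (evR (+ b) (a ∷ l)) ⟩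
    ∣ evR y (a ∷ l) ∣ ℕ.+ ∣ evR (+ b) (a ∷ l) ∣ ≤⟨ ℕ.+-mono-≤ v-suc v0 ⟩
    V′ i                                        ∎
    where
    open ℕ.≤-Reasoning
    y = + (suc b ℕ.+ i)
    v-suc : ∣ evR y (a ∷ l) ∣ ℕ.≤ V (suc i)
    v-suc = subst (λ z → ∣ evR (+ z) (a ∷ l) ∣ ℕ.≤ V (suc i)) (ℕ.+-suc b i) (v (suc i))
    y-b : y ℤ.- + b ≡ + suc i
    y-b = trans (cong (ℤ._- + b) (trans (cong +_ (sym (ℕ.+-suc b i))) (ℤ.pos-+ b (suc i)))) (lem (+ b) (+ suc i))
      where
      lem : ∀ b i → (b ℤ.+ i) ℤ.- b ≡ i
      lem = solve-∀
    lem : ∀ u v → v ≡ (u ℤ.+ v) ℤ.- u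
    lem = solve-∀
    difference : + suc i ℤ.* evR y q ≡ evR y (a ∷ l) ℤ.- evR (+ b) (a ∷ l)
    difference = trans (lem (evR (+ b) (a ∷ l)) (+ suc i ℤ.* evR y q))
      (cong (ℤ._- evR (+ b) (a ∷ l)) (sym (trans (horner-eval (+ b) y (a ∷ l))
        (cong (λ z → evR (+ b) (a ∷ l) ℤ.+ z ℤ.* evR y q) y-b))))
  IH : AllBelow B q
  IH = coefBound-correct n (suc b) V′ q (subst (ℕ._≤ n) (sym (horner-length (+ b) a l)) h) q-small

range : ℕ → List ℤ
range B = map +_ (upTo (suc B)) ++ map -[1+_] (upTo B)

∈-range : ∀ B a → ∣ a ∣ ℕ.≤ B → a ∈ range B
∈-range B (+ n)     h = ∈.∈-++⁺ˡ (∈.∈-map⁺ +_ (∈.∈-upTo⁺ (s≤s h)))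
∈-range B -[1+ n ] h = ∈.∈-++⁺ʳ (map +_ (upTo (suc B))) (∈.∈-map⁺ -[1+_] (∈.∈-upTo⁺ h))

boundedLists : ℕ → ℕ → List (List ℤ)
boundedLists zero    B = [] ∷ []
boundedLists (suc n) B = [] ∷ cartesianProductWith _∷_ (range B) (boundedLists n B)

∈-boundedLists : ∀ n {B} l → length l ℕ.≤ n → AllBelow B l → l ∈ boundedLists n B
∈-boundedLists zero    []      _       _        = here refl
∈-boundedLists (suc n) []      _       _        = here refl
∈-boundedLists (suc n) (a ∷ l) (s≤s h) (x ∷ xs) =
  there (∈.∈-cartesianProductWith⁺ _∷_ (∈-range _ a x) (∈-boundedLists n l h xs))

infix 4 _∣P_
_∣P_ : Poly → Poly → Set
f ∣P g = ∃ λ h → f *P h ≡ g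

degBelow⇒length≤ : ∀ f {n} → DegBelow f n → length (proj₁ f) ℕ.≤ n
degBelow⇒length≤ ([]    , _) D = z≤n
degBelow⇒length≤ (a ∷ l , h) {n} D with n ℕ.≤? length l
... | no  n≰  = ℕ.≰⇒> n≰
... | yes n≤ = ⊥-elim (lastR≢0 a l h (trans (sym (coef-length a l)) (D (length l) n≤)))

degBelow-factor : ∀ {f g k} → f ≢ 0P → g ∣P f → DegBelow f k → DegBelow g k
degBelow-factor {f} {g} {k} f≢0 (h , refl) D with top g | top h
... | inj₁ refl | _ = ⊥-elim (f≢0 refl)
... | inj₂ _ | inj₁ refl = ⊥-elim (f≢0 (*P-comm g 0P))
... | inj₂ (n , Dg , gn , _) | inj₂ (m , Dh , hm , _) with k ℕ.≤? n
...   | no  k≰n = degBelow-≤ {g} (ℕ.≰⇒> k≰n) Dg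
...   | yes k≤n with ℤ.i*j≡0⇒i≡0∨j≡0 (g [ n ])
          (trans (sym (top-* n m g {h} Dg Dh)) (D (n ℕ.+ m) (ℕ.≤-trans k≤n (ℕ.m≤m+n n m))))
...     | inj₁ e = ⊥-elim (gn e)
...     | inj₂ e = ⊥-elim (hm e)

length-factor : ∀ {f g} → f ≢ 0P → g ∣P f → length (proj₁ g) ℕ.≤ length (proj₁ f)
length-factor {f} {g} f≢0 g∣f = degBelow⇒length≤ g (degBelow-factor {f} {g} f≢0 g∣f (degBelow-length f))

-- Kronecker's observation: if g divides f and f(y) ≠ 0, then |g(y)| ≤ |f(y)|. The points y from
-- `rootBound` on satisfy f(y) ≠ 0, and `coefBound` bounds the coefficients of g by these values.
factor-coefBound : ∀ f → f ≢ 0P → ∃ λ B → ∀ g → g ∣P f → AllBelow B (proj₁ g)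
factor-coefBound f f≢0 = coefBound n b V , λ g g∣f →
  coefBound-correct n b V (proj₁ g) (length-factor {f} {g} f≢0 g∣f) (small g g∣f)
  where
  n = length (proj₁ f)
  b = rootBound (proj₁ f)
  V : ℕ → ℕ
  V i = ∣ eval (+ (b ℕ.+ i)) f ∣
  small : ∀ g → g ∣P f → ∀ i → ∣ eval (+ (b ℕ.+ i)) g ∣ ℕ.≤ V i
  small g (h , e) i = subst (∣ eval y g ∣ ℕ.≤_)
    (trans (sym (ℤ.abs-* (eval y g) (eval y h))) (cong ∣_∣ ev))
    (ℕ.m≤m*n ∣ eval y g ∣ ∣ eval y h ∣ ⦃ ℕ.≢-nonZero h≢0 ⦄)
    where
    y = + (b ℕ.+ i)
    ev : eval y g ℤ.* eval y h ≡ eval y f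
    ev = trans (sym (eval-* y g h)) (cong (eval y) e)
    h≢0 : ∣ eval y h ∣ ≢ 0
    h≢0 z = nonroot (proj₁ f) (proj₂ f) (λ l≡[] → f≢0 (Σ-≡ l≡[])) (b ℕ.+ i) (ℕ.m≤m+n b i)
      (trans (sym ev) (trans (cong (λ u → eval y g ℤ.* u) (ℤ.∣i∣≡0⇒i≡0 z)) (ℤ.*-zeroʳ (eval y g))))

ProperFactorization : Poly → Set
ProperFactorization f = ∃ λ g → ∃ λ h → 1P <P g × 1P <P h × g *P h ≡ f

_<P?_ : ∀ f g → Dec (f <P g)
f <P? g = 0ℤ ℤ.<? lead (g -P f)

-- Both factors divide f, so their coefficient lists occur in the finite list L and all pairs can be
-- tried. Candidates may end in zeros, hence the use of `mkP`.
properFactorization? : ∀ f → f ≢ 0P → Dec (ProperFactorization f)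
properFactorization? f f≢0 = decide (any? (λ l → any? (test l) L) L)
  where
  B = proj₁ (factor-coefBound f f≢0)
  L = boundedLists (length (proj₁ f)) B
  Test : List ℤ → List ℤ → Set
  Test l m = 1P <P mkP l × 1P <P mkP m × mkP l *P mkP m ≡ f
  test : ∀ l m → Dec (Test l m)
  test l m = (1P <P? mkP l) ×-dec ((1P <P? mkP m) ×-dec ((mkP l *P mkP m) ≟P f))
  listed : ∀ g → g ∣P f → proj₁ g ∈ L
  listed g g∣f = ∈-boundedLists (length (proj₁ f)) (proj₁ g)
    (length-factor {f} {g} f≢0 g∣f) (proj₂ (factor-coefBound f f≢0) g g∣f)
  decide : Dec (Any (λ l → Any (Test l) L) L) → Dec (ProperFactorization f)
  decide (yes a) = let l , _ , b = find a ; m , _ , t = find b in yes (mkP l , mkP m , t)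
  decide (no ¬a) = no λ where
    (g , h , 1<g , 1<h , e) → ¬a (lose (listed g (h , e)) (lose (listed h (g , trans (*P-comm h g) e))
      (subst (1P <P_) (sym (mkP-proj₁ g)) 1<g , subst (1P <P_) (sym (mkP-proj₁ h)) 1<h
      , trans (cong₂ _*P_ (mkP-proj₁ g) (mkP-proj₁ h)) e)))

-- Irreducible elements are prime

primeDivisor : ∀ n → 1 ℕ.< n → ∃ λ q → Prime q × q ℕ.∣ n
primeDivisor n 1<n with factorise n ⦃ ℕ.>-nonZero (ℕ.<-trans ℕ.z<s 1<n) ⦄
... | record { factors = [] ; isFactorisation = refl } = ⊥-elim (ℕ.<-irrefl refl 1<n)
... | record { factors = q ∷ qs ; isFactorisation = refl ; factorsPrime = pq ∷ _ } =
  q , pq , ℕ.m∣m*n (product qs)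

1<prime : ∀ {q} → Prime q → 1 ℕ.< q
1<prime {q} pq = ℕ.nonTrivial⇒n>1 q ⦃ prime⇒nonTrivial pq ⦄

+prime≢0 : ∀ {q} → Prime q → + q ≢ 0ℤ
+prime≢0 pq refl with 1<prime pq
... | ()

∣⇒C∣ : ∀ {q} a → q ℕ.∣ ∣ a ∣ → C (+ q) ∣P C a
∣⇒C∣ {q} a q∣a with ∣ᵤ⇒∣ {+ q} {a} q∣a
... | divides k e = C k , trans (sym (C-* (+ q) k)) (cong C (trans (ℤ.*-comm (+ q) k) (sym e)))

C∣X* : ∀ {c f} → C c ∣P X *P f → C c ∣P f
C∣X* {c} {f} (z , e) = tl z , ext λ i → begin
  (C c *P tl z) [ i ]   ≡⟨ [C*] c (tl z) i ⟩
  c ℤ.* tl z [ i ]      ≡⟨ cong (λ w → c ℤ.* w) ([tl] z i) ⟩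
  c ℤ.* z [ suc i ]     ≡⟨ sym ([C*] c z (suc i)) ⟩
  (C c *P z) [ suc i ]  ≡⟨ cong (_[ suc i ]) e ⟩
  (X *P f) [ suc i ]    ≡⟨ [X*]-suc f i ⟩
  f [ i ]               ∎
  where open ≡-Reasoning

C∣-tail : ∀ {c a f} → C c ∣P C a → C c ∣P f → C c ∣P C a +P X *P f
C∣-tail {c} {a} {f} (k , ek) (z , ez) = k +P X *P z , trans
  (solve 4 (λ c k x z → c :* (k :+ x :* z) := c :* k :+ x :* (c :* z)) refl (C c) k X z)
  (cong₂ (λ u v → u +P X *P v) ek ez)

C∣-tailFactor : ∀ {c a f h} → C c ∣P C a → C c ∣P (C a +P X *P f) *P h → C c ∣P f *P h
C∣-tailFactor {c} {a} {f} {h} (k , ek) (z , ez) = C∣X* {c} {f *P h} (z +P neg (k *P h) , (begin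
  C c *P (z +P neg (k *P h))
    ≡⟨ solve 4 (λ c z k h → c :* (z :- k :* h) := c :* z :- (c :* k) :* h) refl (C c) z k h ⟩
  C c *P z +P neg ((C c *P k) *P h)
    ≡⟨ cong₂ (λ u v → u +P neg (v *P h)) ez ek ⟩
  (C a +P X *P f) *P h +P neg (C a *P h)
    ≡⟨ solve 4 (λ a x f h → (a :+ x :* f) :* h :- a :* h := x :* (f :* h)) refl (C a) X f h ⟩
  X *P (f *P h) ∎))
  where open ≡-Reasoning

C∣0 : ∀ c → C c ∣P 0P
C∣0 c = 0P , *P-comm (C c) 0P

prime∣*-heads : ∀ {q} → Prime q → ∀ a b g h → C (+ q) ∣P (C a +P X *P g) *P (C b +P X *P h) →
  q ℕ.∣ ∣ a ∣ ⊎ q ℕ.∣ ∣ b ∣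
prime∣*-heads {q} pq a b g h (z , ez) = euclidsLemma ∣ a ∣ ∣ b ∣ pq
  (ℕ.divides ∣ z [ 0 ] ∣ (trans (sym (ℤ.abs-* a b))
    (trans (cong ∣_∣ (sym q*z₀≡ab)) (trans (ℤ.abs-* (+ q) (z [ 0 ])) (ℕ.*-comm q ∣ z [ 0 ] ∣)))))
  where
  open ≡-Reasoning
  q*z₀≡ab : + q ℤ.* z [ 0 ] ≡ a ℤ.* b
  q*z₀≡ab = begin
    + q ℤ.* z [ 0 ]                                        ≡⟨ sym ([C*] (+ q) z 0) ⟩
    (C (+ q) *P z) [ 0 ]                                   ≡⟨ cong (_[ 0 ]) ez ⟩
    ((C a +P X *P g) *P (C b +P X *P h)) [ 0 ]             ≡⟨ [*]-zero (C a +P X *P g) (C b +P X *P h) ⟩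
    (C a +P X *P g) [ 0 ] ℤ.* (C b +P X *P h) [ 0 ]        ≡⟨ cong₂ ℤ._*_ ([C+X*]-zero a g) ([C+X*]-zero b h) ⟩
    a ℤ.* b                                                ∎

-- The constant terms a and b have a product divisible by q, so q divides one of them. Subtracting
-- that term and cancelling X leaves a shorter factor for the induction. The outer hypothesis ranges
-- over all h because the second factor stays whole when the first one shrinks.
gauss : ∀ {q} → Prime q → ∀ g h → C (+ q) ∣P g *P h → C (+ q) ∣P g ⊎ C (+ q) ∣P h
gauss {q} pq = Poly-ind (λ g → ∀ h → Gauss g h) (λ h _ → inj₁ (C∣0 (+ q))) λ a g IHg →
  Poly-ind (Gauss (C a +P X *P g)) (λ _ → inj₂ (C∣0 (+ q))) λ b h IHh D →
    Data.Sum.[ (λ q∣a → map₁ (C∣-tail {+ q} {a} {g} (∣⇒C∣ a q∣a))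
                  (IHg (C b +P X *P h) (C∣-tailFactor {+ q} {a} {g} {C b +P X *P h} (∣⇒C∣ a q∣a) D)))
             , (λ q∣b → map₂ (C∣-tail {+ q} {b} {h} (∣⇒C∣ b q∣b))
                  (IHh (subst Divides (*P-comm h (C a +P X *P g))
                    (C∣-tailFactor {+ q} {b} {h} {C a +P X *P g} (∣⇒C∣ b q∣b)
                      (subst Divides (*P-comm (C a +P X *P g) (C b +P X *P h)) D)))))
             ] (prime∣*-heads pq a b g h D)
  where
  Divides : Poly → Set
  Divides f = C (+ q) ∣P f
  Gauss : Poly → Poly → Set
  Gauss g h = Divides (g *P h) → Divides g ⊎ Divides h

∣i∣≡1⇒i*i≡1 : ∀ {c} → ∣ c ∣ ≡ 1 → c ℤ.* c ≡ 1ℤ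
∣i∣≡1⇒i*i≡1 {+ 1}     refl = refl
∣i∣≡1⇒i*i≡1 { -[1+ 0 ]} refl = refl

C-square-cancel : ∀ c f → c ℤ.* c ≡ 1ℤ → C c *P (C c *P f) ≡ f
C-square-cancel c f e = trans (sym (*P-assoc (C c) (C c) f))
  (trans (cong (_*P f) (trans (sym (C-* c c)) (cong C e))) (*P-identityˡ f))

-- How a constant c cancels from c y = g u.
record Distributed (c : ℤ) (y g u : Poly) : Set where
  field
    c₁ c₂ : ℤ
    g′ u′ : Poly
    c≡    : c ≡ c₁ ℤ.* c₂
    g≡    : g ≡ C c₁ *P g′
    u≡    : u ≡ C c₂ *P u′
    y≡    : y ≡ g′ *P u′

-- Prime factors of c are removed one at a time: by `gauss` each divides g or u, and it is recorded
-- in c₁ or c₂ accordingly. The recursion is bounded by |c|.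
distribute : ∀ c {y g u} → c ≢ 0ℤ → C c *P y ≡ g *P u → Distributed c y g u
distribute c = go ∣ c ∣ c ℕ.≤-refl
  where
  go : ∀ n c {y g u} → ∣ c ∣ ℕ.≤ n → c ≢ 0ℤ → C c *P y ≡ g *P u → Distributed c y g u
  go zero c h c≢0 e = ⊥-elim (c≢0 (ℤ.∣i∣≡0⇒i≡0 (ℕ.n≤0⇒n≡0 h)))
  go (suc n) c {y} {g} {u} h c≢0 e with ∣ c ∣ ℕ.≟ 1
  -- Now c = ±1 is its own inverse and can be charged to g.
  ... | yes ∣c∣≡1 = record
    { c₁ = c ; c₂ = 1ℤ ; g′ = C c *P g ; u′ = u ; c≡ = sym (ℤ.*-identityʳ c)
    ; g≡ = sym (C-square-cancel c g cc) ; u≡ = sym (*P-identityˡ u)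
    ; y≡ = trans (sym (C-square-cancel c y cc)) (trans (cong (C c *P_) e) (sym (*P-assoc (C c) g u))) }
    where cc = ∣i∣≡1⇒i*i≡1 {c} ∣c∣≡1
  ... | no ∣c∣≢1 with primeDivisor ∣ c ∣ (ℕ.≤∧≢⇒< (ℕ.n≢0⇒n>0 (λ z → c≢0 (ℤ.∣i∣≡0⇒i≡0 z))) (λ z → ∣c∣≢1 (sym z)))
  ...   | q , pq , q∣c with ∣ᵤ⇒∣ {+ q} {c} q∣c
  ...     | divides k refl = result (gauss pq g u (C k *P y , trans qky e))
    where
    qky : C (+ q) *P (C k *P y) ≡ C (k ℤ.* + q) *P y
    qky = trans (solve 3 (λ q k y → q :* (k :* y) := (k :* q) :* y) refl (C (+ q)) (C k) y)
            (cong (_*P y) (sym (C-* k (+ q))))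
    k≢0 : k ≢ 0ℤ
    k≢0 refl = c≢0 refl
    k≤n : ∣ k ∣ ℕ.≤ n
    k≤n = ℕ.≤-pred (ℕ.≤-trans (ℕ.m<m*n ∣ k ∣ q ⦃ ℕ.≢-nonZero (λ z → k≢0 (ℤ.∣i∣≡0⇒i≡0 z)) ⦄ (1<prime pq))
            (subst (ℕ._≤ suc n) (ℤ.abs-* k (+ q)) h))
    result : C (+ q) ∣P g ⊎ C (+ q) ∣P u → Distributed (k ℤ.* + q) y g u
    result (inj₁ (g₁ , refl)) = record
      { c₁ = c₁ ℤ.* + q ; c₂ = c₂ ; g′ = g′ ; u′ = u′
      ; c≡ = trans (cong (ℤ._* + q) c≡) (lem c₁ c₂ (+ q))
      ; g≡ = trans (cong (C (+ q) *P_) g≡) (trans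
               (solve 3 (λ q c g → q :* (c :* g) := (c :* q) :* g) refl (C (+ q)) (C c₁) g′)
               (cong (_*P g′) (sym (C-* c₁ (+ q)))))
      ; u≡ = u≡ ; y≡ = y≡ }
      where
      lem : ∀ a b q → a ℤ.* b ℤ.* q ≡ a ℤ.* q ℤ.* b
      lem = solve-∀
      open Distributed (go n k {y} {g₁} {u} k≤n k≢0 (C*-cancel {+ q} (+prime≢0 pq)
        (trans qky (trans e (*P-assoc (C (+ q)) g₁ u)))))
    result (inj₂ (u₁ , refl)) = record
      { c₁ = c₁ ; c₂ = c₂ ℤ.* + q ; g′ = g′ ; u′ = u′
      ; c≡ = trans (cong (ℤ._* + q) c≡) (ℤ.*-assoc c₁ c₂ (+ q))
      ; g≡ = g≡
      ; u≡ = trans (cong (C (+ q) *P_) u≡) (trans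
               (solve 3 (λ q c g → q :* (c :* g) := (c :* q) :* g) refl (C (+ q)) (C c₂) u′)
               (cong (_*P u′) (sym (C-* c₂ (+ q)))))
      ; y≡ = y≡ }
      where
      open Distributed (go n k {y} {g} {u₁} k≤n k≢0 (C*-cancel {+ q} (+prime≢0 pq)
        (trans qky (trans e (solve 3 (λ g q u → g :* (q :* u) := q :* (g :* u)) refl g (C (+ q)) u₁)))))

-- Division and greatest common divisors over ℚ, without denominators

*≢0 : ∀ {a b} → a ≢ 0ℤ → b ≢ 0ℤ → a ℤ.* b ≢ 0ℤ
*≢0 {a} a≢0 b≢0 e = Data.Sum.[ a≢0 , b≢0 ] (ℤ.i*j≡0⇒i≡0∨j≡0 a e)

-- Division with remainder over ℚ by an a of degree m; the factor k clears the denominators.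
record PseudoDivision (m : ℕ) (a f : Poly) : Set where
  field
    k      : ℤ
    q r    : Poly
    k≢0    : k ≢ 0ℤ
    small  : DegBelow r m
    eq     : C k *P f ≡ q *P a +P r

-- Long division, taking in the coefficients of f from the top. Passing from f to b + X f turns the
-- remainder r into k b + X r, of degree at most m; scaling by the leading coefficient l of a and
-- subtracting t a cancels its coefficient t at m.
pseudoDivide : ∀ m a → DegBelow a (suc m) → a [ m ] ≢ 0ℤ → ∀ f → PseudoDivision m a f
pseudoDivide m a Da l≢0 = Poly-ind (PseudoDivision m a)
  record { k = 1ℤ ; q = 0P ; r = 0P ; k≢0 = λ () ; small = λ _ _ → refl ; eq = refl } step
  where
  open ≡-Reasoning
  l = a [ m ]
  step : ∀ b f → PseudoDivision m a f → PseudoDivision m a (C b +P X *P f)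
  step b f IH = record
    { k = l ℤ.* k ; q = C l *P (X *P q) +P C t ; r = C l *P r₁ +P neg (C t *P a)
    ; k≢0 = *≢0 l≢0 k≢0 ; small = r-small ; eq = r-eq }
    where
    open PseudoDivision IH
    r₁ = C (k ℤ.* b) +P X *P r
    t = r₁ [ m ]
    r₁-small : DegBelow r₁ (suc m)
    r₁-small = degBelow-+ {C (k ℤ.* b)} {X *P r}
      (degBelow-≤ {C (k ℤ.* b)} (s≤s z≤n) (degBelow-C (k ℤ.* b))) (degBelow-X* {r} small)
    r-small : DegBelow (C l *P r₁ +P neg (C t *P a)) m
    r-small i m≤i rewrite [+] (C l *P r₁) (neg (C t *P a)) i | [neg] (C t *P a) i | [C*] l r₁ i | [C*] t a i
      with ℕ.m≤n⇒m<n∨m≡n m≤i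
    ... | inj₁ m<i rewrite r₁-small i m<i | Da i m<i | ℤ.*-zeroʳ l | ℤ.*-zeroʳ t = refl
    ... | inj₂ refl = trans (cong (ℤ._- t ℤ.* l) (ℤ.*-comm l t)) (ℤ.+-inverseʳ (t ℤ.* l))
    r-eq : C (l ℤ.* k) *P (C b +P X *P f) ≡
           (C l *P (X *P q) +P C t) *P a +P (C l *P r₁ +P neg (C t *P a))
    r-eq = begin
      C (l ℤ.* k) *P (C b +P X *P f)
        ≡⟨ cong (_*P (C b +P X *P f)) (C-* l k) ⟩
      (C l *P C k) *P (C b +P X *P f)
        ≡⟨ solve 5 (λ l k b x f → (l :* k) :* (b :+ x :* f) := l :* (k :* b :+ x :* (k :* f))) refl (C l) (C k) (C b) X f ⟩
      C l *P (C k *P C b +P X *P (C k *P f))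
        ≡⟨ cong₂ (λ u v → C l *P (u +P X *P v)) (sym (C-* k b)) eq ⟩
      C l *P (C (k ℤ.* b) +P X *P (q *P a +P r))
        ≡⟨ solve 7 (λ l c x q a r t → l :* (c :+ x :* (q :* a :+ r)) :=
              (l :* (x :* q) :+ t) :* a :+ (l :* (c :+ x :* r) :- t :* a)) refl (C l) (C (k ℤ.* b)) X q a r (C t) ⟩
      (C l *P (X *P q) +P C t) *P a +P (C l *P r₁ +P neg (C t *P a)) ∎

-- g is a greatest common divisor of f and a over ℚ, with denominators cleared.
record PseudoGCD (f a : Poly) : Set where
  field
    g s t u w : Poly
    c      : ℤ
    c≢0    : c ≢ 0ℤ
    bezout : g ≡ s *P f +P t *P a
    cf≡gu  : C c *P f ≡ g *P u
    ca≡gw  : C c *P a ≡ g *P w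

pseudoGCD-0 : ∀ f → PseudoGCD f 0P
pseudoGCD-0 f = record
  { g = f ; s = 1P ; t = 0P ; u = 1P ; w = 0P ; c = 1ℤ ; c≢0 = λ ()
  ; bezout = solve 1 (λ f → f := con 1ℤ :* f :+ con 0ℤ) refl f
  ; cf≡gu = *P-comm 1P f
  ; ca≡gw = *P-comm 0P f }

pseudoGCD-divide : ∀ {m a f} (D : PseudoDivision m a f) → PseudoGCD a (PseudoDivision.r D) → PseudoGCD f a
pseudoGCD-divide {m} {a} {f} D G = record
  { g = g ; s = t *P C k ; t = s +P neg (t *P q) ; u = q *P u +P w ; w = C k *P u
  ; c = c ℤ.* k ; c≢0 = *≢0 c≢0 k≢0
  ; bezout = bezout′ ; cf≡gu = cf ; ca≡gw = ca }
  where
  open ≡-Reasoning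
  open PseudoDivision D
  open PseudoGCD G
  bezout′ : g ≡ (t *P C k) *P f +P (s +P neg (t *P q)) *P a
  bezout′ = begin
    g                                             ≡⟨ bezout ⟩
    s *P a +P t *P r
      ≡⟨ solve 5 (λ s t q a r → s :* a :+ t :* r := t :* (q :* a :+ r) :+ (s :- t :* q) :* a) refl s t q a r ⟩
    t *P (q *P a +P r) +P (s +P neg (t *P q)) *P a
      ≡⟨ cong (λ z → t *P z +P (s +P neg (t *P q)) *P a) (sym eq) ⟩
    t *P (C k *P f) +P (s +P neg (t *P q)) *P a
      ≡⟨ cong (_+P (s +P neg (t *P q)) *P a) (sym (*P-assoc t (C k) f)) ⟩
    (t *P C k) *P f +P (s +P neg (t *P q)) *P a   ∎
  cf : C (c ℤ.* k) *P f ≡ g *P (q *P u +P w)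
  cf = begin
    C (c ℤ.* k) *P f                   ≡⟨ cong (_*P f) (C-* c k) ⟩
    (C c *P C k) *P f                  ≡⟨ *P-assoc (C c) (C k) f ⟩
    C c *P (C k *P f)                  ≡⟨ cong (C c *P_) eq ⟩
    C c *P (q *P a +P r)
      ≡⟨ solve 4 (λ c q a r → c :* (q :* a :+ r) := q :* (c :* a) :+ c :* r) refl (C c) q a r ⟩
    q *P (C c *P a) +P C c *P r        ≡⟨ cong₂ (λ x y → q *P x +P y) cf≡gu ca≡gw ⟩
    q *P (g *P u) +P g *P w
      ≡⟨ solve 4 (λ q g u w → q :* (g :* u) :+ g :* w := g :* (q :* u :+ w)) refl q g u w ⟩
    g *P (q *P u +P w)                 ∎
  ca : C (c ℤ.* k) *P a ≡ g *P (C k *P u)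
  ca = begin
    C (c ℤ.* k) *P a     ≡⟨ cong (_*P a) (C-* c k) ⟩
    (C c *P C k) *P a    ≡⟨ solve 3 (λ c k a → (c :* k) :* a := k :* (c :* a)) refl (C c) (C k) a ⟩
    C k *P (C c *P a)    ≡⟨ cong (C k *P_) cf≡gu ⟩
    C k *P (g *P u)      ≡⟨ solve 3 (λ k g u → k :* (g :* u) := g :* (k :* u)) refl (C k) g u ⟩
    g *P (C k *P u)      ∎

-- Euclid's algorithm by recursion on the degree bound n: a vanishing top coefficient merely lowers
-- the bound, and otherwise a division yields a remainder with a smaller one.
pseudoGCD : ∀ n f a → DegBelow a n → PseudoGCD f a
pseudoGCD zero    f a Da = subst (PseudoGCD f) (sym (degBelow-0 {a} Da)) (pseudoGCD-0 f)
pseudoGCD (suc m) f a Da = byTop (a [ m ] ℤ.≟ 0ℤ)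
  where
  lower : a [ m ] ≡ 0ℤ → DegBelow a m
  lower e i m≤i = Data.Sum.[ Da i , (λ m≡i → subst (λ j → a [ j ] ≡ 0ℤ) m≡i e) ] (ℕ.m≤n⇒m<n∨m≡n m≤i)
  byTop : Dec (a [ m ] ≡ 0ℤ) → PseudoGCD f a
  byTop (yes e)  = pseudoGCD m f a (lower e)
  byTop (no l≢0) = pseudoGCD-divide D (pseudoGCD m a (PseudoDivision.r D) (PseudoDivision.small D))
    where D = pseudoDivide m a Da l≢0 f

-- Order and divisibility

≤-<P-trans : ∀ {f g h} → f ≤P g → g <P h → f <P h
≤-<P-trans {f} {g} {h} (inj₁ p) q = <P-trans {f} {g} {h} p q
≤-<P-trans (inj₂ refl) q = q

<-≤P-trans : ∀ {f g h} → f <P g → g ≤P h → f <P h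
<-≤P-trans {f} {g} {h} p (inj₁ q) = <P-trans {f} {g} {h} p q
<-≤P-trans p (inj₂ refl) = p

≤P-trans : ∀ {f g h} → f ≤P g → g ≤P h → f ≤P h
≤P-trans {f} {g} {h} p (inj₁ q) = inj₁ (≤-<P-trans {f} {g} {h} p q)
≤P-trans p (inj₂ refl) = p

≤⇒≯P : ∀ {f g} → f ≤P g → ¬ (g <P f)
≤⇒≯P {f} {g} p q = <P-irrefl {f} (≤-<P-trans {f} {g} {f} p q)

≤-or-> : ∀ f g → f ≤P g ⊎ g <P f
≤-or-> f g = Data.Sum.[ (λ e → inj₁ (inj₂ e)) , map₁ inj₁ ]′ (<P-cmp f g)

*P-monoʳ-< : ∀ f {g h} → Pos f → g <P h → f *P g <P f *P h
*P-monoʳ-< f {g} {h} f>0 p with <P-elim {g} {h} p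
... | d , d>0 , e = <P-intro {f *P g} {f *P h} {f *P d} (Pos-* {f} {d} f>0 d>0)
  (trans (cong (f *P_) e) (solve 3 (λ f g d → f :* (g :+ d) := f :* g :+ f :* d) refl f g d))

*P-monoʳ-≤ : ∀ f {g h} → Pos f → g ≤P h → f *P g ≤P f *P h
*P-monoʳ-≤ f {g} {h} f>0 (inj₁ p) = inj₁ (*P-monoʳ-< f {g} {h} f>0 p)
*P-monoʳ-≤ f f>0 (inj₂ e) = inj₂ (cong (f *P_) e)

*P-mono-≤ : ∀ {f f′ g g′} → Pos f → Pos g′ → f ≤P f′ → g ≤P g′ → f *P g ≤P f′ *P g′
*P-mono-≤ {f} {f′} {g} {g′} f>0 g′>0 p q =
  ≤P-trans {f *P g} {f *P g′} {f′ *P g′} (*P-monoʳ-≤ f {g} {g′} f>0 q)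
    (subst₂ _≤P_ (*P-comm g′ f) (*P-comm g′ f′) (*P-monoʳ-≤ g′ {f} {f′} g′>0 p))

*P-identityʳ : ∀ f → f *P 1P ≡ f
*P-identityʳ f = trans (*P-comm f 1P) (*P-identityˡ f)

1≤P : ∀ {f} → Pos f → 1P ≤P f
1≤P {f} p = Data.Sum.[ (λ e → inj₂ (sym e)) , inj₁ ] (Pos⇒1≤ {f} p)

∣⇒≤P : ∀ {f g} → Pos f → Pos g → f ∣P g → f ≤P g
∣⇒≤P {f} {g} f>0 g>0 (h , e) = subst₂ _≤P_ (*P-identityʳ f) e (*P-monoʳ-≤ f {1P} {h} f>0
  (1≤P {h} (Pos-factor {f} {h} f>0 (subst Pos (sym e) g>0))))

∣1⇒≡1 : ∀ {f} → Pos f → f ∣P 1P → f ≡ 1P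
∣1⇒≡1 {f} f>0 d = Data.Sum.[ (λ e → e) , (λ p → ⊥-elim (≤⇒≯P {f} {1P} (∣⇒≤P {f} {1P} f>0 Pos-1 d) p)) ]
  (Pos⇒1≤ {f} f>0)

∣P-trans : ∀ {f g h} → f ∣P g → g ∣P h → f ∣P h
∣P-trans {f} (a , refl) (b , refl) = a *P b , sym (*P-assoc f a b)

∣P⇒∣C : ∀ {f g} → Pos f → InC g → f ∣P g → f ∣C g
∣P⇒∣C {f} f>0 (inj₁ refl) _ = 0P , inj₁ refl , *P-comm f 0P
∣P⇒∣C {f} {g} f>0 (inj₂ g>0) (h , e) =
  h , Pos⇒InC {h} (Pos-factor {f} {h} f>0 (subst Pos (sym e) (0<⇒Pos {g} g>0))) , e

∣C⇒∣P : ∀ {f g} → f ∣C g → f ∣P g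
∣C⇒∣P (h , _ , e) = h , e

-- Units and Euclid's lemma for irreducible elements

IsUnit : Poly → Set
IsUnit f = ∃ λ ε → ε ℤ.* ε ≡ 1ℤ × f ≡ C ε

isUnit-neg : ∀ {f} → neg f ≡ 1P → IsUnit f
isUnit-neg {f} e = -[1+ 0 ] , refl , (begin
  f            ≡⟨ solve 1 (λ f → f := :- (:- f)) refl f ⟩
  neg (neg f)  ≡⟨ cong neg e ⟩
  neg 1P       ∎)
  where open ≡-Reasoning

irreducible-positive : ∀ {f g h} → ¬ ProperFactorization f → Pos g → Pos h → g *P h ≡ f → g ≡ 1P ⊎ h ≡ 1P
irreducible-positive {f} {g} {h} irr g>0 h>0 e = byCases (Pos⇒1≤ {g} g>0) (Pos⇒1≤ {h} h>0)
  where
  byCases : g ≡ 1P ⊎ 1P <P g → h ≡ 1P ⊎ 1P <P h → g ≡ 1P ⊎ h ≡ 1P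
  byCases (inj₁ e′) _          = inj₁ e′
  byCases (inj₂ _)  (inj₁ e′)  = inj₂ e′
  byCases (inj₂ p)  (inj₂ q)   = ⊥-elim (irr (g , h , p , q , e))

-- The two factors of a positive element have the same sign; if both are negative, both are negated.
irreducible-unit : ∀ {f g h} → Pos f → ¬ ProperFactorization f → g *P h ≡ f → IsUnit g ⊎ IsUnit h
irreducible-unit {f} {g} {h} f>0 irr e = byCases (trichotomy g)
  where
  one : ∀ {k} → k ≡ 1P → IsUnit k
  one k≡1 = 1ℤ , refl , k≡1
  byCases : g ≡ 0P ⊎ Pos g ⊎ Pos (neg g) → IsUnit g ⊎ IsUnit h
  byCases (inj₁ g≡0) = ⊥-elim (Pos⇒≢0 {f} f>0 (trans (sym e) (cong (_*P h) g≡0)))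
  byCases (inj₂ (inj₁ g>0)) = Data.Sum.map one one (irreducible-positive irr g>0
    (Pos-factor {g} {h} g>0 (subst Pos (sym e) f>0)) e)
  byCases (inj₂ (inj₂ -g>0)) = Data.Sum.map isUnit-neg isUnit-neg
    (irreducible-positive irr -g>0 (Pos-factor {neg g} {neg h} -g>0 (subst Pos (sym e′) f>0)) e′)
    where
    e′ : neg g *P neg h ≡ f
    e′ = trans (solve 2 (λ g h → (:- g) :* (:- h) := g :* h) refl g h) e

-- One factor in f = c y is a unit, and it cannot be y, since f would then be constant.
irreducible-primitive : ∀ {f} c → Big f → ¬ ProperFactorization f → C c ∣P f → c ℤ.* c ≡ 1ℤ
irreducible-primitive {f} c big irr (y , e) =
  Data.Sum.[ (λ { (ε , εε , e′) → trans (cong (λ z → z ℤ.* z) (C-injective {c} {ε} e′)) εε })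
           , (λ { (ε , _ , e′) → ⊥-elim (constant ε e′) }) ]
    (irreducible-unit {f} {C c} {y} (Big⇒Pos {f} big) irr e)
  where
  constant : ∀ ε → y ≢ C ε
  constant ε e′ = <P-irrefl {f} (subst (_<P f) (trans (C-* c ε) (trans (cong (C c *P_) (sym e′)) e))
    (C<Big {f} (c ℤ.* ε) big))

-- In c y = f z, `distribute` assigns a part c₁ of c to f. As f is primitive, c₁ = ±1, so up to sign
-- all of c cancels against z.
∣-cancelC : ∀ {f c y} → Big f → ¬ ProperFactorization f → c ≢ 0ℤ → f ∣P C c *P y → f ∣P y
∣-cancelC {f} {c} {y} big irr c≢0 (z , e) = C c₁ *P u′ , (begin
  f *P (C c₁ *P u′)             ≡⟨ cong (_*P (C c₁ *P u′)) g≡ ⟩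
  (C c₁ *P g′) *P (C c₁ *P u′)  ≡⟨ solve 3 (λ c g u → (c :* g) :* (c :* u) := c :* (c :* (g :* u))) refl (C c₁) g′ u′ ⟩
  C c₁ *P (C c₁ *P (g′ *P u′))  ≡⟨ C-square-cancel c₁ (g′ *P u′) (irreducible-primitive {f} c₁ big irr (g′ , sym g≡)) ⟩
  g′ *P u′                      ≡⟨ sym y≡ ⟩
  y                             ∎)
  where
  open ≡-Reasoning
  open Distributed (distribute c {y} {f} {z} c≢0 (sym e))

-- Let g be the gcd of f and a over ℚ, with g = c₁ g′ and f = g′ u′. If u′ is a unit, f equals g up
-- to constants and divides c a. If g′ is a unit, g is constant, and the Bézout identity multiplied
-- by b shows that f divides a constant multiple of b. `∣-cancelC` removes the constants.
euclid-Big : ∀ {f a b} → Big f → ¬ ProperFactorization f → f ∣P a *P b → f ∣P a ⊎ f ∣P b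
euclid-Big {f} {a} {b} big irr (z , e) = Data.Sum.map
    (λ { (ε , εε , u′≡) → ∣-cancelC {f} {c} {a} big irr c≢0 (C c₁ *P (C ε *P w) , sym (divides-a ε εε u′≡)) })
    (λ { (ε , εε , g′≡) → ∣-cancelC {f} {c₁ ℤ.* ε} {b} big irr (*≢0 c₁≢0 (λ { refl → 0≢1 εε }))
           (s *P b +P t *P z , sym (divides-b ε g′≡)) })
    (Data.Sum.swap (irreducible-unit {f} {g′} {u′} (Big⇒Pos {f} big) irr (sym y≡)))
  where
  open ≡-Reasoning
  open PseudoGCD (pseudoGCD (length (proj₁ a)) f a (degBelow-length a))
  open Distributed (distribute c {f} {g} {u} c≢0 cf≡gu)
  0≢1 : 0ℤ ≢ 1ℤ
  0≢1 ()
  c₁≢0 : c₁ ≢ 0ℤ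
  c₁≢0 h = c≢0 (trans c≡ (trans (cong (ℤ._* c₂) h) (ℤ.*-zeroˡ c₂)))
  divides-a : ∀ ε → ε ℤ.* ε ≡ 1ℤ → u′ ≡ C ε → C c *P a ≡ f *P (C c₁ *P (C ε *P w))
  divides-a ε εε u′≡ = begin
    C c *P a                           ≡⟨ ca≡gw ⟩
    g *P w                             ≡⟨ cong (_*P w) g≡ ⟩
    (C c₁ *P g′) *P w                  ≡⟨ cong (λ k → (C c₁ *P k) *P w) (sym (C-square-cancel ε g′ εε)) ⟩
    (C c₁ *P (C ε *P (C ε *P g′))) *P w
      ≡⟨ solve 4 (λ c e g w → (c :* (e :* (e :* g))) :* w := (g :* e) :* (c :* (e :* w))) refl (C c₁) (C ε) g′ w ⟩
    (g′ *P C ε) *P (C c₁ *P (C ε *P w)) ≡⟨ cong (_*P (C c₁ *P (C ε *P w))) (sym (trans y≡ (cong (g′ *P_) u′≡))) ⟩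
    f *P (C c₁ *P (C ε *P w))          ∎
  divides-b : ∀ ε → g′ ≡ C ε → C (c₁ ℤ.* ε) *P b ≡ f *P (s *P b +P t *P z)
  divides-b ε g′≡ = begin
    C (c₁ ℤ.* ε) *P b               ≡⟨ cong (_*P b) (trans (C-* c₁ ε) (trans (cong (C c₁ *P_) (sym g′≡)) (sym g≡))) ⟩
    g *P b                          ≡⟨ cong (_*P b) bezout ⟩
    (s *P f +P t *P a) *P b
      ≡⟨ solve 5 (λ s f t a b → (s :* f :+ t :* a) :* b := s :* f :* b :+ t :* (a :* b)) refl s f t a b ⟩
    (s *P f) *P b +P t *P (a *P b)  ≡⟨ cong (λ k → (s *P f) *P b +P t *P k) (sym e) ⟩
    (s *P f) *P b +P t *P (f *P z)
      ≡⟨ solve 5 (λ s f t b z → s :* f :* b :+ t :* (f :* z) := f :* (s :* b :+ t :* z)) refl s f t b z ⟩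
    f *P (s *P b +P t *P z)         ∎

natFactorization : ∀ n → 1 ℕ.< n → ¬ Prime n → ProperFactorization (C (+ n))
natFactorization n 1<n ¬p = factors (¬prime⇒composite ⦃ ℕ.n>1⇒nonTrivial 1<n ⦄ ¬p)
  where
  factors : Composite n → ProperFactorization (C (+ n))
  factors (ℕ.hasNonTrivialDivisor {divisor = d} ⦃ nt ⦄ d<n d∣n@(ℕ.divides q e)) =
   C (+ q) , C (+ d) , C<C {+ 1} {+ q} (+<+ 1<q) , C<C {+ 1} {+ d} (+<+ (ℕ.nonTrivial⇒n>1 d ⦃ nt ⦄))
   , trans (sym (C-* (+ q) (+ d))) (cong C (trans (sym (ℤ.pos-* q d)) (cong +_ (sym e))))
    where
    1<q : 1 ℕ.< q
    1<q = ℕ.quotient>1 d∣n d<n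

irreducible⇒prime : ∀ {f} → 1P <P f → ¬ ProperFactorization f → PrimeC f
irreducible⇒prime {f} 1<f irr = 1<f , λ a b c a∈ b∈ _ e → Data.Sum.map
  (∣P⇒∣C {f} {a} f>0 a∈) (∣P⇒∣C {f} {b} f>0 b∈) (euclid a b (c , e) (Pos-cases {f} f>0))
  where
  f>0 : Pos f
  f>0 = 1<⇒Pos {f} 1<f
  euclid : ∀ a b → f ∣P a *P b → (∃ λ k → f ≡ C (+ suc k)) ⊎ Big f → f ∣P a ⊎ f ∣P b
  euclid a b d (inj₂ big) = euclid-Big {f} {a} {b} big irr d
  euclid a b d (inj₁ (k , e)) = subst (λ x → x ∣P a *P b → x ∣P a ⊎ x ∣P b) (sym e) (gauss (isPrime (prime? (suc k))) a b) d
    where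
    isPrime : Dec (Prime (suc k)) → Prime (suc k)
    isPrime (yes p) = p
    isPrime (no ¬p) = ⊥-elim (irr (subst ProperFactorization (sym e) (natFactorization (suc k)
      (ℤ.drop‿+<+ (C<C⁻¹ {+ 1} {+ suc k} (subst (1P <P_) e 1<f))) ¬p)))

prime-or-factors : ∀ {f} → 1P <P f → PrimeC f ⊎ ProperFactorization f
prime-or-factors {f} 1<f = decide (properFactorization? f (Pos⇒≢0 {f} (1<⇒Pos {f} 1<f)))
  where
  decide : Dec (ProperFactorization f) → PrimeC f ⊎ ProperFactorization f
  decide (yes p) = inj₂ p
  decide (no ¬p) = inj₁ (irreducible⇒prime {f} 1<f ¬p)

-- Primes in 𝒞(ℤ[X]) and goodness

PrimeC⇒Pos : ∀ {v} → PrimeC v → Pos v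
PrimeC⇒Pos {v} (1<v , _) = 1<⇒Pos {v} 1<v

PrimeC-euclid : ∀ {v a b} → PrimeC v → Pos a → Pos b → v ∣P a *P b → v ∣P a ⊎ v ∣P b
PrimeC-euclid {v} {a} {b} pv@(_ , euclid) a>0 b>0 (c , e) =
  Data.Sum.map (∣C⇒∣P {v} {a}) (∣C⇒∣P {v} {b}) (euclid a b c (Pos⇒InC {a} a>0) (Pos⇒InC {b} b>0)
    (Pos⇒InC {c} (Pos-factor {v} {c} (PrimeC⇒Pos {v} pv) (subst Pos (sym e) (Pos-* {a} {b} a>0 b>0)))) e)

PrimeC⇒≢1 : ∀ {v} → PrimeC v → v ≢ 1P
PrimeC⇒≢1 {v} (1<v , _) e = <P-irrefl {1P} (subst (1P <P_) e 1<v)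

*-expands : ∀ {f g} → Pos f → 1P <P g → f <P f *P g
*-expands {f} {g} f>0 1<g = subst (_<P f *P g) (*P-identityʳ f) (*P-monoʳ-< f {1P} {g} f>0 1<g)

PrimeC⇒noFactors : ∀ {f} → PrimeC f → ¬ ProperFactorization f
PrimeC⇒noFactors {f} pf (g , h , 1<g , 1<h , e) = Data.Sum.[ absurd g h 1<g 1<h e , absurd h g 1<h 1<g (trans (*P-comm h g) e) ]
  (PrimeC-euclid {f} {g} {h} pf (1<⇒Pos {g} 1<g) (1<⇒Pos {h} 1<h) (1P , trans (*P-identityʳ f) (sym e)))
  where
  absurd : ∀ g h → 1P <P g → 1P <P h → g *P h ≡ f → ¬ (f ∣P g)
  absurd g h 1<g 1<h e d = ≤⇒≯P {f} {g} (∣⇒≤P {f} {g} (PrimeC⇒Pos {f} pf) (1<⇒Pos {g} 1<g) d)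
    (subst (g <P_) e (*-expands {g} {h} (1<⇒Pos {g} 1<g) 1<h))

primeC? : ∀ {f} → 1P <P f → Dec (PrimeC f)
primeC? {f} 1<f = Data.Sum.[ yes , (λ pf → no (λ p → PrimeC⇒noFactors {f} p pf)) ] (prime-or-factors {f} 1<f)

prime-C : ∀ {q} → Prime q → PrimeC (C (+ q))
prime-C {q} pq = 1<f , λ a b c a∈ b∈ _ e → Data.Sum.map
    (∣P⇒∣C {C (+ q)} {a} f>0 a∈) (∣P⇒∣C {C (+ q)} {b} f>0 b∈) (gauss pq a b (c , e))
  where
  1<f : 1P <P C (+ q)
  1<f = C<C {+ 1} {+ q} (+<+ (1<prime pq))
  f>0 = 1<⇒Pos {C (+ q)} 1<f

prime-C⁻¹ : ∀ {q} → PrimeC (C (+ q)) → Prime q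
prime-C⁻¹ {q} p = decide (prime? q)
  where
  decide : Dec (Prime q) → Prime q
  decide (yes pq) = pq
  decide (no ¬pq) = ⊥-elim (PrimeC⇒noFactors {C (+ q)} p
    (natFactorization q (ℤ.drop‿+<+ (C<C⁻¹ {+ 1} {+ q} (proj₁ p))) ¬pq))

-- The measure is degree plus leading coefficient: of two factors, the second
-- has positive degree or is a constant greater than 1.
primeFactor : ∀ {f} → 1P <P f → ∃ λ v → PrimeC v × v ∣P f
primeFactor {f} 1<f = let n , D , l>0 = Pos⇒top {f} (1<⇒Pos {f} 1<f) in
  go (n ℕ.+ ∣ f [ n ] ∣) f n D l>0 1<f ℕ.≤-refl
  where
  go : ∀ N f n → DegBelow f (suc n) → 0ℤ ℤ.< f [ n ] → 1P <P f → n ℕ.+ ∣ f [ n ] ∣ ℕ.≤ N →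
       ∃ λ v → PrimeC v × v ∣P f
  go N f n D l>0 1<f h = Data.Sum.[ (λ pf → f , pf , 1P , *P-identityʳ f) , descend N h ] (prime-or-factors {f} 1<f)
    where
    descend : ∀ N → n ℕ.+ ∣ f [ n ] ∣ ℕ.≤ N → ProperFactorization f → ∃ λ v → PrimeC v × v ∣P f
    descend N h (a , b , 1<a , 1<b , e) = step N h (Pos⇒top {a} (1<⇒Pos {a} 1<a)) (Pos⇒top {b} (1<⇒Pos {b} 1<b))
      where
      step : ∀ N → n ℕ.+ ∣ f [ n ] ∣ ℕ.≤ N → (∃ λ i → DegBelow a (suc i) × 0ℤ ℤ.< a [ i ]) →
             (∃ λ j → DegBelow b (suc j) × 0ℤ ℤ.< b [ j ]) → ∃ λ v → PrimeC v × v ∣P f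
      step N h (i , Da , ai) (j , Db , bj) = finish N (ℕ.<-≤-trans smaller h)
        where
        top≡ : f [ i ℕ.+ j ] ≡ a [ i ] ℤ.* b [ j ]
        top≡ = trans (cong (_[ i ℕ.+ j ]) (sym e)) (top-* i j a {b} Da Db)
        n≡ : n ≡ i ℕ.+ j
        n≡ = top-unique {f} D (λ z → ℤ.<-irrefl (sym z) l>0)
          (subst (λ f → DegBelow f (suc (i ℕ.+ j))) e (degBelow-* i a {b} Da Db))
          (λ z → ℤ.<-irrefl (sym (trans (sym top≡) z)) (0<* ai bj))
        ∣a∣ = ∣ a [ i ] ∣
        ∣b∣ = ∣ b [ j ] ∣
        f≡ : n ℕ.+ ∣ f [ n ] ∣ ≡ i ℕ.+ j ℕ.+ ∣a∣ ℕ.* ∣b∣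
        f≡ = trans (cong (λ n → n ℕ.+ ∣ f [ n ] ∣) n≡)
          (cong (λ z → i ℕ.+ j ℕ.+ z) (trans (cong ∣_∣ top≡) (ℤ.abs-* (a [ i ]) (b [ j ]))))
        nonZero : ∀ {z} → 0ℤ ℤ.< z → ℕ.NonZero ∣ z ∣
        nonZero z>0 = ℕ.≢-nonZero (λ e → ℤ.<-irrefl (sym (ℤ.∣i∣≡0⇒i≡0 e)) z>0)
        compare : ∀ j → DegBelow b (suc j) → 0ℤ ℤ.< b [ j ] → i ℕ.+ ∣a∣ ℕ.< i ℕ.+ j ℕ.+ ∣a∣ ℕ.* ∣ b [ j ] ∣
        compare (suc j) _ bj = ℕ.+-mono-<-≤ (ℕ.m<m+n i ℕ.z<s) (ℕ.m≤m*n ∣a∣ ∣ b [ suc j ] ∣ ⦃ nonZero bj ⦄)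
        compare zero Db bj = ℕ.+-mono-≤-< (ℕ.m≤m+n i 0) (ℕ.m<m*n ∣a∣ ∣ b [ 0 ] ∣ ⦃ nonZero ai ⦄ (1<∣b∣ (b [ 0 ])
            (C<C⁻¹ {1ℤ} {b [ 0 ]} (subst (1P <P_) (degBelow-1 {b} Db) 1<b))))
          where
          1<∣b∣ : ∀ z → 1ℤ ℤ.< z → 1 ℕ.< ∣ z ∣
          1<∣b∣ (+ m) (+<+ h) = h
        smaller : i ℕ.+ ∣a∣ ℕ.< n ℕ.+ ∣ f [ n ] ∣
        smaller = subst (i ℕ.+ ∣a∣ ℕ.<_) (sym f≡) (compare j Db bj)
        finish : ∀ N → i ℕ.+ ∣a∣ ℕ.< N → ∃ λ v → PrimeC v × v ∣P f
        finish (suc N) (s≤s h) = let v , pv , v∣a = go N a i Da ai 1<a h in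
          v , pv , ∣P-trans {v} {a} {f} v∣a (b , e)

-- As long as u does not divide d, it can be cancelled from the cofactor: d e = u² becomes d e′ = u
-- and then d e″ = 1.
divisor-of-square : ∀ {u d} → PrimeC u → Pos d → d ∣P u *P u → d ≡ 1P ⊎ u ∣P d
divisor-of-square {u} {d} pu d>0 (e , de≡uu) =
  Data.Sum.[ inj₂ , second ] (PrimeC-euclid {u} {d} {e} pu d>0 e>0 (u , sym de≡uu))
  where
  open ≡-Reasoning
  u>0 = PrimeC⇒Pos {u} pu
  e>0 : Pos e
  e>0 = Pos-factor {d} {e} d>0 (subst Pos (sym de≡uu) (Pos-* {u} {u} u>0 u>0))
  third : ∀ e′ → d *P e′ ≡ u → u ∣P e′ → d ≡ 1P ⊎ u ∣P d
  third e′ de′≡u (e″ , ue″≡e′) = inj₁ (∣1⇒≡1 {d} d>0 (e″ , *P-cancelˡ {u} {d *P e″} {1P} (Pos⇒≢0 {u} u>0) (begin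
    u *P (d *P e″)  ≡⟨ solve 3 (λ u d e → u :* (d :* e) := d :* (u :* e)) refl u d e″ ⟩
    d *P (u *P e″)  ≡⟨ cong (d *P_) ue″≡e′ ⟩
    d *P e′         ≡⟨ de′≡u ⟩
    u               ≡⟨ sym (*P-identityʳ u) ⟩
    u *P 1P         ∎)))
  second : u ∣P e → d ≡ 1P ⊎ u ∣P d
  second (e′ , ue′≡e) = Data.Sum.[ inj₂ , third e′ de′≡u ]
    (PrimeC-euclid {u} {d} {e′} pu d>0 (Pos-factor {u} {e′} u>0 (subst Pos (sym ue′≡e) e>0))
      (1P , trans (*P-identityʳ u) (sym de′≡u)))
    where
    de′≡u : d *P e′ ≡ u
    de′≡u = *P-cancelˡ {u} {d *P e′} {u} (Pos⇒≢0 {u} u>0) (begin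
      u *P (d *P e′)  ≡⟨ solve 3 (λ u d e → u :* (d :* e) := d :* (u :* e)) refl u d e′ ⟩
      d *P (u *P e′)  ≡⟨ cong (d *P_) ue′≡e ⟩
      d *P e          ≡⟨ de≡uu ⟩
      u *P u          ∎)

InC-cases : ∀ {f} → InC f → f ≡ 0P ⊎ Pos f
InC-cases {f} = map₂ (0<⇒Pos {f})

∣-Pos : ∀ {d f} → InC d → d ∣P f → Pos f → Pos d
∣-Pos {d} {f} d∈ (e , de≡f) f>0 = Data.Sum.[
    (λ d≡0 → ⊥-elim (Pos⇒≢0 {f} f>0 (trans (sym de≡f) (cong (_*P e) d≡0)))) , (λ d>0 → d>0) ] (InC-cases {d} d∈)

-- A divisor of u² other than 1 is a multiple of u, and u divides neither n nor a prime v ≤ p < u.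
-- So u² passes both coprimality tests.
square⇒¬Good : ∀ {p n u} → PrimeC u → p <P u → ¬ (u ∣P n) → u *P u <P n → ¬ GoodC p n
square⇒¬Good {p} {n} {u} pu p<u u∤n uu<n good = PrimeC⇒noFactors {u *P u}
    (good (u *P u) (Pos⇒InC {u *P u} uu>0) 1<uu uu<n coprime-n coprime-v)
    (u , u , proj₁ pu , proj₁ pu , refl)
  where
  u>0 = PrimeC⇒Pos {u} pu
  uu>0 : Pos (u *P u)
  uu>0 = Pos-* {u} {u} u>0 u>0
  1<uu : 1P <P u *P u
  1<uu = <P-trans {1P} {u} {u *P u} (proj₁ pu) (*-expands {u} {u} u>0 (proj₁ pu))
  coprime : ∀ d → InC d → d ∣C u *P u → ¬ (u ∣P d) → d ≡ 1P
  coprime d d∈ d∣uu u∤d = Data.Sum.[ (λ e → e) , (λ u∣d → ⊥-elim (u∤d u∣d)) ]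
    (divisor-of-square {u} {d} pu (∣-Pos {d} {u *P u} d∈ (∣C⇒∣P {d} {u *P u} d∣uu) uu>0) (∣C⇒∣P {d} {u *P u} d∣uu))
  coprime-n : RelPrimeC (u *P u) n
  coprime-n d d∈ d∣uu d∣n = coprime d d∈ d∣uu (λ u∣d → u∤n (∣P-trans {u} {d} {n} u∣d (∣C⇒∣P {d} {n} d∣n)))
  coprime-v : ∀ v → InC v → PrimeC v → v ≤P p → RelPrimeC v (u *P u)
  coprime-v v _ pv v≤p d d∈ d∣v d∣uu = coprime d d∈ d∣uu λ u∣d →
    ≤⇒≯P {u} {v} (∣⇒≤P {u} {v} u>0 (PrimeC⇒Pos {v} pv) (∣P-trans {u} {d} {v} u∣d (∣C⇒∣P {d} {v} d∣v)))
      (≤-<P-trans {v} {p} {u} v≤p p<u)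

noSquare⇒Good : ∀ {p n} → InC n → (∀ q → PrimeC q → p <P q → ¬ (q ∣P n) → ¬ (q *P q <P n)) → GoodC p n
noSquare⇒Good {p} {n} n∈ noSquare t t∈ 1<t t<n coprime-n coprime-v =
  Data.Sum.[ (λ pt → pt) , (λ { (g , h , 1<g , 1<h , e) → ⊥-elim (notComposite g h 1<g 1<h e) }) ] (prime-or-factors {t} 1<t)
  where
  -- Since v divides t, the common divisor v itself refutes the coprimality of t with v if v ≤ p,
  -- and with n if v divides n.
  primeFactor-avoids : ∀ v → PrimeC v → v ∣P t → p <P v × ¬ (v ∣P n)
  primeFactor-avoids v pv v∣t =
    Data.Sum.[ (λ v≤p → ⊥-elim (PrimeC⇒≢1 {v} pv (coprime-v v v∈ pv v≤p v v∈ (1P , Pos⇒InC {1P} Pos-1 , *P-identityʳ v) v∣Ct)))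
             , (λ p<v → p<v) ]′ (≤-or-> v p)
    , λ v∣n → PrimeC⇒≢1 {v} pv (coprime-n v v∈ v∣Ct (∣P⇒∣C {v} {n} v>0 n∈ v∣n))
    where
    v>0 = PrimeC⇒Pos {v} pv
    v∈ : InC v
    v∈ = Pos⇒InC {v} v>0
    v∣Ct : v ∣C t
    v∣Ct = ∣P⇒∣C {v} {t} v>0 t∈ v∣t
  small : ∀ v w g h → PrimeC v → PrimeC w → v ∣P g → w ∣P h → Pos g → Pos h → g *P h ≡ t → v ≤P w → ⊥
  small v w g h pv pw v∣g w∣h g>0 h>0 e v≤w =
    let p<v , v∤n = primeFactor-avoids v pv (∣P-trans {v} {g} {t} v∣g (h , e)) in
    noSquare v pv p<v v∤n (≤-<P-trans {v *P v} {t} {n} (subst (v *P v ≤P_) e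
      (*P-mono-≤ {v} {g} {v} {h} v>0 h>0 (∣⇒≤P {v} {g} v>0 g>0 v∣g)
        (≤P-trans {v} {w} {h} v≤w (∣⇒≤P {w} {h} (PrimeC⇒Pos {w} pw) h>0 w∣h)))) t<n)
    where v>0 = PrimeC⇒Pos {v} pv
  notComposite : ∀ g h → 1P <P g → 1P <P h → g *P h ≡ t → ⊥
  notComposite g h 1<g 1<h e =
    let v , pv , v∣g = primeFactor {g} 1<g
        w , pw , w∣h = primeFactor {h} 1<h
    in Data.Sum.[ small v w g h pv pw v∣g w∣h g>0 h>0 e
                , (λ w<v → small w v h g pw pv w∣h v∣g h>0 g>0 (trans (*P-comm h g) e) (inj₁ w<v)) ]′ (≤-or-> v w)
    where
    g>0 = 1<⇒Pos {g} 1<g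
    h>0 = 1<⇒Pos {h} 1<h

-- A prime below √n not dividing n

-- The integers F are D ∫₀¹ xⁱ(1−x)ʲ dx = D i! j! / (i+j+1)!.
betaIntegral : ∀ D M → (∀ i → i ℕ.< M → suc i ℕ.∣ D) → ∀ j i → i ℕ.+ j ℕ.< M →
  ∃ λ F → + D ℤ.* + (i ! ℕ.* j !) ≡ F ℤ.* + (suc (i ℕ.+ j) !)
betaIntegral D M div zero i h with div i (subst (ℕ._< M) (ℕ.+-identityʳ i) h)
... | ℕ.divides k refl = + k , (begin
  + (k ℕ.* suc i) ℤ.* + (i ! ℕ.* 1)   ≡⟨ sym (ℤ.pos-* (k ℕ.* suc i) (i ! ℕ.* 1)) ⟩
  + (k ℕ.* suc i ℕ.* (i ! ℕ.* 1))     ≡⟨ cong +_ (lem k i (i !)) ⟩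
  + (k ℕ.* (suc i ℕ.* i !))           ≡⟨ cong (λ i → + (k ℕ.* (suc i !))) (sym (ℕ.+-identityʳ i)) ⟩
  + (k ℕ.* (suc (i ℕ.+ 0) !))         ≡⟨ ℤ.pos-* k (suc (i ℕ.+ 0) !) ⟩
  + k ℤ.* + (suc (i ℕ.+ 0) !)         ∎)
  where
  open ≡-Reasoning
  lem : ∀ k i f → k ℕ.* suc i ℕ.* (f ℕ.* 1) ≡ k ℕ.* (suc i ℕ.* f)
  lem = ℕ-Ring.solve-∀
betaIntegral D M div (suc j) i h =
  -- The recursion ∫ xⁱ(1-x)ʲ⁺¹ = ∫ xⁱ(1-x)ʲ - ∫ xⁱ⁺¹(1-x)ʲ, multiplied by D. The base case was ∫ xⁱ
  -- = 1/(i+1), where i + 1 divides D.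
  let F₁ , e₁ = betaIntegral D M div j i (ℕ.<-trans (ℕ.+-monoʳ-< i (ℕ.n<1+n j)) h)
      F₂ , e₂ = betaIntegral D M div j (suc i) (subst (ℕ._< M) (ℕ.+-suc i j) h)
  in F₁ ℤ.- F₂ , combine F₁ F₂ e₁ e₂
  where
  open ≡-Reasoning
  A = suc (i ℕ.+ j) !
  combine : ∀ F₁ F₂ → + D ℤ.* + (i ! ℕ.* j !) ≡ F₁ ℤ.* + A →
    + D ℤ.* + (suc i ! ℕ.* j !) ≡ F₂ ℤ.* + (suc (suc i ℕ.+ j) !) →
    + D ℤ.* + (i ! ℕ.* suc j !) ≡ (F₁ ℤ.- F₂) ℤ.* + (suc (i ℕ.+ suc j) !)
  combine F₁ F₂ e₁ e₂ = begin
    + D ℤ.* + (i ! ℕ.* (suc j ℕ.* j !))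
      ≡⟨ cong (λ z → + D ℤ.* z) (trans (cong +_ (nat (i !) (suc j) (j !))) (ℤ.pos-* (suc j) (i ! ℕ.* j !))) ⟩
    + D ℤ.* (+ suc j ℤ.* + (i ! ℕ.* j !))
      ≡⟨ int (+ D) (+ suc i) (+ suc j) (+ (i ! ℕ.* j !)) ⟩
    + D ℤ.* + (i ! ℕ.* j !) ℤ.* (+ suc i ℤ.+ + suc j) ℤ.- + D ℤ.* (+ suc i ℤ.* + (i ! ℕ.* j !))
      ≡⟨ cong₂ (λ u v → + D ℤ.* + (i ! ℕ.* j !) ℤ.* u ℤ.- + D ℤ.* v)
           (sym (ℤ.pos-+ (suc i) (suc j)))
           (trans (sym (ℤ.pos-* (suc i) (i ! ℕ.* j !))) (cong +_ (sym (ℕ.*-assoc (suc i) (i !) (j !))))) ⟩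
    + D ℤ.* + (i ! ℕ.* j !) ℤ.* + (suc i ℕ.+ suc j) ℤ.- + D ℤ.* + (suc i ! ℕ.* j !)
      ≡⟨ cong₂ (λ u v → u ℤ.* + (suc i ℕ.+ suc j) ℤ.- v) e₁ e₂ ⟩
    F₁ ℤ.* + A ℤ.* + (suc i ℕ.+ suc j) ℤ.- F₂ ℤ.* + (suc (suc i ℕ.+ j) !)
      ≡⟨ cong (λ n → F₁ ℤ.* + A ℤ.* + n ℤ.- F₂ ℤ.* + (suc (suc i ℕ.+ j) !)) (cong suc (ℕ.+-suc i j)) ⟩
    F₁ ℤ.* + A ℤ.* + s ℤ.- F₂ ℤ.* + (s ℕ.* A)
      ≡⟨ cong (λ z → F₁ ℤ.* + A ℤ.* + s ℤ.- F₂ ℤ.* z) (ℤ.pos-* s A) ⟩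
    F₁ ℤ.* + A ℤ.* + s ℤ.- F₂ ℤ.* (+ s ℤ.* + A)
      ≡⟨ int′ F₁ F₂ (+ A) (+ s) ⟩
    (F₁ ℤ.- F₂) ℤ.* (+ s ℤ.* + A)
      ≡⟨ cong (λ z → (F₁ ℤ.- F₂) ℤ.* z) (sym (ℤ.pos-* s A)) ⟩
    (F₁ ℤ.- F₂) ℤ.* + (s ℕ.* A)
      ≡⟨ cong (λ n → (F₁ ℤ.- F₂) ℤ.* + (suc n !)) (sym (ℕ.+-suc i j)) ⟩
    (F₁ ℤ.- F₂) ℤ.* + (suc (i ℕ.+ suc j) !) ∎
    where
    s = suc (suc (i ℕ.+ j))
    nat : ∀ a b c → a ℕ.* (b ℕ.* c) ≡ b ℕ.* (a ℕ.* c)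
    nat = ℕ-Ring.solve-∀
    int : ∀ d a b f → d ℤ.* (b ℤ.* f) ≡ d ℤ.* f ℤ.* (a ℤ.+ b) ℤ.- d ℤ.* (a ℤ.* f)
    int = solve-∀
    int′ : ∀ F G a s → F ℤ.* a ℤ.* s ℤ.- G ℤ.* (s ℤ.* a) ≡ (F ℤ.- G) ℤ.* (s ℤ.* a)
    int′ = solve-∀

-- Passing to m + 1 multiplies the left side by 2(m+1)² and the right side by (2m+2)(2m+3).
2^m*m!*m!≤ : ∀ m → 2 ℕ.^ m ℕ.* (m ! ℕ.* m !) ℕ.≤ suc (m ℕ.+ m) !
2^m*m!*m!≤ zero    = s≤s z≤n
2^m*m!*m!≤ (suc m) = begin
  2 ℕ.* 2 ℕ.^ m ℕ.* (suc m ℕ.* m ! ℕ.* (suc m ℕ.* m !))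
    ≡⟨ lem m (2 ℕ.^ m) (m !) ⟩
  (suc m ℕ.+ suc m) ℕ.* suc m ℕ.* (2 ℕ.^ m ℕ.* (m ! ℕ.* m !))
    ≤⟨ ℕ.*-mono-≤ (ℕ.*-mono-≤ (ℕ.n≤1+n (suc m ℕ.+ suc m)) (ℕ.m≤m+n (suc m) (suc m))) (2^m*m!*m!≤ m) ⟩
  suc (suc m ℕ.+ suc m) ℕ.* (suc m ℕ.+ suc m) ℕ.* (suc (m ℕ.+ m) !)
    ≡⟨ cong (λ k → suc (suc m ℕ.+ suc m) ℕ.* (suc m ℕ.+ suc m) ℕ.* (k !)) (sym (ℕ.+-suc m m)) ⟩
  suc (suc m ℕ.+ suc m) ℕ.* (suc m ℕ.+ suc m) ℕ.* ((m ℕ.+ suc m) !)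
    ≡⟨ ℕ.*-assoc (suc (suc m ℕ.+ suc m)) (suc m ℕ.+ suc m) ((m ℕ.+ suc m) !) ⟩
  suc (suc m ℕ.+ suc m) ! ∎
  where
  open ℕ.≤-Reasoning
  lem : ∀ m p f → 2 ℕ.* p ℕ.* (suc m ℕ.* f ℕ.* (suc m ℕ.* f)) ≡
                  (suc m ℕ.+ suc m) ℕ.* suc m ℕ.* (p ℕ.* (f ℕ.* f))
  lem = ℕ-Ring.solve-∀

-- For i = j = m, D m!² = F (2m+1)! with a nonzero integer F, so D ≥ (2m+1)!/m!² ≥ 2^m.
commonMultiple≥2^ : ∀ D m → D ≢ 0 → (∀ i → i ℕ.< suc (m ℕ.+ m) → suc i ℕ.∣ D) → 2 ℕ.^ m ℕ.≤ D
commonMultiple≥2^ D m D≢0 div with betaIntegral D (suc (m ℕ.+ m)) div m m (ℕ.n<1+n (m ℕ.+ m))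
... | F , e = ℕ.*-cancelʳ-≤ (2 ℕ.^ m) D (m ! ℕ.* m !) ⦃ m ℕ.!* m !≢0 ⦄ (begin
  2 ℕ.^ m ℕ.* (m ! ℕ.* m !)    ≤⟨ 2^m*m!*m!≤ m ⟩
  A                            ≤⟨ ℕ.m≤n*m A ∣ F ∣ ⦃ ℕ.≢-nonZero F≢0 ⦄ ⟩
  ∣ F ∣ ℕ.* A                  ≡⟨ sym ∣e∣ ⟩
  D ℕ.* (m ! ℕ.* m !)          ∎)
  where
  open ℕ.≤-Reasoning
  A = suc (m ℕ.+ m) !
  ∣e∣ : D ℕ.* (m ! ℕ.* m !) ≡ ∣ F ∣ ℕ.* A
  ∣e∣ = trans (sym (ℤ.abs-* (+ D) (+ (m ! ℕ.* m !)))) (trans (cong ∣_∣ e) (ℤ.abs-* F (+ A)))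
  F≢0 : ∣ F ∣ ≢ 0
  F≢0 z = ℕ.≢-nonZero⁻¹ (D ℕ.* (m ! ℕ.* m !))
    ⦃ ℕ.m*n≢0 D (m ! ℕ.* m !) ⦃ ℕ.≢-nonZero D≢0 ⦄ ⦃ m ℕ.!* m !≢0 ⦄ ⦄ (trans ∣e∣ (cong (ℕ._* A) z))

-- A positive number below 2^L has fewer than L prime factors with multiplicity, and each of them
-- divides M. Every step strips one prime from k and one factor M from the power.
divides-power : ∀ {B M} → (∀ q → Prime q → q ℕ.< B → q ℕ.∣ M) →
  ∀ L k → 0 ℕ.< k → k ℕ.< B → k ℕ.< 2 ℕ.^ L → k ℕ.∣ M ℕ.^ L
divides-power primes zero    (suc k) _ _ (s≤s ())
divides-power primes (suc L) 1 _ _ _ = ℕ.1∣ _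
divides-power {B} {M} primes (suc L) k@(suc (suc _)) _ k<B k<2^ with primeDivisor k (s≤s (s≤s z≤n))
... | q , pq , ℕ.divides c e = subst₂ ℕ._∣_ (trans (ℕ.*-comm q c) (sym e)) refl
    (ℕ.*-pres-∣ (primes q pq q<B) (divides-power {B} {M} primes L c 0<c c<B c<2^))
  where
  0<c : 0 ℕ.< c
  0<c = ℕ.n≢0⇒n>0 λ { refl → case e }
    where
    case : k ≢ 0
    case ()
  c*2≤k : c ℕ.* 2 ℕ.≤ k
  c*2≤k = subst (c ℕ.* 2 ℕ.≤_) (sym e) (ℕ.*-monoʳ-≤ c (1<prime pq))
  q<B : q ℕ.< B
  q<B = ℕ.≤-<-trans (subst (q ℕ.≤_) (sym e) (ℕ.m≤n*m q c ⦃ ℕ.>-nonZero 0<c ⦄)) k<B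
  c<B : c ℕ.< B
  c<B = ℕ.≤-<-trans (ℕ.≤-trans (ℕ.m≤m*n c 2) c*2≤k) k<B
  c<2^ : c ℕ.< 2 ℕ.^ L
  c<2^ = ℕ.*-cancelˡ-< 2 c (2 ℕ.^ L) (ℕ.≤-<-trans (subst (ℕ._≤ k) (ℕ.*-comm c 2) c*2≤k) k<2^)

-- (3K + 4)(K + 1) + 1 < 2^K for K = 12 + j.
quadratic<2^ : ∀ j → (40 ℕ.+ 3 ℕ.* j) ℕ.* (13 ℕ.+ j) ℕ.+ 1 ℕ.< 4096 ℕ.* 2 ℕ.^ j
quadratic<2^ zero = toWitness {a? = 521 ℕ.<? 4096} _
quadratic<2^ (suc j) = begin-strict
  (40 ℕ.+ 3 ℕ.* suc j) ℕ.* (13 ℕ.+ suc j) ℕ.+ 1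
    -- The added polynomial is twice the old left side minus the new one.
    ≤⟨ ℕ.m≤m+n _ (439 ℕ.+ 73 ℕ.* j ℕ.+ 3 ℕ.* (j ℕ.* j)) ⟩
  (40 ℕ.+ 3 ℕ.* suc j) ℕ.* (13 ℕ.+ suc j) ℕ.+ 1 ℕ.+ (439 ℕ.+ 73 ℕ.* j ℕ.+ 3 ℕ.* (j ℕ.* j))
    ≡⟨ lem j ⟩
  2 ℕ.* ((40 ℕ.+ 3 ℕ.* j) ℕ.* (13 ℕ.+ j) ℕ.+ 1)
    <⟨ ℕ.*-monoʳ-< 2 (quadratic<2^ j) ⟩
  2 ℕ.* (4096 ℕ.* 2 ℕ.^ j)
    ≡⟨ lem′ (2 ℕ.^ j) ⟩
  4096 ℕ.* (2 ℕ.* 2 ℕ.^ j) ∎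
  where
  open ℕ.≤-Reasoning
  lem : ∀ j → (40 ℕ.+ 3 ℕ.* suc j) ℕ.* (13 ℕ.+ suc j) ℕ.+ 1 ℕ.+ (439 ℕ.+ 73 ℕ.* j ℕ.+ 3 ℕ.* (j ℕ.* j)) ≡
              2 ℕ.* ((40 ℕ.+ 3 ℕ.* j) ℕ.* (13 ℕ.+ j) ℕ.+ 1)
  lem = ℕ-Ring.solve-∀
  lem′ : ∀ x → 2 ℕ.* (4096 ℕ.* x) ≡ 4096 ℕ.* (2 ℕ.* x)
  lem′ = ℕ-Ring.solve-∀

-- With P ≤ K the left side is at most (3K + 4)(K + 1) + 1. The hypothesis secures both P ≤ K and
-- the starting point K ≥ 12 of `quadratic<2^`.
exponent<2^ : ∀ P K → P ℕ.+ 12 ℕ.≤ K → suc ((suc (suc K) ℕ.+ suc (suc K) ℕ.+ P) ℕ.* suc K) ℕ.< 2 ℕ.^ K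
exponent<2^ P K h = subst (λ K → suc ((suc (suc K) ℕ.+ suc (suc K) ℕ.+ P) ℕ.* suc K) ℕ.< 2 ℕ.^ K) (ℕ.m+[n∸m]≡n 12≤K) (begin-strict
  suc ((suc (suc K′) ℕ.+ suc (suc K′) ℕ.+ P) ℕ.* suc K′)
    ≤⟨ s≤s (ℕ.*-monoˡ-≤ (suc K′) (ℕ.+-monoʳ-≤ (suc (suc K′) ℕ.+ suc (suc K′)) P≤K′)) ⟩
  suc ((suc (suc K′) ℕ.+ suc (suc K′) ℕ.+ K′) ℕ.* suc K′)
    ≡⟨ lem j ⟩
  (40 ℕ.+ 3 ℕ.* j) ℕ.* (13 ℕ.+ j) ℕ.+ 1
    <⟨ quadratic<2^ j ⟩
  4096 ℕ.* 2 ℕ.^ j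
    ≡⟨ sym (ℕ.^-distribˡ-+-* 2 12 j) ⟩
  2 ℕ.^ K′ ∎)
  where
  open ℕ.≤-Reasoning
  12≤K : 12 ℕ.≤ K
  12≤K = ℕ.≤-trans (ℕ.m≤n+m 12 P) h
  j = K ℕ.∸ 12
  K′ = 12 ℕ.+ j
  P≤K′ : P ℕ.≤ K′
  P≤K′ = subst (P ℕ.≤_) (sym (ℕ.m+[n∸m]≡n 12≤K)) (ℕ.≤-trans (ℕ.m≤m+n P 12) h)
  lem : ∀ j → suc ((suc (suc (12 ℕ.+ j)) ℕ.+ suc (suc (12 ℕ.+ j)) ℕ.+ (12 ℕ.+ j)) ℕ.* suc (12 ℕ.+ j)) ≡
              (40 ℕ.+ 3 ℕ.* j) ℕ.* (13 ℕ.+ j) ℕ.+ 1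
  lem = ℕ-Ring.solve-∀

n<2^n : ∀ n → n ℕ.< 2 ℕ.^ n
n<2^n zero    = s≤s z≤n
n<2^n (suc n) = begin-strict
  suc n              ≤⟨ n<2^n n ⟩
  2 ℕ.^ n            <⟨ ℕ.m<m+n (2 ℕ.^ n) (ℕ.m^n>0 2 n) ⟩
  2 ℕ.^ n ℕ.+ 2 ℕ.^ n  ≡⟨ cong (2 ℕ.^ n ℕ.+_) (sym (ℕ.+-identityʳ (2 ℕ.^ n))) ⟩
  2 ℕ.^ suc n        ∎
  where open ℕ.≤-Reasoning

-- Base 4 is chosen because any q below 2^L then satisfies q² < 4^L ≤ n.
log₄ : ∀ L₀ n → 2 ℕ.^ (L₀ ℕ.+ L₀) ℕ.≤ n →
  ∃ λ L → L₀ ℕ.≤ L × 2 ℕ.^ (L ℕ.+ L) ℕ.≤ n × n ℕ.< 2 ℕ.^ (suc L ℕ.+ suc L)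
log₄ L₀ n h = go n (ℕ.<-≤-trans (n<2^n n) (ℕ.^-monoʳ-≤ 2 (ℕ.≤-trans (ℕ.m≤n+m n L₀) (ℕ.m≤n+m (L₀ ℕ.+ n) (L₀ ℕ.+ n)))))
  where
  go : ∀ t → n ℕ.< 2 ℕ.^ ((L₀ ℕ.+ t) ℕ.+ (L₀ ℕ.+ t)) →
    ∃ λ L → L₀ ℕ.≤ L × 2 ℕ.^ (L ℕ.+ L) ℕ.≤ n × n ℕ.< 2 ℕ.^ (suc L ℕ.+ suc L)
  go zero    n< = ⊥-elim (ℕ.<⇒≱ n< (subst (λ l → 2 ℕ.^ (l ℕ.+ l) ℕ.≤ n) (sym (ℕ.+-identityʳ L₀)) h))
  go (suc t) n< with n ℕ.<? 2 ℕ.^ ((L₀ ℕ.+ t) ℕ.+ (L₀ ℕ.+ t))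
  ... | yes p = go t p
  ... | no ¬p = L₀ ℕ.+ t , ℕ.m≤m+n L₀ t , ℕ.≮⇒≥ ¬p
              , subst (λ l → n ℕ.< 2 ℕ.^ (l ℕ.+ l)) (ℕ.+-suc L₀ t) n<

HasPrimeSquare : ℕ → ℕ → Set
HasPrimeSquare k n = ∃ λ q → q ℕ.< n × Prime q × k ℕ.< q × ¬ q ℕ.∣ n × q ℕ.* q ℕ.< n

hasPrimeSquare? : ∀ k n → Dec (HasPrimeSquare k n)
hasPrimeSquare? k n = ℕ.anyUpTo?
  (λ q → prime? q ×-dec k ℕ.<? q ×-dec ¬? (q ℕ.∣? n) ×-dec q ℕ.* q ℕ.<? n) n

-- If every prime below 2^(K+1) divided M = n P, then M^(K+1) would be a common
-- multiple of 1, …, 2^(K+1) − 1 smaller than 2^(2^K − 1).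
primeNonDivisor : ∀ P K n → P ℕ.+ 12 ℕ.≤ K → n ≢ 0 → P ≢ 0 → n ℕ.< 2 ℕ.^ (suc (suc K) ℕ.+ suc (suc K)) →
  ∃ λ q → q ℕ.< 2 ℕ.^ suc K × Prime q × ¬ q ℕ.∣ n ℕ.* P
primeNonDivisor P K n h n≢0 P≢0 n< with ℕ.anyUpTo? (λ q → prime? q ×-dec ¬? (q ℕ.∣? n ℕ.* P)) (2 ℕ.^ suc K)
... | yes p = p
... | no ¬p = ⊥-elim (ℕ.<⇒≱ D<2^m (commonMultiple≥2^ D m D≢0 λ i i< →
    divides-power {2 ℕ.^ suc K} primes (suc K) (suc i) ℕ.z<s (below i i<) (below i i<)))
  where
  M = n ℕ.* P
  D = M ℕ.^ suc K
  -- Chosen so that 2m + 1 = 2^(K+1) - 1, the last number below the bound on the primes.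
  m = ℕ.pred (2 ℕ.^ K)
  suc-m : suc m ≡ 2 ℕ.^ K
  suc-m = ℕ.suc-pred (2 ℕ.^ K) ⦃ ℕ.m^n≢0 2 K ⦄
  M≢0 : ℕ.NonZero M
  M≢0 = ℕ.m*n≢0 n P ⦃ ℕ.≢-nonZero n≢0 ⦄ ⦃ ℕ.≢-nonZero P≢0 ⦄
  D≢0 : D ≢ 0
  D≢0 = ℕ.≢-nonZero⁻¹ D ⦃ ℕ.m^n≢0 M (suc K) ⦃ M≢0 ⦄ ⦄
  primes : ∀ q → Prime q → q ℕ.< 2 ℕ.^ suc K → q ℕ.∣ M
  primes q pq q< with q ℕ.∣? M
  ... | yes d = d
  ... | no ¬d = ⊥-elim (¬p (q , q< , pq , ¬d))
  below : ∀ i → i ℕ.< suc (m ℕ.+ m) → suc i ℕ.< 2 ℕ.^ suc K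
  below i i< = ℕ.≤-<-trans i< (subst (λ x → suc (m ℕ.+ m) ℕ.< x ℕ.+ (x ℕ.+ 0)) suc-m
    (ℕ.≤-reflexive (lem m)))
    where
    lem : ∀ m → suc (suc (m ℕ.+ m)) ≡ suc m ℕ.+ (suc m ℕ.+ 0)
    lem = ℕ-Ring.solve-∀
  e = (suc (suc K) ℕ.+ suc (suc K) ℕ.+ P) ℕ.* suc K
  e<m : e ℕ.< m
  e<m = ℕ.≤-pred (subst (suc e ℕ.<_) (sym suc-m) (exponent<2^ P K h))
  D<2^m : D ℕ.< 2 ℕ.^ m
  D<2^m = begin-strict
    (n ℕ.* P) ℕ.^ suc K
      ≤⟨ ℕ.^-monoˡ-≤ (suc K) (ℕ.*-mono-≤ (ℕ.<⇒≤ n<) (ℕ.<⇒≤ (n<2^n P))) ⟩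
    (2 ℕ.^ (suc (suc K) ℕ.+ suc (suc K)) ℕ.* 2 ℕ.^ P) ℕ.^ suc K
      ≡⟨ cong (ℕ._^ suc K) (sym (ℕ.^-distribˡ-+-* 2 (suc (suc K) ℕ.+ suc (suc K)) P)) ⟩
    (2 ℕ.^ (suc (suc K) ℕ.+ suc (suc K) ℕ.+ P)) ℕ.^ suc K
      ≡⟨ ℕ.^-*-assoc 2 (suc (suc K) ℕ.+ suc (suc K) ℕ.+ P) (suc K) ⟩
    2 ℕ.^ e
      <⟨ ℕ.^-monoʳ-< 2 (s≤s (s≤s z≤n)) e<m ⟩
    2 ℕ.^ m ∎
    where open ℕ.≤-Reasoning

∣! : ∀ {q k} → 0 ℕ.< q → q ℕ.≤ k → q ℕ.∣ k !
∣! {suc q} _ q≤k = ℕ.∣-trans (ℕ.m∣m*n (q !)) (ℕ.m≤n⇒m!∣n! q≤k)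

-- Every prime up to k divides k!, so a prime that does not divide n k! exceeds k and does not
-- divide n.
eventually-hasPrimeSquare : ∀ k → ∃ λ N → ∀ n → N ℕ.≤ n → HasPrimeSquare k n
eventually-hasPrimeSquare k = 2 ℕ.^ (L₀ ℕ.+ L₀) , λ n N≤n → fromLog n (log₄ L₀ n N≤n)
  where
  -- `primeNonDivisor` is applied with K + 1 = L and needs K ≥ k! + 12; hence the successor.
  L₀ = suc (k ! ℕ.+ 12)
  fromLog : ∀ n → (∃ λ L → L₀ ℕ.≤ L × 2 ℕ.^ (L ℕ.+ L) ℕ.≤ n × n ℕ.< 2 ℕ.^ (suc L ℕ.+ suc L)) → HasPrimeSquare k n
  fromLog n (suc K , s≤s L₀≤L , lower , upper) =
    let q , q< , pq , q∤ = primeNonDivisor (k !) K n L₀≤L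
                             (λ { refl → ℕ.<⇒≱ (ℕ.m^n>0 2 (suc K ℕ.+ suc K)) lower })
                             (ℕ.≢-nonZero⁻¹ (k !) ⦃ k ℕ.!≢0 ⦄) upper
        0<q = ℕ.<-trans ℕ.z<s (1<prime pq)
        q²<n = ℕ.<-≤-trans (subst (q ℕ.* q ℕ.<_) (sym (ℕ.^-distribˡ-+-* 2 (suc K) (suc K))) (ℕ.*-mono-< q< q<)) lower
    in q , ℕ.≤-<-trans (ℕ.m≤m*n q q ⦃ ℕ.>-nonZero 0<q ⦄) q²<n , pq
     , ℕ.≰⇒> (λ q≤k → q∤ (ℕ.∣n⇒∣m*n n (∣! 0<q q≤k)))
     , (λ q∣n → q∤ (ℕ.∣m⇒∣m*n (k !) q∣n)) , q²<n

-- Prime translates of a nonconstant polynomial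

normR : List ℤ → ℕ
normR []      = 0
normR (a ∷ l) = ∣ a ∣ ℕ.+ normR l

normR-norm : ∀ l → normR (norm l) ≡ normR l
normR-norm []      = refl
normR-norm (a ∷ l) = trans (normR-cons a (norm l)) (cong (∣ a ∣ ℕ.+_) (normR-norm l))
  where
  normR-cons : ∀ a l → normR (cons a l) ≡ normR (a ∷ l)
  normR-cons (+ zero)  []      = refl
  normR-cons (+ suc n) []      = refl
  normR-cons -[1+ n ]  []      = refl
  normR-cons a         (b ∷ l) = refl

normR-addR : ∀ p q → normR (addR p q) ℕ.≤ normR p ℕ.+ normR q
normR-addR []      q       = ℕ.≤-refl
normR-addR (a ∷ p) []      = ℕ.m≤m+n _ 0
normR-addR (a ∷ p) (b ∷ q) = begin
  ∣ a ℤ.+ b ∣ ℕ.+ normR (addR p q)                ≤⟨ ℕ.+-mono-≤ (ℤ.∣i+j∣≤∣i∣+∣j∣ a b) (normR-addR p q) ⟩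
  ∣ a ∣ ℕ.+ ∣ b ∣ ℕ.+ (normR p ℕ.+ normR q)       ≡⟨ interchange ℕ.+-commutativeSemigroup ∣ a ∣ ∣ b ∣ (normR p) (normR q) ⟩
  ∣ a ∣ ℕ.+ normR p ℕ.+ (∣ b ∣ ℕ.+ normR q)       ∎
  where
  open ℕ.≤-Reasoning

normR-scale : ∀ c p → normR (map (c ℤ.*_) p) ≡ ∣ c ∣ ℕ.* normR p
normR-scale c []      = sym (ℕ.*-zeroʳ ∣ c ∣)
normR-scale c (a ∷ p) = trans (cong₂ ℕ._+_ (ℤ.abs-* c a) (normR-scale c p)) (sym (ℕ.*-distribˡ-+ ∣ c ∣ ∣ a ∣ (normR p)))

‖_‖ : Poly → ℕ
‖ f ‖ = normR (proj₁ f)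

‖+‖ : ∀ f g → ‖ f +P g ‖ ℕ.≤ ‖ f ‖ ℕ.+ ‖ g ‖
‖+‖ f g = subst (ℕ._≤ ‖ f ‖ ℕ.+ ‖ g ‖) (sym (normR-norm (addR (proj₁ f) (proj₁ g)))) (normR-addR (proj₁ f) (proj₁ g))

‖C*‖ : ∀ c f → ‖ C c *P f ‖ ≡ ∣ c ∣ ℕ.* ‖ f ‖
‖C*‖ c f = trans (cong ‖_‖ e) (trans (normR-norm (map (c ℤ.*_) (proj₁ f))) (normR-scale c (proj₁ f)))
  where
  e : C c *P f ≡ mkP (map (c ℤ.*_) (proj₁ f))
  e = ext λ i → trans ([C*] c f i) (sym (trans (mkP-[] (map (c ℤ.*_) (proj₁ f)) i) (coef-scale c (proj₁ f) i)))

‖split‖ : ∀ f → ‖ f ‖ ≡ ∣ f [ 0 ] ∣ ℕ.+ ‖ tl f ‖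
‖split‖ ([]    , _) = refl
‖split‖ (a ∷ l , _) = refl

tl-C+X* : ∀ a f → tl (C a +P X *P f) ≡ f
tl-C+X* a f = ext λ i → trans ([tl] (C a +P X *P f) i) ([C+X*]-suc a f i)

‖X*‖ : ∀ f → ‖ X *P f ‖ ≡ ‖ f ‖
‖X*‖ f = trans (cong ‖_‖ (sym (+P-identityˡ (X *P f)))) (trans (‖split‖ (C 0ℤ +P X *P f))
  (cong₂ (λ a g → ∣ a ∣ ℕ.+ ‖ g ‖) ([C+X*]-zero 0ℤ f) (tl-C+X* 0ℤ f)))

-- Subtracting g(0) R(0) g from R and dividing by X strictly decreases ‖hR‖
-- unless R(0) = 0; hence g divides every R.
module _ {f g h : Poly} (gh≡f : g *P h ≡ f) {ε : ℤ} (εε≡1 : ε ℤ.* ε ≡ 1ℤ) (g₀≡ε : g [ 0 ] ≡ ε)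
         (dominant : ‖ tl f ‖ ℕ.< ∣ f [ 0 ] ∣) where

  private
    reduce : ℤ → Poly → Poly
    reduce r R = R +P C (ℤ.- (ε ℤ.* r)) *P tl g

    reduce-eq : ∀ r R → g *P C (ε ℤ.* r) +P X *P reduce r R ≡ C r +P X *P R
    reduce-eq r R = begin
      g *P C (ε ℤ.* r) +P X *P (R +P C (ℤ.- (ε ℤ.* r)) *P tl g)
        ≡⟨ cong₂ (λ u v → u *P C (ε ℤ.* r) +P X *P (R +P v *P tl g))
             (trans (split g) (cong (λ a → C a +P X *P tl g) g₀≡ε)) (C-neg (ε ℤ.* r)) ⟩
      (C ε +P X *P tl g) *P C (ε ℤ.* r) +P X *P (R +P neg (C (ε ℤ.* r)) *P tl g)
        ≡⟨ solve 5 (λ e x t s R → (e :+ x :* t) :* s :+ x :* (R :+ (:- s) :* t) := e :* s :+ x :* R)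
             refl (C ε) X (tl g) (C (ε ℤ.* r)) R ⟩
      C ε *P C (ε ℤ.* r) +P X *P R
        ≡⟨ cong (_+P X *P R) (sym (C-* ε (ε ℤ.* r))) ⟩
      C (ε ℤ.* (ε ℤ.* r)) +P X *P R
        ≡⟨ cong (λ a → C a +P X *P R) (trans (sym (ℤ.*-assoc ε ε r)) (trans (cong (ℤ._* r) εε≡1) (ℤ.*-identityˡ r))) ⟩
      C r +P X *P R ∎
      where open ≡-Reasoning

    -- After multiplication by h, the subtracted multiple of g becomes a multiple of f = g h, so
    -- that the dominance of f(0) can be used.
    h*reduce : ∀ r R → h *P reduce r R ≡ tl (h *P (C r +P X *P R)) +P C (ℤ.- (ε ℤ.* r)) *P tl f
    h*reduce r R = ext λ i → begin
      (h *P reduce r R) [ i ]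
        ≡⟨ sym ([X*]-suc (h *P reduce r R) i) ⟩
      (X *P (h *P reduce r R)) [ suc i ]
        ≡⟨ cong (_[ suc i ]) eq ⟩
      (h *P (C r +P X *P R) +P C s *P f) [ suc i ]
        ≡⟨ [+] (h *P (C r +P X *P R)) (C s *P f) (suc i) ⟩
      (h *P (C r +P X *P R)) [ suc i ] ℤ.+ (C s *P f) [ suc i ]
        ≡⟨ cong₂ ℤ._+_ (sym ([tl] (h *P (C r +P X *P R)) i))
             (trans ([C*] s f (suc i)) (trans (cong (λ a → s ℤ.* a) (sym ([tl] f i))) (sym ([C*] s (tl f) i)))) ⟩
      tl (h *P (C r +P X *P R)) [ i ] ℤ.+ (C s *P tl f) [ i ]
        ≡⟨ sym ([+] (tl (h *P (C r +P X *P R))) (C s *P tl f) i) ⟩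
      (tl (h *P (C r +P X *P R)) +P C s *P tl f) [ i ] ∎
      where
      open ≡-Reasoning
      s = ℤ.- (ε ℤ.* r)
      eq : X *P (h *P reduce r R) ≡ h *P (C r +P X *P R) +P C s *P f
      eq = begin
        X *P (h *P reduce r R)
          ≡⟨ solve 5 (λ x h R g s → x :* (h :* R) := h :* (g :* s :+ x :* R) :+ (:- s) :* (g :* h))
               refl X h (reduce r R) g (C (ε ℤ.* r)) ⟩
        h *P (g *P C (ε ℤ.* r) +P X *P reduce r R) +P neg (C (ε ℤ.* r)) *P (g *P h)
          ≡⟨ cong₂ (λ u v → h *P u +P v) (reduce-eq r R) (cong₂ _*P_ (sym (C-neg (ε ℤ.* r))) gh≡f) ⟩
        h *P (C r +P X *P R) +P C s *P f ∎

    ∣ε∣≡1 : ∣ ε ∣ ≡ 1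
    ∣ε∣≡1 = ℕ.m*n≡1⇒m≡1 ∣ ε ∣ ∣ ε ∣ (trans (sym (ℤ.abs-* ε ε)) (cong ∣_∣ εε≡1))

    ∣ε*∣ : ∀ a → ∣ ε ℤ.* a ∣ ≡ ∣ a ∣
    ∣ε*∣ a = trans (ℤ.abs-* ε a) (trans (cong (ℕ._* ∣ a ∣) ∣ε∣≡1) (ℕ.*-identityˡ ∣ a ∣))

    ∣f₀∣≡∣h₀∣ : ∣ f [ 0 ] ∣ ≡ ∣ h [ 0 ] ∣
    ∣f₀∣≡∣h₀∣ = trans (cong (λ k → ∣ k [ 0 ] ∣) (sym gh≡f)) (trans (cong ∣_∣ ([*]-zero g h))
      (trans (cong (λ a → ∣ a ℤ.* h [ 0 ] ∣) g₀≡ε) (∣ε*∣ (h [ 0 ]))))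

    -- The reduction drops the constant term of h (r + X R), of absolute value |r| |f(0)|, and adds
    -- a polynomial of norm |r| ‖`tl f`‖, which is smaller.
    decreases : ∀ r R → r ≢ 0ℤ → ‖ h *P reduce r R ‖ ℕ.< ‖ h *P (C r +P X *P R) ‖
    decreases r R r≢0 = begin-strict
      ‖ h *P reduce r R ‖
        ≡⟨ cong ‖_‖ (h*reduce r R) ⟩
      ‖ tl hR +P C s *P tl f ‖
        ≤⟨ ‖+‖ (tl hR) (C s *P tl f) ⟩
      ‖ tl hR ‖ ℕ.+ ‖ C s *P tl f ‖
        ≡⟨ cong (‖ tl hR ‖ ℕ.+_) (trans (‖C*‖ s (tl f)) (cong (ℕ._* ‖ tl f ‖) (trans (ℤ.∣-i∣≡∣i∣ (ε ℤ.* r)) (∣ε*∣ r)))) ⟩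
      ‖ tl hR ‖ ℕ.+ ∣ r ∣ ℕ.* ‖ tl f ‖
        <⟨ ℕ.+-monoʳ-< ‖ tl hR ‖ (ℕ.*-monoʳ-< ∣ r ∣ ⦃ ℕ.≢-nonZero (λ z → r≢0 (ℤ.∣i∣≡0⇒i≡0 z)) ⦄ dominant) ⟩
      ‖ tl hR ‖ ℕ.+ ∣ r ∣ ℕ.* ∣ f [ 0 ] ∣
        ≡⟨ ℕ.+-comm ‖ tl hR ‖ (∣ r ∣ ℕ.* ∣ f [ 0 ] ∣) ⟩
      ∣ r ∣ ℕ.* ∣ f [ 0 ] ∣ ℕ.+ ‖ tl hR ‖
        ≡⟨ cong (ℕ._+ ‖ tl hR ‖) (sym hR₀) ⟩
      ∣ hR [ 0 ] ∣ ℕ.+ ‖ tl hR ‖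
        ≡⟨ sym (‖split‖ hR) ⟩
      ‖ hR ‖ ∎
      where
      open ℕ.≤-Reasoning
      s = ℤ.- (ε ℤ.* r)
      hR = h *P (C r +P X *P R)
      hR₀ : ∣ hR [ 0 ] ∣ ≡ ∣ r ∣ ℕ.* ∣ f [ 0 ] ∣
      hR₀ = trans (cong ∣_∣ (trans ([*]-zero h (C r +P X *P R)) (cong (λ a → h [ 0 ] ℤ.* a) ([C+X*]-zero r R))))
        (trans (ℤ.abs-* (h [ 0 ]) r) (trans (ℕ.*-comm ∣ h [ 0 ] ∣ ∣ r ∣) (cong (∣ r ∣ ℕ.*_) (sym ∣f₀∣≡∣h₀∣))))

    -- Two nested inductions: if r ≠ 0 the norm drops and N decreases; if r = 0 the norm stays the
    -- same, but the polynomial loses a factor X.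
    divides-below : ∀ N R → ‖ h *P R ‖ ℕ.< N → g ∣P R
    divides-below (suc N) = Poly-ind (λ R → ‖ h *P R ‖ ℕ.< suc N → g ∣P R)
      (λ _ → 0P , *P-comm g 0P) (λ r R IH small → step r R IH small (r ℤ.≟ 0ℤ))
      where
      step : ∀ r R → (‖ h *P R ‖ ℕ.< suc N → g ∣P R) → ‖ h *P (C r +P X *P R) ‖ ℕ.< suc N → Dec (r ≡ 0ℤ) →
             g ∣P C r +P X *P R
      step r R IH small (yes refl) = let k , e = IH (subst (ℕ._< suc N) same small) in
        X *P k , trans (solve 3 (λ g x k → g :* (x :* k) := con 0ℤ :+ x :* (g :* k)) refl g X k)
                   (cong (λ z → C 0ℤ +P X *P z) e)
        where
        same : ‖ h *P (C 0ℤ +P X *P R) ‖ ≡ ‖ h *P R ‖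
        same = trans (cong ‖_‖ (solve 3 (λ h x R → h :* (con 0ℤ :+ x :* R) := x :* (h :* R)) refl h X R)) (‖X*‖ (h *P R))
      step r R IH small (no r≢0) =
        let k , e = divides-below N (reduce r R) (ℕ.<-≤-trans (decreases r R r≢0) (ℕ.≤-pred small)) in
        C (ε ℤ.* r) +P X *P k
        , trans (solve 4 (λ g s x k → g :* (s :+ x :* k) := g :* s :+ x :* (g :* k)) refl g (C (ε ℤ.* r)) X k)
            (trans (cong (λ z → g *P C (ε ℤ.* r) +P X *P z) e) (reduce-eq r R))

  -- The classical reason: f has no complex root in the closed unit disc, so a nonconstant factor
  -- has a constant term of absolute value greater than 1. Here the descent is applied to R = 1
  -- instead.
  dominant⇒unitFactor : g ∣P 1P
  dominant⇒unitFactor = divides-below (suc ‖ h *P 1P ‖) 1P ℕ.≤-refl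

-- The constant terms of two factors multiply to the prime q, so one of them is ±1; that factor then
-- divides 1 and, being positive, equals 1.
dominantPrime⇒PrimeC : ∀ {f q} → Big f → Prime q → f [ 0 ] ≡ + q → ‖ tl f ‖ ℕ.< q → PrimeC f
dominantPrime⇒PrimeC {f} {q} big pq f₀≡q dominant =
  Data.Sum.[ (λ p → p) , (λ { (g , h , 1<g , 1<h , e) → ⊥-elim (absurd g h 1<g 1<h e) }) ]
    (prime-or-factors {f} (C<Big {f} 1ℤ big))
  where
  noUnit : ∀ g h → 1P <P g → g *P h ≡ f → ∣ g [ 0 ] ∣ ≢ 1
  noUnit g h 1<g e ∣g₀∣≡1 = <P-irrefl {1P} (subst (1P <P_) (∣1⇒≡1 {g} (1<⇒Pos {g} 1<g)
    (dominant⇒unitFactor {f} {g} {h} e (∣i∣≡1⇒i*i≡1 {g [ 0 ]} ∣g₀∣≡1) refl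
      (subst (‖ tl f ‖ ℕ.<_) (cong ∣_∣ (sym f₀≡q)) dominant))) 1<g)
  absurd : ∀ g h → 1P <P g → 1P <P h → g *P h ≡ f → ⊥
  absurd g h 1<g 1<h e = Data.Sum.[ noUnit g h 1<g e , (λ ∣g₀∣≡q → noUnit h g 1<h (trans (*P-comm h g) e)
      (ℕ.*-cancelˡ-≡ ∣ h [ 0 ] ∣ 1 q ⦃ ℕ.>-nonZero (ℕ.<-trans ℕ.z<s (1<prime pq)) ⦄
        (trans (cong (ℕ._* ∣ h [ 0 ] ∣) (sym ∣g₀∣≡q)) (trans g₀h₀≡q (sym (ℕ.*-identityʳ q)))))) ]
    (prime⇒irreducible pq (ℕ.divides ∣ h [ 0 ] ∣ (trans (sym g₀h₀≡q) (ℕ.*-comm ∣ g [ 0 ] ∣ ∣ h [ 0 ] ∣))))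
    where
    g₀h₀≡q : ∣ g [ 0 ] ∣ ℕ.* ∣ h [ 0 ] ∣ ≡ q
    g₀h₀≡q = trans (sym (ℤ.abs-* (g [ 0 ]) (h [ 0 ]))) (cong ∣_∣
      (trans (sym ([*]-zero g h)) (trans (cong (_[ 0 ]) e) f₀≡q)))

NoDivisorAbove : Poly → ℕ → Set
NoDivisorAbove n b = ∀ u q → b ℕ.< q → u [ 0 ] ≡ + q → ¬ (u ∣P n)

-- The bound is the absolute value of the lowest nonzero coefficient of n. A divisor u with u(0) ≠ 0
-- still divides n after powers of X are cancelled, and then u(0) divides that coefficient.
noDivisorAbove : ∀ n → n ≢ 0P → ∃ (NoDivisorAbove n)
noDivisorAbove = Poly-ind (λ n → n ≢ 0P → ∃ (NoDivisorAbove n)) (λ 0≢0 → ⊥-elim (0≢0 refl))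
  (λ a n IH ≢0 → step a n IH ≢0 (a ℤ.≟ 0ℤ))
  where
  head : ∀ {a n u w q} → u [ 0 ] ≡ + q → u *P w ≡ C a +P X *P n → + q ℤ.* w [ 0 ] ≡ a
  head {a} {n} {u} {w} u₀ e = trans (cong (ℤ._* w [ 0 ]) (sym u₀)) (trans (sym ([*]-zero u w))
    (trans (cong (_[ 0 ]) e) ([C+X*]-zero a n)))
  step : ∀ a n → (n ≢ 0P → ∃ (NoDivisorAbove n)) → C a +P X *P n ≢ 0P → Dec (a ≡ 0ℤ) → ∃ (NoDivisorAbove (C a +P X *P n))
  step a n IH ≢0 (no a≢0) = ∣ a ∣ , λ { u q a<q u₀ (w , e) → ℕ.<⇒≱ a<q (ℕ.∣⇒≤
    ⦃ ℕ.≢-nonZero (λ z → a≢0 (ℤ.∣i∣≡0⇒i≡0 z)) ⦄ (ℕ.divides ∣ w [ 0 ] ∣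
      (trans (cong ∣_∣ (sym (head {a} {n} {u} {w} u₀ e))) (trans (ℤ.abs-* (+ q) (w [ 0 ])) (ℕ.*-comm q ∣ w [ 0 ] ∣))))) }
  step .0ℤ n IH ≢0 (yes refl) = b , λ { u q b<q u₀ (w , e) → avoid u q b<q u₀ (tl w , shifted u w q b<q u₀ e) }
    where
    n≢0 : n ≢ 0P
    n≢0 n≡0 = ≢0 (trans (cong (λ n → C 0ℤ +P X *P n) n≡0) (*P-comm X 0P))
    b = proj₁ (IH n≢0)
    avoid = proj₂ (IH n≢0)
    shifted : ∀ u w q → b ℕ.< q → u [ 0 ] ≡ + q → u *P w ≡ C 0ℤ +P X *P n → u *P tl w ≡ n
    shifted u w q b<q u₀ e = X*-cancel {u *P tl w} {n} (begin
      X *P (u *P tl w)                     ≡⟨ solve 3 (λ x u w → x :* (u :* w) := u :* (con 0ℤ :+ x :* w)) refl X u (tl w) ⟩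
      u *P (C 0ℤ +P X *P tl w)             ≡⟨ cong (λ a → u *P (C a +P X *P tl w)) (sym w₀≡0) ⟩
      u *P (C (w [ 0 ]) +P X *P tl w)      ≡⟨ cong (u *P_) (sym (split w)) ⟩
      u *P w                               ≡⟨ e ⟩
      C 0ℤ +P X *P n                       ≡⟨ +P-identityˡ (X *P n) ⟩
      X *P n                               ∎)
      where
      open ≡-Reasoning
      w₀≡0 : w [ 0 ] ≡ 0ℤ
      w₀≡0 = Data.Sum.[ (λ q≡0 → ⊥-elim (ℕ.n≮0 (subst (b ℕ.<_) (ℤ.+-injective q≡0) b<q))) , (λ z → z) ]
        (ℤ.i*j≡0⇒i≡0∨j≡0 (+ q) (head {0ℤ} {n} {u} {w} u₀ e))

primeAbove : ∀ N → ∃ λ q → Prime q × N ℕ.< q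
primeAbove N = let q , pq , q∣ = primeDivisor (N ! ℕ.+ 1) (ℕ.+-monoˡ-≤ 1 (ℕ.1≤n! N)) in
  q , pq , ℕ.≰⇒> λ q≤N → ℕ.<⇒≱ (1<prime pq)
    (ℕ.∣⇒≤ (ℕ.∣m+n∣m⇒∣n q∣ (∣! (ℕ.<-trans ℕ.z<s (1<prime pq)) q≤N)))

i≤∣i∣ : ∀ i → i ℤ.≤ + ∣ i ∣
i≤∣i∣ (+ n)    = ℤ.≤-refl
i≤∣i∣ -[1+ n ] = ℤ.-≤+

-- The constant term of p + j is made a prime larger than B, than the sum of the
-- other coefficients, and than the bound of noDivisorAbove.
primeTranslate : ∀ p → Big p → ∀ n → n ≢ 0P → ∀ B →
  ∃ λ j → B ℕ.< j × PrimeC (p +P C (+ j)) × ¬ (p +P C (+ j) ∣P n)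
primeTranslate p big n n≢0 B = ∣ j ∣ , B<j
  , dominantPrime⇒PrimeC {u} {q} (Big-+C {p} (+ ∣ j ∣) big) pq u₀
      (subst (λ t → ‖ t ‖ ℕ.< q) (sym tl-u) (ℕ.≤-<-trans (ℕ.≤-trans (ℕ.m≤m+n ‖ tl p ‖ b) (ℕ.m≤n+m (‖ tl p ‖ ℕ.+ b) (a ℕ.+ B))) M<q))
  , avoid u q (ℕ.≤-<-trans (ℕ.≤-trans (ℕ.m≤n+m b ‖ tl p ‖) (ℕ.m≤n+m (‖ tl p ‖ ℕ.+ b) (a ℕ.+ B))) M<q) u₀
  where
  b = proj₁ (noDivisorAbove n n≢0)
  avoid = proj₂ (noDivisorAbove n n≢0)
  a = ∣ p [ 0 ] ∣
  M = a ℕ.+ B ℕ.+ (‖ tl p ‖ ℕ.+ b)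
  q = proj₁ (primeAbove M)
  pq = proj₁ (proj₂ (primeAbove M))
  M<q : M ℕ.< q
  M<q = proj₂ (proj₂ (primeAbove M))
  j = + q ℤ.- p [ 0 ]
  a+B<q : a ℕ.+ B ℕ.< q
  a+B<q = ℕ.≤-<-trans (ℕ.m≤m+n (a ℕ.+ B) (‖ tl p ‖ ℕ.+ b)) M<q
  +B<j : + B ℤ.< j
  +B<j = ℤ.<-≤-trans (subst (ℤ._< + q ℤ.- + a) (lem (+ a) (+ B)) (ℤ.+-monoˡ-< (ℤ.- + a) (subst (ℤ._< + q) (ℤ.pos-+ a B) (+<+ a+B<q))))
           (ℤ.+-monoʳ-≤ (+ q) (ℤ.neg-mono-≤ (i≤∣i∣ (p [ 0 ]))))
    where
    lem : ∀ a B → a ℤ.+ B ℤ.- a ≡ B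
    lem = solve-∀
  +∣j∣≡j : + ∣ j ∣ ≡ j
  +∣j∣≡j = ℤ.0≤i⇒+∣i∣≡i (ℤ.≤-trans (ℤ.+≤+ z≤n) (ℤ.<⇒≤ +B<j))
  B<j : B ℕ.< ∣ j ∣
  B<j = ℤ.drop‿+<+ (subst (+ B ℤ.<_) (sym +∣j∣≡j) +B<j)
  u = p +P C (+ ∣ j ∣)
  u₀ : u [ 0 ] ≡ + q
  u₀ = trans ([+] p (C (+ ∣ j ∣)) 0) (trans (cong (λ z → p [ 0 ] ℤ.+ z) (trans (C-zero (+ ∣ j ∣)) +∣j∣≡j)) (lem (p [ 0 ]) (+ q)))
    where
    lem : ∀ a q → a ℤ.+ (q ℤ.- a) ≡ q
    lem = solve-∀
  tl-u : tl u ≡ tl p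
  tl-u = ext λ i → trans ([tl] u i) (trans ([+] p (C (+ ∣ j ∣)) (suc i))
    (trans (cong (λ z → p [ suc i ] ℤ.+ z) (C-suc (+ ∣ j ∣) i)) (trans (ℤ.+-identityʳ (p [ suc i ])) (sym ([tl] p i)))))

-- The largest good element

LargestGood : Poly → Poly → Set
LargestGood p n = InC n × GoodC p n × (∀ m → InC m → n <P m → ¬ GoodC p m)

module _ {P : ℕ → Set} (P? : ∀ n → Dec (P n)) where

  largest : ∀ N → P 0 → (∀ n → N ℕ.≤ n → ¬ P n) → ∃ λ n → P n × ∀ m → n ℕ.< m → ¬ P m
  largest zero    p0 none = ⊥-elim (none 0 z≤n p0)
  largest (suc N) p0 none = byCases (P? N)
    where
    byCases : Dec (P N) → ∃ λ n → P n × ∀ m → n ℕ.< m → ¬ P m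
    byCases (yes p) = N , p , none
    byCases (no ¬p) = largest N p0 λ n N≤n → Data.Sum.[ none n , (λ e → subst (λ n → ¬ P n) e ¬p) ] (ℕ.m≤n⇒m<n∨m≡n N≤n)

  least : ∀ N → P N → ∃ λ n → P n × ∀ m → m ℕ.< n → ¬ P m
  least N p = search N N ℕ.≤-refl p
    where
    search : ∀ b N → N ℕ.≤ b → P N → ∃ λ n → P n × ∀ m → m ℕ.< n → ¬ P m
    search b N N≤b p with ℕ.anyUpTo? P? N
    search b       N _   p | no ¬q = N , p , λ m m<N q → ¬q (m , m<N , q)
    search zero    N N≤b p | yes (m , m<N , q) = ⊥-elim (ℕ.n≮0 (ℕ.<-≤-trans m<N N≤b))
    search (suc b) N N≤b p | yes (m , m<N , q) = search b m (ℕ.≤-pred (ℕ.<-≤-trans m<N N≤b)) q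

-- Constant p

C-InC : ∀ n → InC (C (+ n))
C-InC zero    = inj₁ refl
C-InC (suc n) = Pos⇒InC {C (+ suc n)} (Pos-C {+ suc n} (+<+ ℕ.z<s))

C<C⁻¹-ℕ : ∀ {m n} → C (+ m) <P C (+ n) → m ℕ.< n
C<C⁻¹-ℕ {m} {n} h = ℤ.drop‿+<+ (C<C⁻¹ {+ m} {+ n} h)

C-*-ℕ : ∀ m n → C (+ (m ℕ.* n)) ≡ C (+ m) *P C (+ n)
C-*-ℕ m n = trans (cong C (ℤ.pos-* m n)) (C-* (+ m) (+ n))

C∣C⇒∣ : ∀ {q n} → C (+ q) ∣P C (+ n) → q ℕ.∣ n
C∣C⇒∣ {q} {n} (z , e) = ℕ.divides ∣ z [ 0 ] ∣ (trans (cong ∣_∣ n≡) (trans (ℤ.abs-* (+ q) (z [ 0 ])) (ℕ.*-comm q ∣ z [ 0 ] ∣)))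
  where
  n≡ : + n ≡ + q ℤ.* z [ 0 ]
  n≡ = trans (sym (C-zero (+ n))) (trans (cong (_[ 0 ]) (sym e)) ([C*] (+ q) z 0))

largestGood-C : ∀ k → ∃ (LargestGood (C (+ k)))
largestGood-C k = C (+ n) , C-InC n , good , notGood
  where
  N = proj₁ (eventually-hasPrimeSquare k)
  -- No q lies below 0, so 0 can start the search. The double negation is removed later by deciding
  -- `HasPrimeSquare`.
  max : ∃ λ n → ¬ HasPrimeSquare k n × ∀ m → n ℕ.< m → ¬ ¬ HasPrimeSquare k m
  max = largest (λ n → ¬? (hasPrimeSquare? k n)) N (λ { (q , () , _) })
    (λ n N≤n ¬h → ¬h (proj₂ (eventually-hasPrimeSquare k) n N≤n))
  n = proj₁ max
  good : GoodC (C (+ k)) (C (+ n))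
  good = noSquare⇒Good {C (+ k)} {C (+ n)} (C-InC n) λ q pq k<q q∤n qq<n →
      byCases q pq k<q q∤n qq<n (Pos-cases {q} (PrimeC⇒Pos {q} pq))
    where
    byCases : ∀ q → PrimeC q → C (+ k) <P q → ¬ (q ∣P C (+ n)) → q *P q <P C (+ n) → (∃ λ i → q ≡ C (+ suc i)) ⊎ Big q → ⊥
    byCases q pq _ _ qq<n (inj₂ big) =
      <P-asym {q *P q} {C (+ n)} qq<n (C<Big {q *P q} (+ n) (Big-* {q} {q} (PrimeC⇒Pos {q} pq) big))
    byCases .(C (+ suc i)) pq k<q q∤n qq<n (inj₁ (i , refl)) = proj₁ (proj₂ max)
        (q , ℕ.≤-<-trans (ℕ.m≤m*n q q) q²<n , prime-C⁻¹ {q} pq , C<C⁻¹-ℕ {k} {q} k<q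
        , (λ q∣n → q∤n (∣⇒C∣ (+ n) q∣n)) , q²<n)
      where
      q = suc i
      q²<n : q ℕ.* q ℕ.< n
      q²<n = C<C⁻¹-ℕ {q ℕ.* q} {n} (subst (_<P C (+ n)) (sym (C-*-ℕ q q)) qq<n)
  notGood : ∀ m → InC m → C (+ n) <P m → ¬ GoodC (C (+ k)) m
  notGood m m∈ n<m = Data.Sum.[ (λ { (i , refl) → constant i n<m }) , nonconstant ]
      (Pos-cases {m} (Data.Sum.[ (λ m≡0 → ⊥-elim (negative (subst (C (+ n) <P_) m≡0 n<m))) , (λ m>0 → m>0) ]′ (InC-cases {m} m∈)))
    where
    negative : ¬ (C (+ n) <P 0P)
    negative h = ℕ.n≮0 (C<C⁻¹-ℕ {n} {0} h)
    constant : ∀ i → C (+ n) <P C (+ suc i) → ¬ GoodC (C (+ k)) (C (+ suc i))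
    constant i n<m =
      let q , _ , pq , k<q , q∤m , q²<m = decidable-stable (hasPrimeSquare? k (suc i))
            (proj₂ (proj₂ max) (suc i) (C<C⁻¹-ℕ {n} {suc i} n<m))
      in square⇒¬Good {C (+ k)} {C (+ suc i)} {C (+ q)} (prime-C pq) (C<C {+ k} {+ q} (+<+ k<q))
           (λ d → q∤m (C∣C⇒∣ {q} {suc i} d))
           (subst (_<P C (+ suc i)) (C-*-ℕ q q) (C<C {+ (q ℕ.* q)} {+ suc i} (+<+ q²<m)))
    -- A constant prime that is large enough does not divide m, and its square, again a constant,
    -- lies below m.
    nonconstant : Big m → ¬ GoodC (C (+ k)) m
    nonconstant big =
      let b , avoid = noDivisorAbove m (Pos⇒≢0 {m} (Big⇒Pos {m} big))
          q , pq , bk<q = primeAbove (b ℕ.+ k)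
      in square⇒¬Good {C (+ k)} {m} {C (+ q)} (prime-C pq)
           (C<C {+ k} {+ q} (+<+ (ℕ.≤-<-trans (ℕ.m≤n+m k b) bk<q)))
           (avoid (C (+ q)) q (ℕ.≤-<-trans (ℕ.m≤m+n b k) bk<q) (C-zero (+ q)))
           (subst (_<P m) (C-*-ℕ q q) (C<Big {m} (+ (q ℕ.* q)) big))

-- Nonconstant p

2≤P : ∀ {c} → 1P <P c → 1P +P 1P ≤P c
2≤P {c} 1<c = byDifference (<P-elim {1P} {c} 1<c)
  where
  byDifference : (∃ λ d → Pos d × c ≡ 1P +P d) → 1P +P 1P ≤P c
  byDifference (d , d>0 , c≡) = Data.Sum.[ (λ d≡1 → inj₂ (sym (trans c≡ (cong (1P +P_) d≡1))))
    , (λ 1<d → let d′ , d′>0 , d≡ = <P-elim {1P} {d} 1<d in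
        inj₁ (<P-intro {1P +P 1P} {c} {d′} d′>0 (trans c≡ (trans (cong (1P +P_) d≡) (sym (+P-assoc 1P 1P d′)))))) ]′
    (Pos⇒1≤ {d} d>0)

+C-mono-< : ∀ p {i j} → i ℕ.< j → p +P C (+ i) <P p +P C (+ j)
+C-mono-< p {i} {j} i<j with <P-elim {C (+ i)} {C (+ j)} (C<C {+ i} {+ j} (+<+ i<j))
... | d , d>0 , e = <P-intro {p +P C (+ i)} {p +P C (+ j)} {d} d>0
  (trans (cong (p +P_) e) (sym (+P-assoc p (C (+ i)) d)))

-- The lower bound is strict, so the search from 0 starts above p itself.
IsNextPrime : Poly → ℕ → ℕ → Set
IsNextPrime p i j = (i ℕ.< j × PrimeC (p +P C (+ j))) × ∀ k → k ℕ.< j → ¬ (i ℕ.< k × PrimeC (p +P C (+ k)))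

nextPrime : ∀ p → Big p → ∀ i → ∃ (IsNextPrime p i)
nextPrime p big i =
  -- Any prime translate beyond i bounds the search, so 1 serves as a default for the element to be
  -- avoided.
  let j , i<j , pj , _ = primeTranslate p big 1P (λ ()) i in
  least (λ j → (i ℕ.<? j) ×-dec primeC? {p +P C (+ j)} (C<Big {p +P C (+ j)} 1ℤ (Big-+C {p} (+ j) big))) j (i<j , pj)

module Nonconstant {p : Poly} (big : Big p) {j₁ j₂ : ℕ}
  (next₁ : IsNextPrime p 0 j₁) (next₂ : IsNextPrime p j₁ j₂) where

  translate : ℕ → Poly
  translate j = p +P C (+ j)

  translate-Big : ∀ j → Big (translate j)
  translate-Big j = Big-+C {p} (+ j) big

  p<translate : ∀ {j} → 0 ℕ.< j → p <P translate j
  p<translate {j} 0<j = <P-intro {p} {translate j} {C (+ j)} (Pos-C {+ j} (+<+ 0<j)) refl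

  u₁ = translate j₁
  u₂ = translate j₂

  0<j₁ : 0 ℕ.< j₁
  0<j₁ = proj₁ (proj₁ next₁)
  j₁<j₂ : j₁ ℕ.< j₂
  j₁<j₂ = proj₁ (proj₁ next₂)
  u₁-prime : PrimeC u₁
  u₁-prime = proj₂ (proj₁ next₁)
  u₂-prime : PrimeC u₂
  u₂-prime = proj₂ (proj₁ next₂)
  u₁>0 : Pos u₁
  u₁>0 = PrimeC⇒Pos {u₁} u₁-prime
  u₂>0 : Pos u₂
  u₂>0 = PrimeC⇒Pos {u₂} u₂-prime

  -- The difference q - p is a positive constant, and then q is a translate covered by the
  -- minimality of j₁ and j₂, or it is nonconstant and exceeds j₂.
  u₂-least : ∀ q → PrimeC q → p <P q → q ≢ u₁ → u₂ ≤P q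
  u₂-least q pq p<q q≢u₁ = byDifference (<P-elim {p} {q} p<q)
    where
    fromTranslate : ∀ i → q ≡ translate (suc i) → u₂ ≤P q
    fromTranslate i q≡ = byPosition (ℕ.<-cmp j₁ (suc i))
      where
      prime : PrimeC (translate (suc i))
      prime = subst PrimeC q≡ pq
      byPosition : Tri (j₁ ℕ.< suc i) (j₁ ≡ suc i) (suc i ℕ.< j₁) → u₂ ≤P q
      byPosition (tri> _ _ i<j₁) = ⊥-elim (proj₂ next₁ (suc i) i<j₁ (ℕ.z<s , prime))
      byPosition (tri≈ _ j₁≡i _) = ⊥-elim (q≢u₁ (trans q≡ (cong translate (sym j₁≡i))))
      byPosition (tri< j₁<i _ _) = Data.Sum.[
          (λ lt → inj₁ (subst (u₂ <P_) (sym q≡) (+C-mono-< p lt)))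
        , (λ eq → inj₂ (trans (cong translate eq) (sym q≡))) ]′
        (ℕ.m≤n⇒m<n∨m≡n (ℕ.≮⇒≥ λ i<j₂ → proj₂ next₂ (suc i) i<j₂ (j₁<i , prime)))
    fromBig : ∀ d → q ≡ p +P d → (∃ λ d′ → Pos d′ × d ≡ C (+ j₂) +P d′) → u₂ ≤P q
    fromBig d q≡ (d′ , d′>0 , d≡) = inj₁ (<P-intro {u₂} {q} {d′} d′>0
      (trans q≡ (trans (cong (p +P_) d≡) (sym (+P-assoc p (C (+ j₂)) d′)))))
    byDifference : (∃ λ d → Pos d × q ≡ p +P d) → u₂ ≤P q
    byDifference (d , d>0 , q≡) = Data.Sum.[
        (λ { (i , d≡) → fromTranslate i (trans q≡ (cong (p +P_) d≡)) })
      , (λ big-d → fromBig d q≡ (<P-elim {C (+ j₂)} {d} (C<Big {d} (+ j₂) big-d))) ]′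
      (Pos-cases {d} d>0)

  e = j₂ ℕ.∸ j₁
  ε = C (+ e)

  ε>0 : Pos ε
  ε>0 = Pos-C {+ e} (+<+ (ℕ.m<n⇒0<n∸m j₁<j₂))

  u₂≡ : u₂ ≡ u₁ +P ε
  u₂≡ = begin
    p +P C (+ j₂)               ≡⟨ cong (λ k → p +P C (+ k)) (sym (ℕ.m+[n∸m]≡n (ℕ.<⇒≤ j₁<j₂))) ⟩
    p +P C (+ (j₁ ℕ.+ e))       ≡⟨ cong (p +P_) (trans (cong C (ℤ.pos-+ j₁ e)) (C-+ (+ j₁) (+ e))) ⟩
    p +P (C (+ j₁) +P ε)        ≡⟨ sym (+P-assoc p (C (+ j₁)) ε) ⟩
    u₁ +P ε                     ∎
    where open ≡-Reasoning

  -- u₁(2u₂ − u₁) = u₂² − (u₂ − u₁)², the largest multiple of u₁ below u₂².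
  n₀ = u₁ *P (u₁ +P (ε +P ε))

  n₀>0 : Pos n₀
  n₀>0 = Pos-* {u₁} {u₁ +P (ε +P ε)} u₁>0 (Pos-+ {u₁} {ε +P ε} u₁>0 (Pos-+ {ε} {ε} ε>0 ε>0))

  u₂²≡ : u₂ *P u₂ ≡ n₀ +P ε *P ε
  u₂²≡ = trans (cong (λ u → u *P u) u₂≡)
    (solve 2 (λ u e → (u :+ e) :* (u :+ e) := u :* (u :+ (e :+ e)) :+ e :* e) refl u₁ ε)

  n₀<u₂² : n₀ <P u₂ *P u₂
  n₀<u₂² = <P-intro {n₀} {u₂ *P u₂} {ε *P ε} (Pos-* {ε} {ε} ε>0 ε>0) u₂²≡

  u₁²<n₀ : u₁ *P u₁ <P n₀
  u₁²<n₀ = *P-monoʳ-< u₁ {u₁} {u₁ +P (ε +P ε)} u₁>0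
    (<P-intro {u₁} {u₁ +P (ε +P ε)} {ε +P ε} (Pos-+ {ε} {ε} ε>0 ε>0) refl)

  good : GoodC p n₀
  good = noSquare⇒Good {p} {n₀} (Pos⇒InC {n₀} n₀>0) λ q pq p<q q∤n₀ qq<n₀ →
    let u₂≤q = u₂-least q pq p<q (λ q≡u₁ → q∤n₀ (subst (_∣P n₀) (sym q≡u₁) (u₁ +P (ε +P ε) , refl))) in
    ≤⇒≯P {u₂ *P u₂} {q *P q} (*P-mono-≤ {u₂} {q} {u₂} {q} u₂>0 (PrimeC⇒Pos {q} pq) u₂≤q u₂≤q)
      (<P-trans {q *P q} {n₀} {u₂ *P u₂} qq<n₀ n₀<u₂²)

  -- The difference is p(p + k) + l with constants k and l, where j enters only through these
  -- constants. The product p(p + k) is nonconstant and outweighs l.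
  translate²<2u₁u₂ : ∀ j → translate j *P translate j <P u₁ *P (u₂ *P (1P +P 1P))
  translate²<2u₁u₂ j = <P-intro {translate j *P translate j} {u₁ *P (u₂ *P (1P +P 1P))} {gap}
    (Big⇒Pos {gap} (Big-+C {p *P (p +P C k)} l (Big-* {p} {p +P C k} (Big⇒Pos {p} big) (Big-+C {p} k big)))) eq
    where
    a = + j₁
    b = + j₂
    c = + j
    k = (a ℤ.+ a) ℤ.+ (b ℤ.+ b) ℤ.+ ℤ.- (c ℤ.+ c)
    l = (a ℤ.+ a) ℤ.* b ℤ.+ ℤ.- (c ℤ.* c)
    gap = p *P (p +P C k) +P C l
    Ck : C k ≡ (C a +P C a) +P (C b +P C b) +P neg (C c +P C c)
    Ck = trans (C-+ ((a ℤ.+ a) ℤ.+ (b ℤ.+ b)) (ℤ.- (c ℤ.+ c))) (cong₂ _+P_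
      (trans (C-+ (a ℤ.+ a) (b ℤ.+ b)) (cong₂ _+P_ (C-+ a a) (C-+ b b)))
      (trans (C-neg (c ℤ.+ c)) (cong neg (C-+ c c))))
    Cl : C l ≡ (C a +P C a) *P C b +P neg (C c *P C c)
    Cl = trans (C-+ ((a ℤ.+ a) ℤ.* b) (ℤ.- (c ℤ.* c))) (cong₂ _+P_
      (trans (C-* (a ℤ.+ a) b) (cong (_*P C b) (C-+ a a)))
      (trans (C-neg (c ℤ.* c)) (cong neg (C-* c c))))
    eq : u₁ *P (u₂ *P (1P +P 1P)) ≡ translate j *P translate j +P gap
    eq = trans
      (solve 4 (λ p a b c → (p :+ a) :* ((p :+ b) :* (con 1ℤ :+ con 1ℤ)) :=
          (p :+ c) :* (p :+ c) :+ (p :* (p :+ ((a :+ a) :+ (b :+ b) :+ (:- (c :+ c)))) :+ ((a :+ a) :* b :+ (:- (c :* c)))))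
        refl p (C a) (C b) (C c))
      (cong₂ (λ x y → translate j *P translate j +P (p *P (p +P x) +P y)) (sym Ck) (sym Cl))

  notGood : ∀ m → n₀ <P m → ¬ GoodC p m
  notGood m n₀<m good-m = square⇒¬Good {p} {m} {u₁} u₁-prime (p<translate 0<j₁) u₁∤m
      (<P-trans {u₁ *P u₁} {n₀} {m} u₁²<n₀ n₀<m) good-m
    where
    m>0 : Pos m
    m>0 = 0<⇒Pos {m} (<P-trans {0P} {n₀} {m} (Pos⇒0< {n₀} n₀>0) n₀<m)
    u₁∤m : ¬ (u₁ ∣P m)
    u₁∤m (w , u₁w≡m) = square⇒¬Good {p} {m} {u₂} u₂-prime (p<translate (ℕ.<-trans 0<j₁ j₁<j₂)) u₂∤m u₂²<m good-m
      where
      w>0 : Pos w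
      w>0 = Pos-factor {u₁} {w} u₁>0 (subst Pos (sym u₁w≡m) m>0)
      w₀ = u₁ +P (ε +P ε)
      w₀<w : w₀ <P w
      w₀<w = Data.Sum.[ (λ w≤w₀ → ⊥-elim (≤⇒≯P {m} {n₀} (subst (_≤P n₀) u₁w≡m (*P-monoʳ-≤ u₁ {w} {w₀} u₁>0 w≤w₀)) n₀<m))
                      , (λ lt → lt) ]′ (≤-or-> w w₀)
      d = proj₁ (<P-elim {w₀} {w} w₀<w)
      d>0 : Pos d
      d>0 = proj₁ (proj₂ (<P-elim {w₀} {w} w₀<w))
      w≡ : w ≡ w₀ +P d
      w≡ = proj₂ (proj₂ (<P-elim {w₀} {w} w₀<w))
      -- The excess of m over n₀ is d u₁, which is nonconstant, while u₂² exceeds n₀ only by the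
      -- constant ε².
      ε²<du₁ : ε *P ε <P d *P u₁
      ε²<du₁ = subst (_<P d *P u₁) (C-* (+ e) (+ e)) (C<Big {d *P u₁} (+ e ℤ.* + e) (Big-* {d} {u₁} d>0 (translate-Big j₁)))
      u₂²<m : u₂ *P u₂ <P m
      u₂²<m = let d′ , d′>0 , eq = <P-elim {ε *P ε} {d *P u₁} ε²<du₁ in
        <P-intro {u₂ *P u₂} {m} {d′} d′>0 (m≡ d′ eq)
        where
        open ≡-Reasoning
        m≡ : ∀ d′ → d *P u₁ ≡ ε *P ε +P d′ → m ≡ u₂ *P u₂ +P d′
        m≡ d′ eq = begin
          m                          ≡⟨ sym u₁w≡m ⟩
          u₁ *P w                    ≡⟨ cong (u₁ *P_) w≡ ⟩
          u₁ *P (w₀ +P d)            ≡⟨ solve 3 (λ u w d → u :* (w :+ d) := u :* w :+ d :* u) refl u₁ w₀ d ⟩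
          n₀ +P d *P u₁              ≡⟨ cong (n₀ +P_) eq ⟩
          n₀ +P (ε *P ε +P d′)       ≡⟨ sym (+P-assoc n₀ (ε *P ε) d′) ⟩
          n₀ +P ε *P ε +P d′         ≡⟨ cong (_+P d′) (sym u₂²≡) ⟩
          u₂ *P u₂ +P d′             ∎
      u₂<w : u₂ <P w
      u₂<w = <P-trans {u₂} {w₀} {w} (<P-intro {u₂} {w₀} {ε} ε>0
        (trans (sym (+P-assoc u₁ ε ε)) (cong (_+P ε) (sym u₂≡)))) w₀<w
      -- Because u₂ < w, a quotient of w by u₂ is at least 2; this yields m ≥ 2 u₁ u₂.
      1<quotient : ∀ c → u₂ *P c ≡ w → 1P <P c
      1<quotient c u₂c≡w = Data.Sum.[ (λ c≡1 → ⊥-elim (<P-irrefl {u₂} (subst (u₂ <P_)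
              (trans (sym u₂c≡w) (trans (cong (u₂ *P_) c≡1) (*P-identityʳ u₂))) u₂<w))) , (λ lt → lt) ]′
        (Pos⇒1≤ {c} (Pos-factor {u₂} {c} u₂>0 (subst Pos (sym u₂c≡w) w>0)))
      u₂∤w : ¬ (u₂ ∣P w)
      u₂∤w (c , u₂c≡w) =
        let j , 0<j , pj , j∤m = primeTranslate p big m (Pos⇒≢0 {m} m>0) 0 in
        square⇒¬Good {p} {m} {translate j} pj (p<translate 0<j) j∤m
          (<-≤P-trans {translate j *P translate j} {u₁ *P (u₂ *P (1P +P 1P))} {m} (translate²<2u₁u₂ j)
            (subst (u₁ *P (u₂ *P (1P +P 1P)) ≤P_) (trans (cong (u₁ *P_) u₂c≡w) u₁w≡m)
              (*P-monoʳ-≤ u₁ {u₂ *P (1P +P 1P)} {u₂ *P c} u₁>0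
                (*P-monoʳ-≤ u₂ {1P +P 1P} {c} u₂>0 (2≤P {c} (1<quotient c u₂c≡w))))))
          good-m
      u₂∤m : ¬ (u₂ ∣P m)
      u₂∤m u₂∣m = Data.Sum.[ (λ u₂∣u₁ → ≤⇒≯P {u₂} {u₁} (∣⇒≤P {u₂} {u₁} u₂>0 u₁>0 u₂∣u₁) (+C-mono-< p j₁<j₂)) , u₂∤w ]
        (PrimeC-euclid {u₂} {u₁} {w} u₂-prime u₁>0 w>0 (subst (u₂ ∣P_) (sym u₁w≡m) u₂∣m))

  largestGood-Big : ∃ (LargestGood p)
  largestGood-Big = n₀ , Pos⇒InC {n₀} n₀>0 , good , λ m _ → notGood m

theorem6p1 : ∀ p → InC p → PrimeC p →
    Σ Poly (λ n → InC n × GoodC p n × (∀ m → InC m → n <P m → ¬ GoodC p m))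
theorem6p1 p _ pp = byCases (Pos-cases {p} (PrimeC⇒Pos {p} pp))
  where
  byCases : (∃ λ k → p ≡ C (+ suc k)) ⊎ Big p → ∃ (LargestGood p)
  byCases (inj₁ (k , p≡)) = subst (λ p → ∃ (LargestGood p)) (sym p≡) (largestGood-C (suc k))
  byCases (inj₂ big)      = Nonconstant.largestGood-Big {p} big (proj₂ next₁) (proj₂ (nextPrime p big (proj₁ next₁)))
    where next₁ = nextPrime p big 0
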